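{- Let $n\ge 0$ be an integer and let $F$ be a filter (upper order ideal) of the poset $I_{n}^{\bullet}$ of pointed integer partitions of $n$. Then the M\"obius function of the poset $\Pi_{n}^{\bullet}(F)\cup\{\hat{0}\}$ satisfies $$\mu\left(\Pi_{n}^{\bullet}(F)\cup\{\hat{0}\}\right)=\sum_{\vec{c}\in C_{n}^{\bullet}(F)}(-1)^{\rho(\vec{c},\hat{1})}\cdot\mu_{C_{n}^{\bullet}(F)\cup\{\hat{0}\}}(\hat{0},\vec{c})\cdot\beta(\vec{c}).$$
   Context: A pointed integer partition of $n$ is a pair $\{\lambda,\underline{m}\}=\{\lambda_1,\ldots,\lambda_k,\underline{m}\}$ where $m\ge 0$ is an integer (the pointed part) and $\lambda=\{\lambda_1,\ldots,\lambda_k\}$ is an integer partition (multiset of positive integers) of $n-m$. $I_n^{\bullet}$ is the set of these, partially ordered by the cover relations $\{\ldots,\lambda_{k-1},\lambda_k,\underline{m}\}\prec\{\ldots,\lambda_{k-1}+\lambda_k,\underline{m}\}$ (merge two ordinary parts) and $\{\ldots,\lambda_{k-1},\lambda_k,\underline{m}\}\prec\{\ldots,\lambda_{k-1},\underline{\lambda_k+m}\}$ (merge an ordinary part into the pointed part). A filter $F$ of a poset is a subset such that $x\in F$, $x\le y$ imply $y\in F$. A pointed set partition of $\{1,\ldots,n\}$ is a pair $(\sigma,Z)$ with $Z\subseteq\{1,\ldots,n\}$ (the zero block, possibly empty) and $\sigma$ a set partition of $\{1,\ldots,n\}-Z$. $\Pi_n^{\bullet}$ is the poset of these ordered by refinement: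 $\pi\le\pi'$ iff every block of $\pi$ is contained in some block (possibly the zero block) of $\pi'$ and the zero block of $\pi$ is contained in the zero block of $\pi'$. The type of $(\sigma,Z)$ is the pointed integer partition $\{\{|B|:B\in\sigma\},\underline{|Z|}\}$. Define $\Pi_n^{\bullet}(F)=\{\pi\in\Pi_n^{\bullet}:\mathrm{type}(\pi)\in F\}$. A pointed composition of $n$ is a list $\vec c=(c_1,\ldots,c_{k-1},\underline{c_k})$ of non-negative integers with sum $n$, where $c_1,\ldots,c_{k-1}$ are positive and $c_k\ge 0$. $C_n^{\bullet}$ is the set of these, ordered by the cover relations of adding two adjacent entries: $(\ldots,c_j,c_{j+1},\ldots,\underline{c_k})\prec(\ldots,c_j+c_{j+1},\ldots,\underline{c_k})$ and $(\ldots,c_{k-1},\underline{c_k})\prec(\ldots,\underline{c_{k-1}+c_k})$. The type of $\vec c$ is the pointed integer partition $\{c_1,\ldots,c_{k-1},\underline{c_k}\}$. Define $C_n^{\bullet}(F)=\{\vec c\in C_n^{\bullet}:\mathrm{type}(\vec c)\in F\}$. For a poset $P$, $P\cup\{\hat 0\}$ denotes $P$ with a new minimum adjoined; $\hat 1$ denotes the maximum $(\underline{n})$ of $C_n^{\bullet}(F)\cup\{\hat0\}$ (and the maximum of $\Pi_n^\bullet(F)\cup\{\hat0\}$, the pointed partition with zero block $\{1,\dots,n\}$), and for a poset $P$ with minimum and maximum, $\mu(P)=\mu_P(\hat0,\hat1)$. $\rho(\vec c,\hat 1)$ is the length of any maximal chain from $\vec c$ to $\hat1$ in $C_n^\bullet$;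 for $\vec c$ with $k$ entries it equals $k-1$. For a pointed composition $\vec c=(c_1,\ldots,c_{k-1},\underline{c_k})$ of $n$: if $c_k>0$, $\beta(\vec c)$ is the number of permutations in the symmetric group $\mathfrak S_n$ with descent set $\{i:\tau(i)>\tau(i+1)\}$ equal to $\{c_1,c_1+c_2,\ldots,c_1+\cdots+c_{k-1}\}$; if $k\ge 2$ and $c_k=0$, $\beta(\vec c)=0$; and $\beta((\underline{0}))=1$. -}

module Defs where

open import Data.Bool using (Bool; true; false; _∧_; _∨_; not; if_then_else_; T)
open import Data.Nat as ℕ using (ℕ; zero; suc; _+_; _≤_; _<_; _≡ᵇ_; _<ᵇ_)
open import Data.Nat.Properties using (≤-decTotalOrder; ≤-totalOrder)
open import Data.Integer as ℤ using (ℤ; +_; -_)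
open import Data.List using (List; []; _∷_; map; concatMap; length; upTo; zip; replicate; _++_)
open import Data.Nat.ListAction using (sum)
open import Data.Bool.ListAction using (all; any)
open import Data.List.Relation.Unary.All using (All)
open import Data.List.Relation.Unary.Unique.Propositional using (Unique)
open import Data.List.Relation.Unary.Unique.Propositional.Properties using ()
open import Data.List.Relation.Binary.Permutation.Propositional using (_↭_)
open import Data.List.Relation.Unary.Sorted.TotalOrder ≤-totalOrder using (Sorted)
open import Data.List.Sort.InsertionSort.Base ≤-decTotalOrder using (sort)
open import Data.Maybe using (Maybe; just; nothing)
open import Data.Product using (Σ; ∃; ∃-syntax; _×_; _,_; proj₁; proj₂)
open import Data.Sum using (_⊎_)
open import Relation.Binary.PropositionalEquality using (_≡_)
open import Relation.Binary.Construct.Closure.ReflexiveTransitive using (Star)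
open import Relation.Nullary.Decidable using (⌊_⌋)
open import Data.List.Properties using (≡-dec)
import Data.Nat as N

-- A finite poset presented by the list of its (distinct) elements,
-- a Boolean equality test and a Boolean order test.
record FinPoset : Set₁ where
  field
    Carrier : Set
    elems   : List Carrier
    _==_    : Carrier → Carrier → Bool
    _≼_     : Carrier → Carrier → Bool

-- Möbius function μ(x,y) by the defining recursion
--   μ(x,x) = 1,   μ(x,y) = - Σ_{x ≤ z < y} μ(x,z)   (x ≤ y),  μ(x,y) = 0 otherwise.
-- The extra ℕ argument is fuel; every strict chain in P has fewer than
-- |P| steps, so fuel |P| suffices (see möbius below).
ℤsum : List ℤ → ℤ
ℤsum [] = + 0
ℤsum (a ∷ as) = a ℤ.+ ℤsum as

bfilter : {A : Set} → (A → Bool) → List A → List A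
bfilter p [] = []
bfilter p (a ∷ as) = if p a then a ∷ bfilter p as else bfilter p as

möbiusF : (P : FinPoset) → ℕ → FinPoset.Carrier P → FinPoset.Carrier P → ℤ
möbiusF P fuel x y =
  if x == y then + 1 else (if x ≼ y then step fuel else + 0)
  where
  open FinPoset P
  step : ℕ → ℤ
  step zero    = + 0
  step (suc f) = - ℤsum (map (möbiusF P f x)
                    (bfilter (λ z → (x ≼ z) ∧ ((z ≼ y) ∧ not (z == y))) elems))

möbius : (P : FinPoset) → FinPoset.Carrier P → FinPoset.Carrier P → ℤ
möbius P = möbiusF P (length (FinPoset.elems P))

_==ℕ_ : ℕ → ℕ → Bool
a ==ℕ b = a ≡ᵇ b

_==L_ : List ℕ → List ℕ → Bool
as ==L bs = ⌊ ≡-dec N._≟_ as bs ⌋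

count : ℕ → List ℕ → ℕ
count j xs = length (bfilter (j ==ℕ_) xs)

words : ℕ → List ℕ → List (List ℕ)
words zero    A = [] ∷ []
words (suc k) A = concatMap (λ a → map (a ∷_) (words k A)) A

oneTo : ℕ → List ℕ
oneTo n = map suc (upTo n)

zeroTo : ℕ → List ℕ
zeroTo n = upTo (suc n)

-- Pointed integer partitions I_n^•
-- {λ , m̲} is represented by (λ , m) with λ the multiset of ordinary parts
-- given as a sorted (nondecreasing) list of positive integers.

PIP : Set
PIP = List ℕ × ℕ

InI : ℕ → PIP → Set
InI n (lam , m) = Sorted lam × All (1 ≤_) lam × sum lam + m ≡ n

-- cover relations of I_n^• (parts are a multiset, hence ↭)
CoverI : PIP → PIP → Set
CoverI (lam , m) (lam' , m') =
    (∃[ a ] ∃[ b ] ∃[ rest ] (lam ↭ a ∷ b ∷ rest) × (lam' ↭ (a + b) ∷ rest) × (m' ≡ m))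
  ⊎ (∃[ a ] (lam ↭ a ∷ lam') × (m' ≡ a + m))

_≤I[_]_ : PIP → ℕ → PIP → Set
x ≤I[ n ] y = Star (λ u v → InI n u × InI n v × CoverI u v) x y

IsFilter : ℕ → (PIP → Bool) → Set
IsFilter n F = ∀ x y → x ≤I[ n ] y → T (F x) → T (F y)

NonemptyIn : ℕ → (PIP → Bool) → Set
NonemptyIn n F = ∃[ x ] InI n x × T (F x)

-- Pointed set partitions Π_n^•
-- (σ , Z) of {1..n} is encoded by its label list (ℓ₁,…,ℓₙ): ℓᵢ = 0 iff
-- i ∈ Z, and the nonzero labels name the blocks of σ in order of first
-- appearance (restricted growth: each new label is 1 + the largest so far).

validRGS : ℕ → List ℕ → Bool
validRGS mx []       = true
validRGS mx (a ∷ as) = (a N.≤ᵇ suc mx) ∧ validRGS (mx N.⊔ a) as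

pointedSetPartitions : ℕ → List (List ℕ)
pointedSetPartitions n = bfilter (validRGS 0) (words n (zeroTo n))

typeΠ : ℕ → List ℕ → PIP
typeΠ n ls =
  sort (bfilter (λ c → not (c ==ℕ 0)) (map (λ j → count j ls) (oneTo n)))
  , count 0 ls

-- refinement order: Z ⊆ Z' and each block of σ inside a block of σ' or Z'
refines : List ℕ → List ℕ → Bool
refines a b =
  all (λ p → not (proj₁ p ==ℕ 0) ∨ (proj₂ p ==ℕ 0)) ps
  ∧ all (λ p → all (λ q → not ((proj₁ p ==ℕ proj₁ q) ∧ not (proj₁ p ==ℕ 0))
                          ∨ (proj₂ p ==ℕ proj₂ q)) ps) ps
  where ps = zip a b

ΠF∪0̂ : ℕ → (PIP → Bool) → FinPoset
ΠF∪0̂ n F = record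
  { Carrier = Maybe (List ℕ)
  ; elems   = nothing ∷ map just (bfilter (λ π → F (typeΠ n π)) (pointedSetPartitions n))
  ; _==_    = eqM
  ; _≼_     = leM
  }
  where
  eqM : Maybe (List ℕ) → Maybe (List ℕ) → Bool
  eqM nothing  nothing  = true
  eqM (just a) (just b) = a ==L b
  eqM _        _        = false
  leM : Maybe (List ℕ) → Maybe (List ℕ) → Bool
  leM nothing  _        = true
  leM (just _) nothing  = false
  leM (just a) (just b) = refines a b

top̂Π : ℕ → Maybe (List ℕ)
top̂Π n = just (replicate n 0)

-- Pointed compositions C_n^•
-- (c₁,…,c_{k-1}, c̲ₖ) is represented by ((c₁,…,c_{k-1}) , cₖ).

PC : Set
PC = List ℕ × ℕ

pointedCompositions : ℕ → List PC
pointedCompositions n =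
  concatMap (λ k → concatMap (λ m →
      map (_, m) (bfilter (λ cs → (sum cs + m) ==ℕ n) (words k (oneTo n))))
    (zeroTo n)) (zeroTo n)

mergesAdj : List ℕ → List (List ℕ)
mergesAdj (a ∷ b ∷ r) = ((a + b) ∷ r) ∷ map (a ∷_) (mergesAdj (b ∷ r))
mergesAdj _           = []

splitLast : List ℕ → Maybe (List ℕ × ℕ)
splitLast []       = nothing
splitLast (a ∷ as) with splitLast as
... | nothing        = just ([] , a)
... | just (bs , b)  = just (a ∷ bs , b)

upcovers : PC → List PC
upcovers (cs , m) = map (_, m) (mergesAdj cs) ++ lastMerge (splitLast cs)
  where
  lastMerge : Maybe (List ℕ × ℕ) → List PC
  lastMerge nothing          = []
  lastMerge (just (bs , b))  = (bs , b + m) ∷ []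

reach : ℕ → PC → List PC
reach zero    x = x ∷ []
reach (suc f) x = x ∷ concatMap (reach f) (upcovers x)

_==PC_ : PC → PC → Bool
(cs , m) ==PC (ds , m') = (cs ==L ds) ∧ (m ==ℕ m')

-- order of C_n^•: reflexive-transitive closure of the covers (each cover
-- lowers the number of entries, which is ≤ n+1, so n steps suffice)
leqC : ℕ → PC → PC → Bool
leqC n x y = any (y ==PC_) (reach n x)

typeC : PC → PIP
typeC (cs , m) = sort cs , m

CF : ℕ → (PIP → Bool) → List PC
CF n F = bfilter (λ c → F (typeC c)) (pointedCompositions n)

CF∪0̂ : ℕ → (PIP → Bool) → FinPoset
CF∪0̂ n F = record
  { Carrier = Maybe PC
  ; elems   = nothing ∷ map just (CF n F)
  ; _==_    = eqM
  ; _≼_     = leM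
  }
  where
  eqM : Maybe PC → Maybe PC → Bool
  eqM nothing  nothing  = true
  eqM (just a) (just b) = a ==PC b
  eqM _        _        = false
  leM : Maybe PC → Maybe PC → Bool
  leM nothing  _        = true
  leM (just _) nothing  = false
  leM (just a) (just b) = leqC n a b

-- ρ(c⃗, 1̂) = k - 1
ρ : PC → ℕ
ρ (cs , m) = length cs

distinct : List ℕ → Bool
distinct []       = true
distinct (a ∷ as) = not (any (a ==ℕ_) as) ∧ distinct as

permutations : ℕ → List (List ℕ)
permutations n = bfilter distinct (words n (upTo n))

-- descent set {i : τ(i) > τ(i+1)}, listed increasingly (i starts at 1)
descents : ℕ → List ℕ → List ℕ
descents i (a ∷ b ∷ r) =
  if b <ᵇ a then i ∷ descents (suc i) (b ∷ r) else descents (suc i) (b ∷ r)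
descents i _ = []

partialSums : ℕ → List ℕ → List ℕ
partialSums acc []       = []
partialSums acc (c ∷ cs) = (acc + c) ∷ partialSums (acc + c) cs

β : ℕ → PC → ℕ
β n (cs , suc m) = length (bfilter (λ τ → descents 1 τ ==L partialSums 0 cs) (permutations n))
β n ([] , zero)    = 1
β n (_ ∷ _ , zero) = 0

{-# OPTIONS --safe #-}
-- Both sides equal − Σ_{c ∈ C_n^•(F)} (−1)^ρ(c) M(c), where M(c) is the multinomial coefficient of c.
-- If Σ_{y ≥ x} W(y) = V(x) on a filter P, then Σ_x V(x) μ(0̂,x) = − Σ_y W(y) in P ∪ {0̂}.
-- On Π_n^•(F) take W(π) = (−1)^k k! with k the number of ordinary blocks; then V is the indicator
-- of 1̂.  On C_n^•(F) take W = (−1)^ρ M; as M(d) counts the permutations whose descents lie among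
-- the partial sums of d, inclusion–exclusion gives V(c) = (−1)^ρ(c) β(c).  Finally both sums Σ W
-- agree: a set partition with k ordinary blocks has k! block orders, and ordered and unordered pointed
-- partitions are both built by adding 1, …, n one at a time, a new block having k + 1 places in the order.
module Submission where

open import Defs
open import Data.Nat using (ℕ; zero; suc)
open import Data.Integer using (ℤ; +_; -_; _*_; _^_; _+_)
open import Data.List using (List; []; _∷_; [_]; _++_; map; concatMap; length; upTo; zip; replicate)
open import Data.Bool using (Bool; true; false; _∧_; _∨_; not; if_then_else_; T)
open import Data.Maybe using (Maybe; just; nothing)
open import Relation.Binary.PropositionalEquality using (_≡_; _≢_; _≗_; refl; sym; trans; cong; cong₂; subst; subst₂; module ≡-Reasoning)
import Data.Nat as ℕ
import Data.Nat.Properties as ℕ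
import Data.Nat.Combinatorics as ℕ
import Data.Integer as ℤ
import Data.Integer.Properties as ℤ
open import Data.Integer.Tactic.RingSolver using (solve-∀)
open import Data.Nat.ListAction using (sum)
open import Data.Nat.ListAction.Properties using (sum-↭)
open import Data.Bool.ListAction using (all; any)
open import Data.Bool.Properties using (∧-zeroʳ; ∧-identityʳ)
open import Data.List.Properties using (map-∘; map-id; ≡-dec; length-++; length-upTo; ∷-injectiveˡ; ∷-injectiveʳ; applyUpTo-∷ʳ; map-applyUpTo; length-replicate)
open import Data.List.Membership.Propositional using (_∈_; _∉_; find)
open import Data.List.Membership.Propositional.Properties
  using (∈-map⁺; ∈-map⁻; ∈-++⁺ˡ; ∈-++⁺ʳ; ∈-++⁻; ∈-concatMap⁺; ∈-concatMap⁻; ∈-upTo⁺; ∈-upTo⁻)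
open import Data.List.Membership.Propositional.Properties.WithK using (unique∧set⇒bag)
open import Data.List.Relation.Unary.Any as Any using (Any; here; there)
open import Data.List.Relation.Unary.All as All using (All; []; _∷_)
import Data.List.Relation.Unary.All.Properties as All
import Data.List.Relation.Unary.AllPairs.Properties as AllPairs
open import Data.List.Relation.Unary.AllPairs as AllPairs using (AllPairs; []; _∷_)
open import Data.List.Relation.Unary.Unique.Propositional using (Unique)
import Data.List.Relation.Unary.Unique.Propositional.Properties as Unique
open import Data.List.Relation.Binary.BagAndSetEquality using (∼bag⇒↭)
open import Data.List.Relation.Binary.Permutation.Propositional as Perm using (_↭_; ↭-refl; ↭-sym; ↭-trans; prep; swap; ↭-reflexive; ↭⇒↭ₛ)
import Data.List.Relation.Binary.Permutation.Propositional.Properties as Perm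
open import Data.Product using (∃-syntax; _×_; _,_; proj₁; proj₂)
open import Data.Sum using (_⊎_; inj₁; inj₂)
open import Data.Empty using (⊥; ⊥-elim)
open import Data.Unit using (tt)
open import Function using (_∘_; id; mk⇔)
open import Relation.Nullary using (yes; no; contradiction)
open import Relation.Binary.Construct.Closure.ReflexiveTransitive using (Star; ε; _◅_; _◅◅_; gmap)
open import Relation.Binary.Definitions using (tri<; tri≈; tri>)
open import Data.List.Sort.InsertionSort.Base ℕ.≤-decTotalOrder using (sort)
open import Data.List.Sort.InsertionSort.Properties ℕ.≤-decTotalOrder using (sort-↭; sort-↗)
open import Data.List.Relation.Unary.Sorted.TotalOrder.Properties using (↗↭↗⇒≋)
open import Data.List.Relation.Binary.Pointwise using (Pointwise-≡⇒≡)
import Data.List.Relation.Unary.Linked as Linked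

-- Finite sums

-- Since `F` is a filter, the elements above x in the restricted poset are all the elements above x
-- in the full one. The relation between W and V is therefore checked in the full posets, where `F`
-- does not occur. It returns only in the comparison of the two sums of W, as a function of the
-- type, blind to the order of the parts.
--
-- The weight (-1)^k k! is a Möbius number: the interval from a pointed partition with k ordinary
-- blocks up to 1̂ is isomorphic to the lattice of partitions of k + 1 points, the zero block being
-- one of the points. That V is the indicator of 1̂ is thus the recursion of the Möbius function
-- read from the top; here it is proved by a direct cancellation.
--
-- Counting the set partitions of a given type would mean dividing by the multiplicities of equal
-- parts. Adding one element at a time avoids this: each sum is an n-fold iterate of an operator on
-- functions of the block sizes, evaluated at the empty partition, and on symmetric functions
-- multiplication by k! intertwines the two operators.

+-congˡ : ∀ (c : ℤ) {a b} → a ≡ b → c + a ≡ c + b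
+-congˡ c = cong (λ a → c + a)

∑ : {A : Set} → List A → (A → ℤ) → ℤ
∑ xs f = ℤsum (map f xs)

⟦_⟧ : Bool → ℤ
⟦ true ⟧  = + 1
⟦ false ⟧ = + 0

∧-true : ∀ {p q} → p ≡ true → q ≡ true → (p ∧ q) ≡ true
∧-true refl refl = refl

∧-true⁻ : ∀ p {q} → (p ∧ q) ≡ true → p ≡ true × q ≡ true
∧-true⁻ true eq = refl , eq

≢true⇒≡false : ∀ {p} → p ≢ true → p ≡ false
≢true⇒≡false {true}  p≢ = contradiction refl p≢
≢true⇒≡false {false} p≢ = refl

⟦∧⟧-* : ∀ p q m → ⟦ p ∧ q ⟧ * m ≡ ⟦ p ⟧ * (⟦ q ⟧ * m)
⟦∧⟧-* true  q m = sym (ℤ.*-identityˡ (⟦ q ⟧ * m))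
⟦∧⟧-* false q m = refl

module _ {A : Set} where

  ∑-cong : ∀ {f g : A → ℤ} xs → (∀ {x} → x ∈ xs → f x ≡ g x) → ∑ xs f ≡ ∑ xs g
  ∑-cong []       f≡g = refl
  ∑-cong (x ∷ xs) f≡g = cong₂ _+_ (f≡g (here refl)) (∑-cong xs (f≡g ∘ there))

  ∑-ext : ∀ {f g : A → ℤ} xs → f ≗ g → ∑ xs f ≡ ∑ xs g
  ∑-ext xs f≗g = ∑-cong xs (λ _ → f≗g _)

  ∑-zero : ∀ {f : A → ℤ} xs → (∀ {x} → x ∈ xs → f x ≡ + 0) → ∑ xs f ≡ + 0
  ∑-zero []       f≡0 = refl
  ∑-zero (x ∷ xs) f≡0 = cong₂ _+_ (f≡0 (here refl)) (∑-zero xs (f≡0 ∘ there))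

  ∑-++ : ∀ xs ys (f : A → ℤ) → ∑ (xs ++ ys) f ≡ ∑ xs f + ∑ ys f
  ∑-++ []       ys f = sym (ℤ.+-identityˡ _)
  ∑-++ (x ∷ xs) ys f = trans (+-congˡ (f x) (∑-++ xs ys f)) (sym (ℤ.+-assoc (f x) _ _))

  ∑-+ : ∀ xs (f g : A → ℤ) → ∑ xs (λ x → f x + g x) ≡ ∑ xs f + ∑ xs g
  ∑-+ []       f g = refl
  ∑-+ (x ∷ xs) f g = trans (+-congˡ (f x + g x) (∑-+ xs f g)) (lemma (f x) (g x) _ _)
    where
    lemma : ∀ a b c d → a + b + (c + d) ≡ a + c + (b + d)
    lemma = solve-∀

  ∑-*ˡ : ∀ xs c (f : A → ℤ) → ∑ xs (λ x → c * f x) ≡ c * ∑ xs f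
  ∑-*ˡ []       c f = sym (ℤ.*-zeroʳ c)
  ∑-*ˡ (x ∷ xs) c f = trans (+-congˡ (c * f x) (∑-*ˡ xs c f)) (sym (ℤ.*-distribˡ-+ c (f x) _))

  ∑-*ʳ : ∀ xs (f : A → ℤ) c → ∑ xs (λ x → f x * c) ≡ ∑ xs f * c
  ∑-*ʳ xs f c = trans (∑-ext xs (λ x → ℤ.*-comm (f x) c)) (trans (∑-*ˡ xs c f) (ℤ.*-comm c _))

  ∑-↭ : ∀ {xs ys} (f : A → ℤ) → xs ↭ ys → ∑ xs f ≡ ∑ ys f
  ∑-↭ f Perm.refl         = refl
  ∑-↭ f (prep x p)        = +-congˡ (f x) (∑-↭ f p)
  ∑-↭ {x ∷ y ∷ xs} {_ ∷ _ ∷ ys} f (swap .x .y p) rewrite ∑-↭ f p = lemma (f x) (f y) _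
    where
    lemma : ∀ a b c → a + (b + c) ≡ b + (a + c)
    lemma = solve-∀
  ∑-↭ f (Perm.trans p q)  = trans (∑-↭ f p) (∑-↭ f q)

  ∑-bfilter : ∀ p xs (f : A → ℤ) → ∑ (bfilter p xs) f ≡ ∑ xs (λ x → ⟦ p x ⟧ * f x)
  ∑-bfilter p []       f = refl
  ∑-bfilter p (x ∷ xs) f with p x
  ... | true  = cong₂ _+_ (sym (ℤ.*-identityˡ (f x))) (∑-bfilter p xs f)
  ... | false = trans (∑-bfilter p xs f) (sym (ℤ.+-identityˡ _))

  ∑-single : ∀ {y} {xs} (f : A → ℤ) → Unique xs → y ∈ xs →
             (∀ {x} → x ∈ xs → x ≢ y → f x ≡ + 0) → ∑ xs f ≡ f y
  ∑-single {y} {x ∷ xs} f (x∉ ∷ u) (here refl) off =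
    trans (+-congˡ (f y) (∑-zero xs (λ x∈ → off (there x∈) (All.lookup x∉ x∈ ∘ sym)))) (ℤ.+-identityʳ _)
  ∑-single {y} {x ∷ xs} f (x∉ ∷ u) (there y∈) off =
    trans (cong₂ _+_ (off (here refl) (All.lookup x∉ y∈)) (∑-single f u y∈ (off ∘ there))) (ℤ.+-identityˡ _)

  length-bfilter : ∀ p (xs : List A) → + length (bfilter p xs) ≡ ∑ xs (λ x → ⟦ p x ⟧)
  length-bfilter p []       = refl
  length-bfilter p (x ∷ xs) with p x
  ... | true  = +-congˡ (+ 1) (length-bfilter p xs)
  ... | false = trans (length-bfilter p xs) (sym (ℤ.+-identityˡ _))

  ∈-bfilter⁺ : ∀ (p : A → Bool) {x xs} → x ∈ xs → p x ≡ true → x ∈ bfilter p xs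
  ∈-bfilter⁺ p (here refl)      px rewrite px = here refl
  ∈-bfilter⁺ p {xs = y ∷ _} (there x∈) px with p y
  ... | true  = there (∈-bfilter⁺ p x∈ px)
  ... | false = ∈-bfilter⁺ p x∈ px

  ∈-bfilter⁻ : ∀ (p : A → Bool) {x} xs → x ∈ bfilter p xs → x ∈ xs × p x ≡ true
  ∈-bfilter⁻ p (y ∷ xs) x∈ with p y in py
  ∈-bfilter⁻ p (y ∷ xs) (here refl) | true  = here refl , py
  ∈-bfilter⁻ p (y ∷ xs) (there x∈)  | true  with ∈-bfilter⁻ p xs x∈
  ... | x∈′ , px = there x∈′ , px
  ∈-bfilter⁻ p (y ∷ xs) x∈          | false with ∈-bfilter⁻ p xs x∈
  ... | x∈′ , px = there x∈′ , px

  bfilter-Unique : ∀ p {xs : List A} → Unique xs → Unique (bfilter p xs)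
  bfilter-Unique p []                = []
  bfilter-Unique p {x ∷ xs} (x∉ ∷ u) with p x
  ... | true  = All.tabulate (λ y∈ → All.lookup x∉ (proj₁ (∈-bfilter⁻ p xs y∈))) ∷ bfilter-Unique p u
  ... | false = bfilter-Unique p u

  bfilter-cong : ∀ {p q : A → Bool} xs → (∀ {x} → x ∈ xs → p x ≡ q x) → bfilter p xs ≡ bfilter q xs
  bfilter-cong []       p≡q = refl
  bfilter-cong {q = q} (x ∷ xs) p≡q rewrite p≡q (here refl) with q x
  ... | true  = cong (x ∷_) (bfilter-cong xs (p≡q ∘ there))
  ... | false = bfilter-cong xs (p≡q ∘ there)

  bfilter-length-≤ : ∀ (p q : A → Bool) xs → (∀ {x} → x ∈ xs → p x ≡ true → q x ≡ true) →
                     length (bfilter p xs) ℕ.≤ length (bfilter q xs)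
  bfilter-length-≤ p q []       p⇒q = ℕ.z≤n
  bfilter-length-≤ p q (x ∷ xs) p⇒q with p x in px | q x in qx
  ... | true  | true  = ℕ.s≤s (bfilter-length-≤ p q xs (p⇒q ∘ there))
  ... | true  | false with () ← trans (sym (p⇒q (here refl) px)) qx
  ... | false | true  = ℕ.m≤n⇒m≤1+n (bfilter-length-≤ p q xs (p⇒q ∘ there))
  ... | false | false = bfilter-length-≤ p q xs (p⇒q ∘ there)

  bfilter-length-< : ∀ (p q : A → Bool) {y} {xs} → (∀ {x} → x ∈ xs → p x ≡ true → q x ≡ true) →
                     y ∈ xs → p y ≡ false → q y ≡ true →
                     length (bfilter p xs) ℕ.< length (bfilter q xs)
  bfilter-length-< p q {xs = x ∷ xs} p⇒q (here refl) py qy rewrite py | qy =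
    ℕ.s≤s (bfilter-length-≤ p q xs (p⇒q ∘ there))
  bfilter-length-< p q {xs = x ∷ xs} p⇒q (there y∈) py qy with p x in px | q x in qx
  ... | true  | true  = ℕ.s≤s (bfilter-length-< p q (p⇒q ∘ there) y∈ py qy)
  ... | true  | false with () ← trans (sym (p⇒q (here refl) px)) qx
  ... | false | true  = ℕ.m≤n⇒m≤1+n (bfilter-length-< p q (p⇒q ∘ there) y∈ py qy)
  ... | false | false = bfilter-length-< p q (p⇒q ∘ there) y∈ py qy

  bfilter-length-bound : ∀ (p : A → Bool) xs → length (bfilter p xs) ℕ.≤ length xs
  bfilter-length-bound p []       = ℕ.z≤n
  bfilter-length-bound p (x ∷ xs) with p x
  ... | true  = ℕ.s≤s (bfilter-length-bound p xs)
  ... | false = ℕ.m≤n⇒m≤1+n (bfilter-length-bound p xs)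

  Unique-↭ : {xs ys : List A} → Unique xs → Unique ys →
             (∀ {x} → x ∈ xs → x ∈ ys) → (∀ {x} → x ∈ ys → x ∈ xs) → xs ↭ ys
  Unique-↭ u v to from = ∼bag⇒↭ (unique∧set⇒bag u v (mk⇔ to from))

module _ {A B : Set} where

  ∑-map : ∀ (h : A → B) xs (f : B → ℤ) → ∑ (map h xs) f ≡ ∑ xs (f ∘ h)
  ∑-map h xs f = cong ℤsum (sym (map-∘ xs))

  ∑-concatMap : ∀ (h : A → List B) xs (f : B → ℤ) → ∑ (concatMap h xs) f ≡ ∑ xs (λ x → ∑ (h x) f)
  ∑-concatMap h []       f = refl
  ∑-concatMap h (x ∷ xs) f = trans (∑-++ (h x) _ f) (+-congˡ (∑ (h x) f) (∑-concatMap h xs f))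

  ∑-swap : ∀ (xs : List A) (ys : List B) (f : A → B → ℤ) →
           ∑ xs (λ x → ∑ ys (f x)) ≡ ∑ ys (λ y → ∑ xs (λ x → f x y))
  ∑-swap []       ys f = sym (∑-zero ys (λ _ → refl))
  ∑-swap (x ∷ xs) ys f = trans (+-congˡ (∑ ys (f x)) (∑-swap xs ys f)) (sym (∑-+ ys (f x) _))

∑-words : ∀ k A (f : List ℕ → ℤ) →
          ∑ (words (suc k) A) f ≡ ∑ A (λ a → ∑ (words k A) (λ w → f (a ∷ w)))
∑-words k A f = trans (∑-concatMap (λ a → map (a ∷_) (words k A)) A f)
                      (∑-ext A (λ a → ∑-map (a ∷_) (words k A) f))

module _ {A B : Set} (h : A → List B) where

  concatMap⁺ : ∀ {x y xs} → x ∈ xs → y ∈ h x → y ∈ concatMap h xs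
  concatMap⁺ x∈ y∈ = ∈-concatMap⁺ h (Any.map (λ { refl → y∈ }) x∈)

  concatMap⁻ : ∀ {y} xs → y ∈ concatMap h xs → ∃[ x ] x ∈ xs × y ∈ h x
  concatMap⁻ xs y∈ = find (∈-concatMap⁻ h {xs} y∈)

∈-words⁺ : ∀ {A w} → All (_∈ A) w → w ∈ words (length w) A
∈-words⁺ [] = here refl
∈-words⁺ {A} {a ∷ w} (a∈ ∷ w∈) =
  concatMap⁺ (λ a → map (a ∷_) (words (length w) A)) a∈ (∈-map⁺ (a ∷_) (∈-words⁺ w∈))

∈-words⁻ : ∀ k {A w} → w ∈ words k A → length w ≡ k × All (_∈ A) w
∈-words⁻ zero    (here refl) = refl , []
∈-words⁻ (suc k) {A} w∈ with concatMap⁻ (λ a → map (a ∷_) (words k A)) A w∈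
... | a , a∈ , w∈′ with ∈-map⁻ (a ∷_) w∈′
...   | v , v∈ , refl with ∈-words⁻ k v∈
...     | refl , v⊆A = refl , a∈ ∷ v⊆A

concatMap-Unique : ∀ {A B : Set} (h : A → List B) {xs} → Unique xs → (∀ x → Unique (h x)) →
                   (∀ {x y z} → z ∈ h x → z ∈ h y → x ≡ y) → Unique (concatMap h xs)
concatMap-Unique h []               uh disj = []
concatMap-Unique h {x ∷ xs} (x∉ ∷ u) uh disj =
  Unique.++⁺ (uh x) (concatMap-Unique h u uh disj)
    (λ { (z∈ , z∈′) → let y , y∈ , z∈y = concatMap⁻ h xs z∈′ in All.lookup x∉ y∈ (disj z∈ z∈y) })

words-Unique : ∀ k {A} → Unique A → Unique (words k A)
words-Unique zero    u = [] ∷ []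
words-Unique (suc k) {A} u =
  concatMap-Unique (λ a → map (a ∷_) (words k A)) u
    (λ a → Unique.map⁺ (λ { refl → refl }) (words-Unique k u)) same-head
  where
  same-head : ∀ {x y z} → z ∈ map (x ∷_) (words k A) → z ∈ map (y ∷_) (words k A) → x ≡ y
  same-head {x} {y} z∈x z∈y with ∈-map⁻ (x ∷_) z∈x | ∈-map⁻ (y ∷_) z∈y
  ... | _ , _ , refl | _ , _ , refl = refl

≡ᵇ-refl : ∀ a → (a ℕ.≡ᵇ a) ≡ true
≡ᵇ-refl zero    = refl
≡ᵇ-refl (suc a) = ≡ᵇ-refl a

≡ᵇ-sound : ∀ a b → (a ℕ.≡ᵇ b) ≡ true → a ≡ b
≡ᵇ-sound zero    zero    eq = refl
≡ᵇ-sound (suc a) (suc b) eq = cong suc (≡ᵇ-sound a b eq)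

≡ᵇ-complete : ∀ {a b} → a ≡ b → (a ℕ.≡ᵇ b) ≡ true
≡ᵇ-complete {a} refl = ≡ᵇ-refl a

==L-refl : ∀ as → (as ==L as) ≡ true
==L-refl as with ≡-dec ℕ._≟_ as as
... | yes _ = refl
... | no ne = contradiction refl ne

==L-sound : ∀ as bs → (as ==L bs) ≡ true → as ≡ bs
==L-sound as bs eq with ≡-dec ℕ._≟_ as bs
... | yes as≡bs = as≡bs

∈-oneTo⁺ : ∀ {n j} → 1 ℕ.≤ j → j ℕ.≤ n → j ∈ oneTo n
∈-oneTo⁺ {j = suc j} 1≤j j≤n = ∈-map⁺ suc (∈-upTo⁺ j≤n)

∈-oneTo⁻ : ∀ {n j} → j ∈ oneTo n → 1 ℕ.≤ j × j ℕ.≤ n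
∈-oneTo⁻ j∈ with ∈-map⁻ suc j∈
... | i , i∈ , refl = ℕ.s≤s ℕ.z≤n , ∈-upTo⁻ i∈

oneTo-Unique : ∀ n → Unique (oneTo n)
oneTo-Unique n = Unique.map⁺ ℕ.suc-injective (Unique.upTo⁺ n)

any⁺ : ∀ {A : Set} (p : A → Bool) {x xs} → x ∈ xs → p x ≡ true → any p xs ≡ true
any⁺ p (here refl) px rewrite px = refl
any⁺ p {xs = y ∷ _} (there x∈) px with p y
... | true  = refl
... | false = any⁺ p x∈ px

any⁻ : ∀ {A : Set} (p : A → Bool) xs → any p xs ≡ true → ∃[ x ] x ∈ xs × p x ≡ true
any⁻ p (x ∷ xs) eq with p x in px
... | true  = x , here refl , px
... | false = let y , y∈ , py = any⁻ p xs eq in y , there y∈ , py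

all⁺ : ∀ {A : Set} (p : A → Bool) xs → (∀ {x} → x ∈ xs → p x ≡ true) → all p xs ≡ true
all⁺ p []       px = refl
all⁺ p (x ∷ xs) px rewrite px (here refl) = all⁺ p xs (px ∘ there)

all⁻ : ∀ {A : Set} (p : A → Bool) xs → all p xs ≡ true → ∀ {x} → x ∈ xs → p x ≡ true
all⁻ p (x ∷ xs) eq (here refl) = proj₁ (∧-true⁻ (p x) eq)
all⁻ p (x ∷ xs) eq (there y∈)  = all⁻ p xs (proj₂ (∧-true⁻ (p x) eq)) y∈

-- Möbius functions

-- The order laws are asked on listed elements only. Off the list they fail: `refines` identifies
-- different labellings of one partition, and `leqC n` can run out of steps.
record IsFinPoset (P : FinPoset) : Set where
  open FinPoset P
  field
    unique    : Unique elems
    ==-sound  : ∀ x y → (x == y) ≡ true → x ≡ y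
    ==-refl   : ∀ x → (x == x) ≡ true
    ≼-refl    : ∀ {x} → x ∈ elems → (x ≼ x) ≡ true
    ≼-trans   : ∀ {x y z} → x ∈ elems → y ∈ elems → z ∈ elems →
                (x ≼ y) ≡ true → (y ≼ z) ≡ true → (x ≼ z) ≡ true
    ≼-antisym : ∀ {x y} → x ∈ elems → y ∈ elems → (x ≼ y) ≡ true → (y ≼ x) ≡ true → x ≡ y

module MöbiusTheory (P : FinPoset) (isP : IsFinPoset P)
         (b : FinPoset.Carrier P) (b∈ : b ∈ FinPoset.elems P)
         (b-min : ∀ z → FinPoset._≼_ P b z ≡ true) where

  open FinPoset P
  open IsFinPoset isP

  below : Carrier → Carrier → Bool
  below y z = (b ≼ z) ∧ ((z ≼ y) ∧ not (z == y))

  height : Carrier → ℕ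
  height y = length (bfilter (_≼ y) elems)

  ==-false : ∀ {x y} → x ≢ y → (x == y) ≡ false
  ==-false {x} {y} x≢y = ≢true⇒≡false (x≢y ∘ ==-sound x y)

  below⁻ : ∀ {y z} → below y z ≡ true → (z ≼ y) ≡ true × z ≢ y
  below⁻ {y} {z} eq with ∧-true⁻ (b ≼ z) eq
  ... | _ , eq′ with ∧-true⁻ (z ≼ y) eq′
  ...   | z≼y , z≠y = z≼y , λ { refl → case z≠y }
    where
    case : not (z == z) ≡ true → ⊥
    case eq rewrite ==-refl z with () ← eq

  height-mono : ∀ {y z} → y ∈ elems → z ∈ elems → (z ≼ y) ≡ true → z ≢ y → height z ℕ.< height y
  height-mono y∈ z∈ z≼y z≢y =
    bfilter-length-< _ _ (λ x∈ x≼z → ≼-trans x∈ z∈ y∈ x≼z z≼y) y∈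
      (≢true⇒≡false (λ y≼z → z≢y (≼-antisym z∈ y∈ z≼y y≼z))) (≼-refl y∈)

  height>0 : ∀ {y} → y ∈ elems → 0 ℕ.< height y
  height>0 y∈ = ℕ.≤-<-trans ℕ.z≤n
    (bfilter-length-< (λ _ → false) _ (λ _ ()) y∈ refl (≼-refl y∈))

  möbiusF-bot : ∀ f → möbiusF P f b b ≡ + 1
  möbiusF-bot f rewrite ==-refl b = refl

  möbiusF-step : ∀ f {y} → b ≢ y →
    möbiusF P (suc f) b y ≡ - ∑ (bfilter (below y) elems) (möbiusF P f b)
  möbiusF-step f {y} b≢y rewrite ==-false b≢y | b-min y = refl

  -- The recursion only visits elements strictly below `y`, and `height` drops strictly there, so
  -- fuel that is at least the height is never exhausted.
  fuel-irrelevant : ∀ f g {y} → y ∈ elems → height y ℕ.≤ f → height y ℕ.≤ g →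
                    möbiusF P f b y ≡ möbiusF P g b y
  fuel-irrelevant zero    g       y∈ h≤f h≤g = contradiction h≤f (ℕ.<⇒≱ (height>0 y∈))
  fuel-irrelevant (suc f) zero    y∈ h≤f h≤g = contradiction h≤g (ℕ.<⇒≱ (height>0 y∈))
  fuel-irrelevant (suc f) (suc g) {y} y∈ h≤f h≤g with b == y in eq
  ... | true  = refl
  ... | false rewrite b-min y = cong -_ (∑-cong (bfilter (below y) elems) λ {z} z∈ →
    let z∈E , lt = ∈-bfilter⁻ (below y) elems z∈
        z≼y , z≢y = below⁻ lt
        h< = height-mono y∈ z∈E z≼y z≢y
    in fuel-irrelevant f g z∈E (ℕ.≤-pred (ℕ.≤-trans h< h≤f)) (ℕ.≤-pred (ℕ.≤-trans h< h≤g)))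

  height-bound : ∀ y → height y ℕ.≤ length elems
  height-bound y = bfilter-length-bound _ elems

  möbius-step : ∀ {y} → y ∈ elems → b ≢ y →
    möbius P b y ≡ - ∑ (bfilter (below y) elems) (möbius P b)
  möbius-step {y} y∈ b≢y =
    -- One unit of fuel is added, so that after unfolding the summands carry exactly the fuel of
    -- `möbius` again.
    trans (fuel-irrelevant _ (suc (length elems)) y∈ (height-bound y) (ℕ.m≤n⇒m≤1+n (height-bound y)))
          (möbiusF-step (length elems) b≢y)

  ⟦==⟧-off : ∀ {y z} m → z ≢ y → ⟦ z == y ⟧ * m ≡ + 0
  ⟦==⟧-off m z≢y rewrite ==-false z≢y = refl

  ⟦==⟧-on : ∀ y m → ⟦ y == y ⟧ * m ≡ m
  ⟦==⟧-on y m rewrite ==-refl y = ℤ.*-identityˡ m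

  ⟦≼⟧-split : ∀ {y} → y ∈ elems → ∀ z m → ⟦ z ≼ y ⟧ * m ≡ ⟦ z == y ⟧ * m + ⟦ below y z ⟧ * m
  ⟦≼⟧-split {y} y∈ z m rewrite b-min z with z == y in eq
  ... | true rewrite ==-sound z y eq | ≼-refl y∈ = sym (ℤ.+-identityʳ _)
  ... | false with z ≼ y
  ...   | true  = sym (ℤ.+-identityˡ _)
  ...   | false = refl

  ∑-below-closed : ∀ {y} → y ∈ elems → b ≢ y → ∑ elems (λ z → ⟦ z ≼ y ⟧ * möbius P b z) ≡ + 0
  ∑-below-closed {y} y∈ b≢y = begin
    ∑ elems (λ z → ⟦ z ≼ y ⟧ * μ z)
      ≡⟨ ∑-ext elems (λ z → ⟦≼⟧-split y∈ z (μ z)) ⟩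
    ∑ elems (λ z → ⟦ z == y ⟧ * μ z + ⟦ below y z ⟧ * μ z)
      ≡⟨ ∑-+ elems _ _ ⟩
    ∑ elems (λ z → ⟦ z == y ⟧ * μ z) + ∑ elems (λ z → ⟦ below y z ⟧ * μ z)
      ≡⟨ cong₂ _+_ (trans (∑-single _ unique y∈ (λ {z} _ → ⟦==⟧-off (μ z))) (⟦==⟧-on y (μ y)))
                   (sym (∑-bfilter (below y) elems μ)) ⟩
    μ y + ∑ (bfilter (below y) elems) μ
      ≡⟨ cong (λ m → m + ∑ (bfilter (below y) elems) μ) (möbius-step y∈ b≢y) ⟩
    - ∑ (bfilter (below y) elems) μ + ∑ (bfilter (below y) elems) μ
      ≡⟨ ℤ.+-inverseˡ (∑ (bfilter (below y) elems) μ) ⟩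
    + 0 ∎
    where
    open ≡-Reasoning
    μ = möbius P b

-- Double counting of Σ_{x ≼ y} μ(0̂,x) W(y): summing over x first leaves - Σ W,
-- since Σ_{0̂ ≺ x ≼ y} μ(0̂,x) = - μ(0̂,0̂).
∑-möbius-transform : ∀ {A : Set} (L : List A) (eq le : Maybe A → Maybe A → Bool) →
  let P = record { Carrier = Maybe A ; elems = nothing ∷ map just L ; _==_ = eq ; _≼_ = le } in
  IsFinPoset P → (∀ z → le nothing z ≡ true) → (W V : A → ℤ) →
  (∀ {x} → x ∈ L → ∑ L (λ y → ⟦ le (just x) (just y) ⟧ * W y) ≡ V x) →
  ∑ L (λ x → V x * möbius P nothing (just x)) ≡ - ∑ L W
∑-möbius-transform {A} L eq le isP min W V W≡V = begin
  ∑ L (λ x → V x * μ x)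
    ≡⟨ ∑-cong L (λ {x} x∈ → trans (cong (_* μ x) (sym (W≡V x∈))) (sym (∑-*ʳ L _ (μ x)))) ⟩
  ∑ L (λ x → ∑ L (λ y → le′ x y * W y * μ x))
    ≡⟨ ∑-swap L L _ ⟩
  ∑ L (λ y → ∑ L (λ x → le′ x y * W y * μ x))
    ≡⟨ ∑-cong L (λ {y} y∈ → trans (∑-ext L (λ x → rearrange (le′ x y) (W y) (μ x))) (trans (∑-*ˡ L (W y) _) (cong (W y *_) (below-sum y∈)))) ⟩
  ∑ L (λ y → W y * (- (+ 1)))
    ≡⟨ ∑-*ʳ L W _ ⟩
  ∑ L W * (- (+ 1))
    ≡⟨ times-1 (∑ L W) ⟩
  - ∑ L W ∎
  where
  open ≡-Reasoning
  P = record { Carrier = Maybe A ; elems = nothing ∷ map just L ; _==_ = eq ; _≼_ = le }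
  open MöbiusTheory P isP nothing (here refl) min
  μ : A → ℤ
  μ x = möbius P nothing (just x)
  le′ : A → A → ℤ
  le′ x y = ⟦ le (just x) (just y) ⟧
  rearrange : ∀ a b c → a * b * c ≡ b * (a * c)
  rearrange = solve-∀
  times-1 : ∀ a → a * (- (+ 1)) ≡ - a
  times-1 = solve-∀
  below-sum : ∀ {y} → y ∈ L → ∑ L (λ x → le′ x y * μ x) ≡ - (+ 1)
  below-sum {y} y∈ = begin
    ∑ L (λ x → le′ x y * μ x)
      ≡⟨ sym (∑-map just L _) ⟩
    S
      ≡⟨ add-sub S ⟩
    - (+ 1) + (+ 1 + S)
      ≡⟨ cong (λ m → - (+ 1) + m) (trans (cong (_+ S) (sym head≡1)) (∑-below-closed (there (∈-map⁺ just y∈)) (λ ()))) ⟩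
    - (+ 1) ∎
    where
    S = ∑ (map just L) (λ z → ⟦ le z (just y) ⟧ * möbius P nothing z)
    add-sub : ∀ s → s ≡ - (+ 1) + (+ 1 + s)
    add-sub = solve-∀
    head≡1 : ⟦ le nothing (just y) ⟧ * möbius P nothing nothing ≡ + 1
    head≡1 rewrite min (just y) = trans (ℤ.*-identityˡ _) (möbiusF-bot (suc (length (map just L))))

∈-just⁻ : ∀ {A : Set} {x : A} {L} → just x ∈ nothing ∷ map just L → x ∈ L
∈-just⁻ (there x∈) with ∈-map⁻ just x∈
... | _ , x∈′ , refl = x∈′

bot∷-Unique : ∀ {A : Set} {L : List A} → Unique L → Unique (nothing ∷ map just L)
bot∷-Unique {L = L} u = All.tabulate notin ∷ Unique.map⁺ (λ { refl → refl }) u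
  where
  notin : ∀ {x} → x ∈ map just L → nothing ≢ x
  notin x∈ refl with ∈-map⁻ just x∈
  ... | _ , _ , ()

-- Pointed compositions

infix 4 _⋖_

-- All three cases read the list from the front, which suits induction; `upcovers` finds the merge
-- into the pointed entry by splitting the list at its end.
data _⋖_ : PC → PC → Set where
  merge : ∀ {a b cs m} → (a ∷ b ∷ cs , m) ⋖ (a ℕ.+ b ∷ cs , m)
  last  : ∀ {a m} → (a ∷ [] , m) ⋖ ([] , a ℕ.+ m)
  skip  : ∀ {a cs m ds m′} → (cs , m) ⋖ (ds , m′) → (a ∷ cs , m) ⋖ (a ∷ ds , m′)

mergesAdj⇒⋖ : ∀ cs {ds m} → ds ∈ mergesAdj cs → (cs , m) ⋖ (ds , m)
mergesAdj⇒⋖ (a ∷ b ∷ cs) (here refl) = merge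
mergesAdj⇒⋖ (a ∷ b ∷ cs) (there ds∈) with ∈-map⁻ (a ∷_) ds∈
... | ds , ds∈′ , refl = skip (mergesAdj⇒⋖ (b ∷ cs) ds∈′)

splitLast⇒⋖ : ∀ cs {bs b m} → splitLast cs ≡ just (bs , b) → (cs , m) ⋖ (bs , b ℕ.+ m)
splitLast⇒⋖ (a ∷ cs) eq with splitLast cs in eq′
splitLast⇒⋖ (a ∷ [])     refl | nothing = last
splitLast⇒⋖ (a ∷ c ∷ cs) refl | nothing with splitLast cs
splitLast⇒⋖ (a ∷ c ∷ cs) refl | nothing | nothing with () ← eq′
splitLast⇒⋖ (a ∷ c ∷ cs) refl | nothing | just _  with () ← eq′
splitLast⇒⋖ (a ∷ cs) refl | just _ = skip (splitLast⇒⋖ cs eq′)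

upcovers⇒⋖ : ∀ cs m {y} → y ∈ upcovers (cs , m) → (cs , m) ⋖ y
upcovers⇒⋖ cs m y∈ with splitLast cs in eq
... | nothing with ∈-++⁻ (map (_, m) (mergesAdj cs)) y∈
...   | inj₁ y∈′ with ∈-map⁻ (_, m) y∈′
...     | ds , ds∈ , refl = mergesAdj⇒⋖ cs ds∈
upcovers⇒⋖ cs m y∈ | just (bs , b) with ∈-++⁻ (map (_, m) (mergesAdj cs)) y∈
...   | inj₂ (here refl) = splitLast⇒⋖ cs eq
...   | inj₁ y∈′ with ∈-map⁻ (_, m) y∈′
...     | ds , ds∈ , refl = mergesAdj⇒⋖ cs ds∈

⋖⇒merge : ∀ {cs m ds m′} → (cs , m) ⋖ (ds , m′) →
          (m′ ≡ m × ds ∈ mergesAdj cs) ⊎ (∃[ b ] splitLast cs ≡ just (ds , b) × m′ ≡ b ℕ.+ m)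
⋖⇒merge merge = inj₁ (refl , here refl)
⋖⇒merge last  = inj₂ (_ , refl , refl)
⋖⇒merge (skip x) with ⋖⇒merge x
⋖⇒merge (skip {a} {c ∷ cs} x) | inj₁ (eq , ds∈) = inj₁ (eq , there (∈-map⁺ (a ∷_) ds∈))
⋖⇒merge (skip {a} {cs} x) | inj₂ (b , eq , eq′) rewrite eq = inj₂ (b , refl , eq′)

⋖⇒upcovers : ∀ cs m {y} → (cs , m) ⋖ y → y ∈ upcovers (cs , m)
⋖⇒upcovers cs m x with ⋖⇒merge x
... | inj₁ (refl , ds∈) = ∈-++⁺ˡ (∈-map⁺ (_, m) ds∈)
... | inj₂ (b , eq , refl) rewrite eq = ∈-++⁺ʳ (map (_, m) (mergesAdj cs)) (here refl)

_≤C_ : PC → PC → Set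
_≤C_ = Star _⋖_

⋖-ρ : ∀ {x y} → x ⋖ y → ρ x ≡ suc (ρ y)
⋖-ρ merge    = refl
⋖-ρ last     = refl
⋖-ρ (skip x) = cong suc (⋖-ρ x)

≤C-ρ : ∀ {x y} → x ≤C y → ρ y ℕ.≤ ρ x
≤C-ρ ε       = ℕ.≤-refl
≤C-ρ (x ◅ p) = ℕ.≤-trans (≤C-ρ p) (ℕ.≤-trans (ℕ.n≤1+n _) (ℕ.≤-reflexive (sym (⋖-ρ x))))

≤C-antisym : ∀ {x y} → x ≤C y → y ≤C x → x ≡ y
≤C-antisym ε       q = refl
≤C-antisym (x ◅ p) q = contradiction (≤C-ρ (p ◅◅ q)) (ℕ.<⇒≱ (ℕ.≤-reflexive (sym (⋖-ρ x))))

reach⇒≤C : ∀ f {x y} → y ∈ reach f x → x ≤C y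
reach⇒≤C zero    (here refl) = ε
reach⇒≤C (suc f) (here refl) = ε
reach⇒≤C (suc f) {cs , m} (there y∈) with concatMap⁻ (reach f) (upcovers (cs , m)) y∈
... | z , z∈ , y∈′ = upcovers⇒⋖ cs m z∈ ◅ reach⇒≤C f y∈′

-- Each cover removes one entry, so a chain from `x` has at most `ρ x` steps. This is why `n` steps
-- are enough for compositions of `n`.
≤C⇒reach : ∀ f {x y} → ρ x ℕ.≤ f → x ≤C y → y ∈ reach f x
≤C⇒reach zero    ρ≤ ε       = here refl
≤C⇒reach (suc f) ρ≤ ε       = here refl
≤C⇒reach zero    ρ≤ (x ◅ p) = contradiction (subst (ℕ._≤ 0) (⋖-ρ x) ρ≤) λ ()
≤C⇒reach (suc f) {cs , m} ρ≤ (x ◅ p) =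
  there (concatMap⁺ (reach f) (⋖⇒upcovers cs m x) (≤C⇒reach f (ℕ.≤-pred (subst (ℕ._≤ suc f) (⋖-ρ x) ρ≤)) p))

==PC-sound : ∀ x y → (x ==PC y) ≡ true → x ≡ y
==PC-sound (cs , m) (ds , m′) eq with ∧-true⁻ (cs ==L ds) eq
... | p , q = cong₂ _,_ (==L-sound cs ds p) (≡ᵇ-sound m m′ q)

==PC-refl : ∀ x → (x ==PC x) ≡ true
==PC-refl (cs , m) = ∧-true (==L-refl cs) (≡ᵇ-refl m)

leqC⇒≤C : ∀ n {x y} → leqC n x y ≡ true → x ≤C y
leqC⇒≤C n {x} {y} eq with any⁻ (y ==PC_) (reach n x) eq
... | z , z∈ , y==z rewrite ==PC-sound y z y==z = reach⇒≤C n z∈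

≤C⇒leqC : ∀ n {x y} → ρ x ℕ.≤ n → x ≤C y → leqC n x y ≡ true
≤C⇒leqC n {x} {y} ρ≤ p = any⁺ (y ==PC_) (≤C⇒reach n ρ≤ p) (==PC-refl y)

consC : ℕ → PC → PC
consC a (cs , m) = a ∷ cs , m

-- The up-set of (a + c₁ , c₂ , … ; m): either the cut after the first entry is kept, or
-- that entry is carried over to the next one.
ups : ℕ → List ℕ → ℕ → List PC
ups a []       m = ([] , a ℕ.+ m) ∷ []
ups a (c ∷ cs) m = map (consC (a ℕ.+ c)) (ups 0 cs m) ++ ups (a ℕ.+ c) cs m

ups-refl : ∀ cs m → (cs , m) ∈ ups 0 cs m
ups-refl []       m = here refl
ups-refl (c ∷ cs) m = ∈-++⁺ˡ (∈-map⁺ (consC c) (ups-refl cs m))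

-- A merge of the first two entries means that no cut is made between them. The result therefore
-- lies in the second half of `ups`, where the first entry is carried over; the two accumulators
-- agree by associativity.
⋖-ups : ∀ {cs m ds m′} a {y} → (cs , m) ⋖ (ds , m′) → y ∈ ups a ds m′ → y ∈ ups a cs m
⋖-ups a {y} (merge {b} {c} {cs} {m}) y∈ =
  ∈-++⁺ʳ (map (consC (a ℕ.+ b)) (ups 0 (c ∷ cs) m))
    (subst (λ k → y ∈ map (consC k) (ups 0 cs m) ++ ups k cs m) (sym (ℕ.+-assoc a b c)) y∈)
⋖-ups a (last {b} {m}) (here refl) =
  ∈-++⁺ʳ (map (consC (a ℕ.+ b)) (ups 0 [] m)) (here (cong ([] ,_) (sym (ℕ.+-assoc a b m))))
⋖-ups a (skip {b} {cs} {m} {ds} {m′} x) y∈ with ∈-++⁻ (map (consC (a ℕ.+ b)) (ups 0 ds m′)) y∈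
... | inj₂ y∈′ = ∈-++⁺ʳ (map (consC (a ℕ.+ b)) (ups 0 cs m)) (⋖-ups (a ℕ.+ b) x y∈′)
... | inj₁ y∈′ with ∈-map⁻ (consC (a ℕ.+ b)) y∈′
...   | z , z∈ , refl = ∈-++⁺ˡ (∈-map⁺ (consC (a ℕ.+ b)) (⋖-ups 0 x z∈))

≤C⇒ups : ∀ {cs m y} → (cs , m) ≤C y → y ∈ ups 0 cs m
≤C⇒ups {cs} {m} ε = ups-refl cs m
≤C⇒ups (_◅_ {j = ds , m′} x p) = ⋖-ups 0 x (≤C⇒ups p)

≤C-cons : ∀ {x y} a → x ≤C y → consC a x ≤C consC a y
≤C-cons a = gmap (consC a) skip

-- The list is taken nonempty so that its first entry absorbs the accumulator; on its own, an
-- accumulator equal to 0 would be an illegal entry.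
ups⇒≤C : ∀ a c cs m {y} → y ∈ ups a (c ∷ cs) m → (a ℕ.+ c ∷ cs , m) ≤C y
ups⇒≤C a c cs m y∈ with ∈-++⁻ (map (consC (a ℕ.+ c)) (ups 0 cs m)) y∈
ups⇒≤C a c [] m y∈ | inj₁ (here refl) = ε
ups⇒≤C a c [] m y∈ | inj₂ (here refl) = last ◅ ε
ups⇒≤C a c (c′ ∷ cs) m y∈ | inj₂ y∈′ = merge ◅ ups⇒≤C (a ℕ.+ c) c′ cs m y∈′
ups⇒≤C a c (c′ ∷ cs) m y∈ | inj₁ y∈′ with ∈-map⁻ (consC (a ℕ.+ c)) y∈′
... | z , z∈ , refl = ≤C-cons (a ℕ.+ c) (ups⇒≤C 0 c′ cs m z∈)

ups0⇒≤C : ∀ cs m {y} → y ∈ ups 0 cs m → (cs , m) ≤C y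
ups0⇒≤C []       m (here refl) = ε
ups0⇒≤C (c ∷ cs) m y∈          = ups⇒≤C 0 c cs m y∈

-- Separates the two halves of `ups`: if the cut is kept, the head is exactly `a + c`; if it is
-- carried over, any head is larger, because the later entries are positive.
ups-head : ∀ a cs m → All (1 ℕ.≤_) cs → ∀ {h ds m′} → (h ∷ ds , m′) ∈ ups a cs m → a ℕ.< h
ups-head a []       m []          (here ())
ups-head a (c ∷ cs) m (1≤c ∷ pos) y∈ with ∈-++⁻ (map (consC (a ℕ.+ c)) (ups 0 cs m)) y∈
... | inj₂ y∈′ = ℕ.≤-<-trans (ℕ.m≤m+n a c) (ups-head (a ℕ.+ c) cs m pos y∈′)
... | inj₁ y∈′ with ∈-map⁻ (consC (a ℕ.+ c)) y∈′
...   | _ , _ , refl = ℕ.m<m+n a 1≤c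

consC-injective : ∀ a {x y} → consC a x ≡ consC a y → x ≡ y
consC-injective a refl = refl

ups-Unique : ∀ a cs m → All (1 ℕ.≤_) cs → Unique (ups a cs m)
ups-Unique a []       m []          = [] ∷ []
ups-Unique a (c ∷ cs) m (1≤c ∷ pos) =
  Unique.++⁺ (Unique.map⁺ (consC-injective (a ℕ.+ c)) (ups-Unique 0 cs m pos)) (ups-Unique (a ℕ.+ c) cs m pos)
    (λ { (z∈ , z∈′) → disjoint z∈ z∈′ })
  where
  disjoint : ∀ {z} → z ∈ map (consC (a ℕ.+ c)) (ups 0 cs m) → z ∈ ups (a ℕ.+ c) cs m → ⊥
  disjoint z∈ z∈′ with ∈-map⁻ (consC (a ℕ.+ c)) z∈
  ... | _ , _ , refl = ℕ.<-irrefl refl (ups-head (a ℕ.+ c) cs m pos z∈′)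

-- Types of pointed compositions and the filter condition

IsComp : ℕ → PC → Set
IsComp n (cs , m) = All (1 ℕ.≤_) cs × sum cs ℕ.+ m ≡ n

CoverI-cons : ∀ {x y} c → CoverI x y → CoverI (consC c x) (consC c y)
CoverI-cons c (inj₁ (a , b , rest , p , q , eq)) =
  inj₁ (a , b , c ∷ rest , ↭-trans (prep c p) (↭-trans (swap c a ↭-refl) (prep a (swap c b ↭-refl)))
                         , ↭-trans (prep c q) (swap c (a ℕ.+ b) ↭-refl) , eq)
CoverI-cons c (inj₂ (a , p , eq)) = inj₂ (a , ↭-trans (prep c p) (swap c a ↭-refl) , eq)

⋖-CoverI : ∀ {x y} → x ⋖ y → CoverI x y
⋖-CoverI (merge {a} {b} {cs}) = inj₁ (a , b , cs , ↭-refl , ↭-refl , refl)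
⋖-CoverI (last {a})           = inj₂ (a , ↭-refl , refl)
⋖-CoverI (skip {c} x)            = CoverI-cons c (⋖-CoverI x)

CoverI-IsComp : ∀ {n x y} → CoverI x y → IsComp n x → IsComp n y
CoverI-IsComp {x = cs , m} {ds , _} (inj₁ (a , b , rest , p , q , refl)) (pos , eq)
  with Perm.All-resp-↭ p pos
... | 1≤a ∷ 1≤b ∷ pos′ =
  Perm.All-resp-↭ (↭-sym q) (ℕ.≤-trans 1≤a (ℕ.m≤m+n a b) ∷ pos′) ,
  trans (cong (ℕ._+ m) (trans (sum-↭ q) (trans (ℕ.+-assoc a b (sum rest)) (sym (sum-↭ p))))) eq
CoverI-IsComp {x = cs , m} {ds , _} (inj₂ (a , p , refl)) (pos , eq) with Perm.All-resp-↭ p pos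
... | _ ∷ pos′ = pos′ ,
  trans (sym (ℕ.+-assoc (sum ds) a m)) (trans (cong (ℕ._+ m) (trans (ℕ.+-comm (sum ds) a) (sym (sum-↭ p)))) eq)

⋖-IsComp : ∀ {n x y} → x ⋖ y → IsComp n x → IsComp n y
⋖-IsComp x = CoverI-IsComp (⋖-CoverI x)

CoverI-resp-↭ : ∀ {cs cs′ m ds ds′ m′} → cs ↭ cs′ → ds ↭ ds′ →
                CoverI (cs , m) (ds , m′) → CoverI (cs′ , m) (ds′ , m′)
CoverI-resp-↭ p q (inj₁ (a , b , rest , r , s , eq)) =
  inj₁ (a , b , rest , ↭-trans (↭-sym p) r , ↭-trans (↭-sym q) s , eq)
CoverI-resp-↭ p q (inj₂ (a , r , eq)) = inj₂ (a , ↭-trans (↭-sym p) (↭-trans r (prep a q)) , eq)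

-- Chains of covers are built on unsorted lists of parts. A reordering counts as a step and becomes
-- an equality once `Steps⇒≤I` sorts the parts.
Step : PIP → PIP → Set
Step x y = CoverI x y ⊎ (proj₁ x ↭ proj₁ y × proj₂ x ≡ proj₂ y)

Step-cons : ∀ {x y} c → Step x y → Step (consC c x) (consC c y)
Step-cons c (inj₁ x)        = inj₁ (CoverI-cons c x)
Step-cons c (inj₂ (p , eq)) = inj₂ (prep c p , eq)

sort-cong-↭ : ∀ {xs ys} → xs ↭ ys → sort xs ≡ sort ys
sort-cong-↭ {xs} {ys} p = Pointwise-≡⇒≡ (↗↭↗⇒≋ ℕ.≤-totalOrder (sort-↗ xs) (sort-↗ ys)
  (↭⇒↭ₛ (↭-trans (sort-↭ xs) (↭-trans p (↭-sym (sort-↭ ys))))))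

sort-InI : ∀ {n cs m} → IsComp n (cs , m) → InI n (sort cs , m)
sort-InI {cs = cs} {m} (pos , eq) =
  sort-↗ cs , Perm.All-resp-↭ (↭-sym (sort-↭ cs)) pos , trans (cong (ℕ._+ m) (sum-↭ (sort-↭ cs))) eq

Steps⇒≤I : ∀ {n x y} → IsComp n x → Star Step x y → typeC x ≤I[ n ] typeC y
Steps⇒≤I c ε = ε
Steps⇒≤I c (inj₁ x◁z ◅ p) =
  (sort-InI c , sort-InI c′ , CoverI-resp-↭ (↭-sym (sort-↭ _)) (↭-sym (sort-↭ _)) x◁z) ◅ Steps⇒≤I c′ p
  where c′ = CoverI-IsComp x◁z c
Steps⇒≤I {n} {cs , m} (pos , eq) (_◅_ {j = ds , _} (inj₂ (cs↭ds , refl)) p) =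
  subst (λ es → (es , m) ≤I[ n ] _) (sym (sort-cong-↭ cs↭ds))
    (Steps⇒≤I (Perm.All-resp-↭ cs↭ds pos , trans (cong (ℕ._+ m) (sym (sum-↭ cs↭ds))) eq) p)

≤C⇒≤I : ∀ {n x y} → IsComp n x → x ≤C y → typeC x ≤I[ n ] typeC y
≤C⇒≤I c x≤y = Steps⇒≤I c (gmap id (inj₁ ∘ ⋖-CoverI) x≤y)

filter-up : ∀ {n F x y} → IsFilter n F → x ≤I[ n ] y → F x ≡ true → F y ≡ true
filter-up {F = F} {x} {y} isF x≤y Fx with F y | isF x y x≤y
... | true  | _ = refl
... | false | f rewrite Fx = ⊥-elim (f tt)

≤C-IsComp : ∀ {n x y} → x ≤C y → IsComp n x → IsComp n y
≤C-IsComp ε       c = c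
≤C-IsComp (x ◅ p) c = ≤C-IsComp p (⋖-IsComp x c)

sum≥length : ∀ {cs} → All (1 ℕ.≤_) cs → length cs ℕ.≤ sum cs
sum≥length []         = ℕ.z≤n
sum≥length (1≤c ∷ pos) = ℕ.+-mono-≤ 1≤c (sum≥length pos)

∈⇒≤sum : ∀ {c cs} → c ∈ cs → c ℕ.≤ sum cs
∈⇒≤sum {cs = c ∷ cs} (here refl) = ℕ.m≤m+n c (sum cs)
∈⇒≤sum {cs = c ∷ cs} (there c∈)  = ℕ.≤-trans (∈⇒≤sum c∈) (ℕ.m≤n+m (sum cs) c)

IsComp-ρ : ∀ {n x} → IsComp n x → ρ x ℕ.≤ n
IsComp-ρ {x = cs , m} (pos , refl) = ℕ.≤-trans (sum≥length pos) (ℕ.m≤m+n (sum cs) m)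

module _ (n : ℕ) where

  private
    withLast : ℕ → ℕ → List PC
    withLast k m = map (_, m) (bfilter (λ cs → (sum cs ℕ.+ m) ==ℕ n) (words k (oneTo n)))

    withLast⁻ : ∀ k m {x} → x ∈ withLast k m → ρ x ≡ k × proj₂ x ≡ m × IsComp n x
    withLast⁻ k m x∈ with ∈-map⁻ (_, m) x∈
    ... | cs , cs∈ , refl with ∈-bfilter⁻ (λ cs → (sum cs ℕ.+ m) ==ℕ n) (words k (oneTo n)) cs∈
    ...   | cs∈′ , eq with ∈-words⁻ k cs∈′
    ...     | len , cs⊆ = len , refl , All.map (proj₁ ∘ ∈-oneTo⁻) cs⊆ , ≡ᵇ-sound (sum cs ℕ.+ m) n eq

  ∈-pointedCompositions⁻ : ∀ {x} → x ∈ pointedCompositions n → IsComp n x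
  ∈-pointedCompositions⁻ x∈ with concatMap⁻ (λ k → concatMap (withLast k) (zeroTo n)) (zeroTo n) x∈
  ... | k , _ , x∈′ with concatMap⁻ (withLast k) (zeroTo n) x∈′
  ...   | m , _ , x∈″ = proj₂ (proj₂ (withLast⁻ k m x∈″))

  ∈-pointedCompositions⁺ : ∀ {x} → IsComp n x → x ∈ pointedCompositions n
  ∈-pointedCompositions⁺ {cs , m} c@(pos , eq) =
    concatMap⁺ (λ k → concatMap (withLast k) (zeroTo n)) (∈-upTo⁺ (ℕ.s≤s (IsComp-ρ c)))
      (concatMap⁺ (withLast (length cs)) (∈-upTo⁺ (ℕ.s≤s m≤n))
        (∈-map⁺ (_, m) (∈-bfilter⁺ _ (∈-words⁺ cs⊆) (≡ᵇ-complete eq))))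
    where
    m≤n : m ℕ.≤ n
    m≤n = subst (m ℕ.≤_) eq (ℕ.m≤n+m m (sum cs))
    cs⊆ : All (_∈ oneTo n) cs
    cs⊆ = All.tabulate (λ c∈ → ∈-oneTo⁺ (All.lookup pos c∈)
      (ℕ.≤-trans (∈⇒≤sum c∈) (subst (sum cs ℕ.≤_) eq (ℕ.m≤m+n (sum cs) m))))

  pointedCompositions-Unique : Unique (pointedCompositions n)
  pointedCompositions-Unique =
    concatMap-Unique (λ k → concatMap (withLast k) (zeroTo n)) (Unique.upTo⁺ (suc n))
      (λ k → concatMap-Unique (withLast k) (Unique.upTo⁺ (suc n))
        (λ m → Unique.map⁺ (cong proj₁) (bfilter-Unique _ (words-Unique k (oneTo-Unique n))))
        (λ {m} {m′} x∈ y∈ → trans (sym (proj₁ (proj₂ (withLast⁻ k m x∈)))) (proj₁ (proj₂ (withLast⁻ k m′ y∈)))))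
      same-length
    where
    len : ∀ {k z} → z ∈ concatMap (withLast k) (zeroTo n) → ρ z ≡ k
    len {k} z∈ with concatMap⁻ (withLast k) (zeroTo n) z∈
    ... | m , _ , z∈′ = proj₁ (withLast⁻ k m z∈′)
    same-length : ∀ {k l z} → z ∈ concatMap (withLast k) (zeroTo n) →
                  z ∈ concatMap (withLast l) (zeroTo n) → k ≡ l
    same-length z∈k z∈l = trans (sym (len z∈k)) (len z∈l)

module _ (n : ℕ) (F : PIP → Bool) where

  ∈-CF⁻ : ∀ {x} → x ∈ CF n F → IsComp n x × F (typeC x) ≡ true
  ∈-CF⁻ x∈ with ∈-bfilter⁻ (λ c → F (typeC c)) (pointedCompositions n) x∈
  ... | x∈′ , Fx = ∈-pointedCompositions⁻ n x∈′ , Fx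

  ∈-CF⁺ : ∀ {x} → IsComp n x → F (typeC x) ≡ true → x ∈ CF n F
  ∈-CF⁺ c Fx = ∈-bfilter⁺ (λ c → F (typeC c)) (∈-pointedCompositions⁺ n c) Fx

  CF-Unique : Unique (CF n F)
  CF-Unique = bfilter-Unique _ (pointedCompositions-Unique n)

  ∈-CF-ρ : ∀ {x} → x ∈ CF n F → ρ x ℕ.≤ n
  ∈-CF-ρ x∈ = IsComp-ρ (proj₁ (∈-CF⁻ x∈))

  CF-isFinPoset : IsFinPoset (CF∪0̂ n F)
  CF-isFinPoset = record
    { unique    = bot∷-Unique CF-Unique
    ; ==-sound  = λ { nothing nothing _ → refl ; (just x) (just y) eq → cong just (==PC-sound x y eq) }
    ; ==-refl   = λ { nothing → refl ; (just x) → ==PC-refl x }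
    ; ≼-refl    = λ { {nothing} _ → refl ; {just x} x∈ → ≤C⇒leqC n (∈-CF-ρ (∈-just⁻ x∈)) ε }
    ; ≼-trans   = λ { {nothing} _ _ _ _ _ → refl
                    ; {just x} {just y} {just z} x∈ _ _ p q →
                        ≤C⇒leqC n (∈-CF-ρ (∈-just⁻ x∈)) (leqC⇒≤C n {x} {y} p ◅◅ leqC⇒≤C n {y} {z} q) }
    ; ≼-antisym = λ { {nothing} {nothing} _ _ _ _ → refl
                    ; {just x} {just y} _ _ p q → cong just (≤C-antisym (leqC⇒≤C n {x} {y} p) (leqC⇒≤C n {y} {x} q)) }
    }

  -- The type grows along `≤C`, so everything above an element of `CF n F` is again in `CF n F`. The
  -- up-set is therefore that of the full poset, which `ups` lists without reference to `F`.
  ∑-up-set : IsFilter n F → ∀ {cs m} → (cs , m) ∈ CF n F → (W : PC → ℤ) →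
             ∑ (CF n F) (λ y → ⟦ leqC n (cs , m) y ⟧ * W y) ≡ ∑ (ups 0 cs m) W
  ∑-up-set isF {cs} {m} x∈ W = trans (sym (∑-bfilter (leqC n (cs , m)) (CF n F) W))
    (∑-↭ W (Unique-↭ (bfilter-Unique _ CF-Unique) (ups-Unique 0 cs m (proj₁ c)) to from))
    where
    c = proj₁ (∈-CF⁻ x∈)
    to : ∀ {y} → y ∈ bfilter (leqC n (cs , m)) (CF n F) → y ∈ ups 0 cs m
    to y∈ = ≤C⇒ups (leqC⇒≤C n (proj₂ (∈-bfilter⁻ (leqC n (cs , m)) (CF n F) y∈)))
    from : ∀ {y} → y ∈ ups 0 cs m → y ∈ bfilter (leqC n (cs , m)) (CF n F)
    from y∈ = ∈-bfilter⁺ _ (∈-CF⁺ (≤C-IsComp x≤y c) (filter-up {F = F} isF (≤C⇒≤I c x≤y) (proj₂ (∈-CF⁻ x∈))))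
                           (≤C⇒leqC n (∈-CF-ρ x∈) x≤y)
      where x≤y = ups0⇒≤C cs m y∈

-- Coarsenings of a pointed set partition

Bool-ext : ∀ {p q} → (p ≡ true → q ≡ true) → (q ≡ true → p ≡ true) → p ≡ q
Bool-ext {true}          p⇒q q⇒p = sym (p⇒q refl)
Bool-ext {false} {true}  p⇒q q⇒p = q⇒p refl
Bool-ext {false} {false} p⇒q q⇒p = refl

≤ᵇ-true : ∀ {a b} → a ℕ.≤ b → (a ℕ.≤ᵇ b) ≡ true
≤ᵇ-true {a} {b} a≤b with a ℕ.≤ᵇ b | ℕ.≤⇒≤ᵇ a≤b
... | true | _ = refl

≤ᵇ-true⁻ : ∀ a {b} → (a ℕ.≤ᵇ b) ≡ true → a ℕ.≤ b
≤ᵇ-true⁻ a {b} eq = ℕ.≤ᵇ⇒≤ a b (subst T (sym eq) tt)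

≤ᵇ-false : ∀ {a b} → b ℕ.< a → (a ℕ.≤ᵇ b) ≡ false
≤ᵇ-false {a} b<a = ≢true⇒≡false (λ eq → ℕ.<⇒≱ b<a (≤ᵇ-true⁻ a eq))

<ᵇ-true : ∀ {a b} → a ℕ.< b → (a ℕ.<ᵇ b) ≡ true
<ᵇ-true {a} {b} a<b with a ℕ.<ᵇ b | ℕ.<⇒<ᵇ a<b
... | true | _ = refl

<ᵇ-true⁻ : ∀ a {b} → (a ℕ.<ᵇ b) ≡ true → a ℕ.< b
<ᵇ-true⁻ a {b} eq = ℕ.<ᵇ⇒< a b (subst T (sym eq) tt)

<ᵇ-false : ∀ {a b} → b ℕ.≤ a → (a ℕ.<ᵇ b) ≡ false
<ᵇ-false {a} b≤a = ≢true⇒≡false (λ eq → ℕ.≤⇒≯ b≤a (<ᵇ-true⁻ a eq))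

<ᵇ-false⁻ : ∀ a {b} → (a ℕ.<ᵇ b) ≡ false → b ℕ.≤ a
<ᵇ-false⁻ a {b} eq = ℕ.≮⇒≥ (λ a<b → case (trans (sym eq) (<ᵇ-true a<b)))
  where
  case : false ≡ true → ⊥
  case ()

≡ᵇ-false : ∀ {a b} → a ≢ b → (a ℕ.≡ᵇ b) ≡ false
≡ᵇ-false {a} {b} a≢b = ≢true⇒≡false (a≢b ∘ ≡ᵇ-sound a b)

∑-upTo-suc : ∀ n (f : ℕ → ℤ) → ∑ (upTo (suc n)) f ≡ ∑ (upTo n) f + f n
∑-upTo-suc n f = trans (cong (λ xs → ∑ xs f) (sym (applyUpTo-∷ʳ id n)))
  (trans (∑-++ (upTo n) (n ∷ []) f) (+-congˡ (∑ (upTo n) f) (ℤ.+-identityʳ (f n))))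

∑-upTo-restrict : ∀ k n (f : ℕ → ℤ) → k ℕ.< n → ∑ (upTo n) (λ b → ⟦ b ℕ.≤ᵇ k ⟧ * f b) ≡ ∑ (upTo (suc k)) f
∑-upTo-restrict k (suc n) f k<1+n with k ℕ.≟ n
... | yes refl = ∑-cong (upTo (suc k)) λ {b} b∈ →
  trans (cong (λ p → ⟦ p ⟧ * f b) (≤ᵇ-true (ℕ.≤-pred (∈-upTo⁻ b∈)))) (ℤ.*-identityˡ (f b))
... | no k≢n = trans (∑-upTo-suc n _)
  (trans (cong₂ _+_ (∑-upTo-restrict k n f k<n) (cong (λ p → ⟦ p ⟧ * f n) (≤ᵇ-false k<n))) (ℤ.+-identityʳ _))
  where k<n = ℕ.≤∧≢⇒< (ℕ.≤-pred k<1+n) k≢n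

∑-const : ∀ {A : Set} (xs : List A) c → ∑ xs (λ _ → c) ≡ + length xs * c
∑-const []       c = refl
∑-const (x ∷ xs) c = trans (+-congˡ c (∑-const xs c)) (lemma (+ length xs) c)
  where
  lemma : ∀ l c → c + l * c ≡ (+ 1 + l) * c
  lemma = solve-∀

-- Stated recursively so that the value for a fresh block is literally the negative of `suc k` equal
-- terms, one for each old block and one for the zero block.
signedFactorial : ℕ → ℤ
signedFactorial zero    = + 1
signedFactorial (suc k) = - (+ suc k * signedFactorial k)

-- Sending a new block of π to one of the mx + 1 existing blocks of y, or to a fresh one, cancels.
signedFactorial-cancel : ∀ mx → ∑ (upTo (suc (suc mx))) (λ b → signedFactorial (mx ℕ.⊔ b)) ≡ + 0
signedFactorial-cancel mx = begin
  ∑ (upTo (suc (suc mx))) (λ b → signedFactorial (mx ℕ.⊔ b))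
    ≡⟨ ∑-upTo-suc (suc mx) (λ b → signedFactorial (mx ℕ.⊔ b)) ⟩
  ∑ (upTo (suc mx)) (λ b → signedFactorial (mx ℕ.⊔ b)) + signedFactorial (mx ℕ.⊔ suc mx)
    ≡⟨ cong₂ _+_ (∑-cong (upTo (suc mx)) (λ b∈ → cong signedFactorial (ℕ.m≥n⇒m⊔n≡m (ℕ.≤-pred (∈-upTo⁻ b∈)))))
                 (cong signedFactorial (ℕ.m≤n⇒m⊔n≡n (ℕ.n≤1+n mx))) ⟩
  ∑ (upTo (suc mx)) (λ _ → signedFactorial mx) + signedFactorial (suc mx)
    ≡⟨ cong (_+ signedFactorial (suc mx)) (trans (∑-const (upTo (suc mx)) (signedFactorial mx))
         (cong (λ l → + l * signedFactorial mx) (length-upTo (suc mx)))) ⟩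
  + suc mx * signedFactorial mx + signedFactorial (suc mx)
    ≡⟨ ℤ.+-inverseʳ (+ suc mx * signedFactorial mx) ⟩
  + 0 ∎
  where open ≡-Reasoning

at : List ℕ → ℕ → ℕ
at []       _       = 0
at (x ∷ xs) zero    = x
at (x ∷ xs) (suc j) = at xs j

at-∈ : ∀ {j} xs → j ℕ.< length xs → at xs j ∈ xs
at-∈ {zero}  (x ∷ xs) j<              = here refl
at-∈ {suc j} (x ∷ xs) (ℕ.s≤s j<)      = there (at-∈ xs j<)

at-∷ʳ-< : ∀ {j} xs b → j ℕ.< length xs → at (xs ++ [ b ]) j ≡ at xs j
at-∷ʳ-< {zero}  (x ∷ xs) b j<         = refl
at-∷ʳ-< {suc j} (x ∷ xs) b (ℕ.s≤s j<) = at-∷ʳ-< xs b j<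

at-∷ʳ-≡ : ∀ xs b → at (xs ++ [ b ]) (length xs) ≡ b
at-∷ʳ-≡ []       b = refl
at-∷ʳ-≡ (x ∷ xs) b = at-∷ʳ-≡ xs b

length-∷ʳ : ∀ (xs : List ℕ) b → length (xs ++ [ b ]) ≡ suc (length xs)
length-∷ʳ xs b = trans (length-++ xs) (ℕ.+-comm (length xs) 1)

-- A pointed partition is coarser than a exactly when its labelling factors through that of a
-- by a relabelling that fixes 0.
Coarsens : List ℕ → List ℕ → Set
Coarsens a b = ∃[ f ] f 0 ≡ 0 × b ≡ map f a

Coarsens-refl : ∀ a → Coarsens a a
Coarsens-refl a = id , refl , sym (map-id a)

Coarsens-trans : ∀ {a b c} → Coarsens a b → Coarsens b c → Coarsens a c
Coarsens-trans {a} (f , f0 , refl) (g , g0 , refl) = g ∘ f , trans (cong g f0) g0 , sym (map-∘ a)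

-- The relabelling behind a refinement: the image of `x` is read off at its first occurrence, and
-- `refines` makes the other occurrences agree. The default 0 is met only at labels that do not
-- occur.
find-label : List (ℕ × ℕ) → ℕ → ℕ
find-label []             x = 0
find-label ((a , b) ∷ ps) x = if a ℕ.≡ᵇ x then b else find-label ps x

find-label-∈ : ∀ ps {x y} → (x , y) ∈ ps → (x , find-label ps x) ∈ ps
find-label-∈ ((a , b) ∷ ps) {x} xy∈ with a ℕ.≡ᵇ x in eq
... | true  rewrite ≡ᵇ-sound a x eq = here refl
find-label-∈ ((a , b) ∷ ps) (here refl) | false with () ← trans (sym eq) (≡ᵇ-refl a)
find-label-∈ ((a , b) ∷ ps) (there xy∈) | false = there (find-label-∈ ps xy∈)

map≡-from-zip : ∀ {f : ℕ → ℕ} a b → length a ≡ length b →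
                (∀ {x y} → (x , y) ∈ zip a b → y ≡ f x) → b ≡ map f a
map≡-from-zip []      []      len eq = refl
map≡-from-zip (x ∷ a) (y ∷ b) len eq =
  cong₂ _∷_ (eq (here refl)) (map≡-from-zip a b (ℕ.suc-injective len) (eq ∘ there))

zip-map⁻ : ∀ {f : ℕ → ℕ} a {x y} → (x , y) ∈ zip a (map f a) → y ≡ f x
zip-map⁻ (x ∷ a) (here refl) = refl
zip-map⁻ (x ∷ a) (there xy∈) = zip-map⁻ a xy∈

refines⇒Coarsens : ∀ a b → length a ≡ length b → refines a b ≡ true → Coarsens a b
refines⇒Coarsens a b len eq = f , refl , map≡-from-zip a b len value
  where
  ps = zip a b
  f : ℕ → ℕ
  f zero    = 0
  f (suc x) = find-label ps (suc x)
  zeros = proj₁ (∧-true⁻ (all (λ p → not (proj₁ p ==ℕ 0) ∨ (proj₂ p ==ℕ 0)) ps) eq)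
  pairs = proj₂ (∧-true⁻ (all (λ p → not (proj₁ p ==ℕ 0) ∨ (proj₂ p ==ℕ 0)) ps) eq)
  value : ∀ {x y} → (x , y) ∈ ps → y ≡ f x
  value {zero}  {y} xy∈ = ≡ᵇ-sound y 0 (all⁻ _ ps zeros xy∈)
  value {suc x} {y} xy∈ with all⁻ _ ps (all⁻ _ ps pairs xy∈) (find-label-∈ ps xy∈)
  ... | eq rewrite ≡ᵇ-refl x = ≡ᵇ-sound y _ eq

Coarsens⇒refines : ∀ a b → Coarsens a b → refines a b ≡ true
Coarsens⇒refines a _ (f , f0 , refl) = ∧-true (all⁺ _ ps zeros) (all⁺ _ ps (λ p∈ → all⁺ _ ps (pairs p∈)))
  where
  ps = zip a (map f a)
  zeros : ∀ {p} → p ∈ ps → (not (proj₁ p ==ℕ 0) ∨ (proj₂ p ==ℕ 0)) ≡ true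
  zeros {zero  , y} p∈ = ≡ᵇ-complete (trans (zip-map⁻ a p∈) f0)
  zeros {suc x , y} p∈ = refl
  pairs : ∀ {p q} → p ∈ ps → q ∈ ps →
          (not ((proj₁ p ==ℕ proj₁ q) ∧ not (proj₁ p ==ℕ 0)) ∨ (proj₂ p ==ℕ proj₂ q)) ≡ true
  pairs {x , y} {x′ , y′} p∈ q∈ with x ==ℕ x′ in eq
  ... | false = refl
  ... | true  rewrite ≡ᵇ-complete {y} {y′}
                        (trans (zip-map⁻ a p∈) (trans (cong f (≡ᵇ-sound x x′ eq)) (sym (zip-map⁻ a q∈)))) =
    ∨-true (not (not (x ==ℕ 0)))
    where
    ∨-true : ∀ p → (p ∨ true) ≡ true
    ∨-true true  = refl
    ∨-true false = refl

validRGS-∷⁻ : ∀ mx a as → validRGS mx (a ∷ as) ≡ true → a ℕ.≤ suc mx × validRGS (mx ℕ.⊔ a) as ≡ true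
validRGS-∷⁻ mx a as v with ∧-true⁻ (a ℕ.≤ᵇ suc mx) v
... | a≤ , v′ = ≤ᵇ-true⁻ a a≤ , v′

-- Both relabellings fix the labels up to `mx`. If one of the next two labels is among these, it is
-- fixed, so the two are equal; if neither is, restricted growth makes both equal to `mx + 1`, and
-- that label is fixed from then on.
Coarsens-antisym : ∀ mx (f g : ℕ → ℕ) → (∀ j → j ℕ.≤ mx → f j ≡ j) → (∀ j → j ℕ.≤ mx → g j ≡ j) →
                   ∀ a b → b ≡ map f a → a ≡ map g b →
                   validRGS mx a ≡ true → validRGS mx b ≡ true → a ≡ b
Coarsens-antisym mx f g f-id g-id []      []      p q va vb = refl
Coarsens-antisym mx f g f-id g-id (x ∷ a) (y ∷ b) p q va vb
  with validRGS-∷⁻ mx x a va | validRGS-∷⁻ mx y b vb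
... | x≤ , va′ | y≤ , vb′ = cong₂ _∷_ x≡y
      (Coarsens-antisym (mx ℕ.⊔ x) f g (extend f f-id fx≡x) (extend g g-id (trans (cong g x≡y) (sym x≡gy)))
        a b (∷-injectiveʳ p) (∷-injectiveʳ q) va′ (subst (λ z → validRGS (mx ℕ.⊔ z) b ≡ true) (sym x≡y) vb′))
  where
  y≡fx = ∷-injectiveˡ p
  x≡gy = ∷-injectiveˡ q
  x≡y : x ≡ y
  x≡y with x ℕ.≤? mx | y ℕ.≤? mx
  ... | yes x≤mx | _        = sym (trans y≡fx (f-id x x≤mx))
  ... | no _     | yes y≤mx = trans x≡gy (g-id y y≤mx)
  ... | no x≰mx  | no y≰mx  = trans (ℕ.≤-antisym x≤ (ℕ.≰⇒> x≰mx)) (ℕ.≤-antisym (ℕ.≰⇒> y≰mx) y≤)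
  fx≡x = trans (sym y≡fx) (sym x≡y)
  extend : ∀ h → (∀ j → j ℕ.≤ mx → h j ≡ j) → h x ≡ x → ∀ j → j ℕ.≤ mx ℕ.⊔ x → h j ≡ j
  extend h h-id hx j j≤ with j ℕ.≤? mx
  ... | yes j≤mx = h-id j j≤mx
  ... | no j≰mx with ℕ.⊔-sel mx x
  ...   | inj₁ eq = contradiction (subst (j ℕ.≤_) eq j≤) j≰mx
  ...   | inj₂ eq rewrite ℕ.≤-antisym (subst (j ℕ.≤_) eq j≤) (ℕ.≤-trans x≤ (ℕ.≰⇒> j≰mx)) = hx

-- Left-to-right test that y factors through π; vs lists the images of the labels met so far.
factors : List ℕ → List ℕ → List ℕ → Bool
factors vs []      y       = true
factors vs (a ∷ π) []      = true
factors vs (a ∷ π) (b ∷ y) =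
  if a ℕ.<ᵇ length vs then (b ℕ.≡ᵇ at vs a) ∧ factors vs π y else factors (vs ++ [ b ]) π y

Extends : List ℕ → (ℕ → ℕ) → Set
Extends vs f = ∀ j → j ℕ.< length vs → f j ≡ at vs j

validRGS-old : ∀ {mx a} {vs : List ℕ} → length vs ≡ suc mx → (a ℕ.<ᵇ length vs) ≡ true → mx ℕ.⊔ a ≡ mx
validRGS-old {mx} {a} len a< = ℕ.m≥n⇒m⊔n≡m (ℕ.≤-pred (subst (suc a ℕ.≤_) len (<ᵇ-true⁻ a a<)))

validRGS-new : ∀ {mx a} {vs : List ℕ} → length vs ≡ suc mx → a ℕ.≤ suc mx → (a ℕ.<ᵇ length vs) ≡ false → a ≡ suc mx
validRGS-new {mx} {a} len a≤ a≮ = ℕ.≤-antisym a≤ (subst (ℕ._≤ a) len (<ᵇ-false⁻ a a≮))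

⊔-suc : ∀ mx → mx ℕ.⊔ suc mx ≡ suc mx
⊔-suc mx = ℕ.m≤n⇒m⊔n≡n (ℕ.n≤1+n mx)

-- The condition on `length vs` says that `vs` is indexed by the labels 0, ..., `mx`. By restricted
-- growth an unlisted label equals `length vs`, so appending its image stores it at the right index.
factors-sound : ∀ {mx} vs π y → length vs ≡ suc mx → validRGS mx π ≡ true → length π ≡ length y →
                factors vs π y ≡ true → ∃[ f ] Extends vs f × y ≡ map f π
factors-sound vs []      []      len v leq ok = at vs , (λ _ _ → refl) , refl
factors-sound {mx} vs (a ∷ π) (b ∷ y) len v leq ok with validRGS-∷⁻ mx a π v | a ℕ.<ᵇ length vs in a<
... | a≤ , v′ | true with ∧-true⁻ (b ℕ.≡ᵇ at vs a) ok
...   | b≡ , ok′ with factors-sound vs π y len (subst (λ k → validRGS k π ≡ true) (validRGS-old {vs = vs} len a<) v′) (ℕ.suc-injective leq) ok′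
...     | f , ext , refl = f , ext , cong (_∷ map f π) (trans (≡ᵇ-sound b _ b≡) (sym (ext a (<ᵇ-true⁻ a a<))))
factors-sound {mx} vs (a ∷ π) (b ∷ y) len v leq ok | a≤ , v′ | false
  with validRGS-new {vs = vs} len a≤ a<
... | refl with factors-sound (vs ++ [ b ]) π y (trans (length-∷ʳ vs b) (cong suc len))
                  (subst (λ k → validRGS k π ≡ true) (⊔-suc mx) v′) (ℕ.suc-injective leq) ok
...   | f , ext , refl = f , ext′ , cong (_∷ map f π) b≡
  where
  len′ = length-∷ʳ vs b
  ext′ : Extends vs f
  ext′ j j< = trans (ext j (subst (j ℕ.<_) (sym len′) (ℕ.m≤n⇒m≤1+n j<))) (at-∷ʳ-< vs b j<)
  b≡ : b ≡ f (suc mx)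
  b≡ = sym (trans (cong f (sym len)) (trans (ext (length vs) (ℕ.≤-reflexive (sym len′))) (at-∷ʳ-≡ vs b)))

factors-complete : ∀ {mx} vs π (f : ℕ → ℕ) → length vs ≡ suc mx → validRGS mx π ≡ true →
                   Extends vs f → factors vs π (map f π) ≡ true
factors-complete vs []      f len v ext = refl
factors-complete {mx} vs (a ∷ π) f len v ext with validRGS-∷⁻ mx a π v | a ℕ.<ᵇ length vs in a<
... | a≤ , v′ | true = ∧-true (≡ᵇ-complete (ext a (<ᵇ-true⁻ a a<)))
  (factors-complete vs π f len (subst (λ k → validRGS k π ≡ true) (validRGS-old {vs = vs} len a<) v′) ext)
... | a≤ , v′ | false with validRGS-new {vs = vs} len a≤ a<
...   | refl = factors-complete (vs ++ [ f (suc mx) ]) π f (trans (length-∷ʳ vs _) (cong suc len))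
                  (subst (λ k → validRGS k π ≡ true) (⊔-suc mx) v′) ext′
  where
  ext′ : Extends (vs ++ [ f (suc mx) ]) f
  ext′ j j< with j ℕ.<? length vs
  ... | yes j<′ = trans (ext j j<′) (sym (at-∷ʳ-< vs _ j<′))
  ... | no j≮ with ℕ.≤-antisym (ℕ.≤-pred (subst (j ℕ.<_) (length-∷ʳ vs _) j<)) (ℕ.≮⇒≥ j≮)
  ...   | refl = trans (cong f len) (sym (at-∷ʳ-≡ vs _))

-- The initial list `[ 0 ]` records that the zero block goes to the zero block. The left-to-right
-- form allows a sum over `y` to be taken letter by letter.
refines≡factors : ∀ π y → validRGS 0 π ≡ true → length π ≡ length y → refines π y ≡ factors [ 0 ] π y
refines≡factors π y v len = Bool-ext to from
  where
  to : refines π y ≡ true → factors [ 0 ] π y ≡ true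
  to r with refines⇒Coarsens π y len r
  ... | f , f0 , refl = factors-complete [ 0 ] π f refl v (λ { zero _ → f0 ; (suc j) (ℕ.s≤s ()) })
  from : factors [ 0 ] π y ≡ true → refines π y ≡ true
  from ok with factors-sound [ 0 ] π y refl v len ok
  ... | f , ext , eq = Coarsens⇒refines π y (f , ext 0 (ℕ.s≤s ℕ.z≤n) , eq)

-- On a restricted growth word, started at 0, this is the number of ordinary blocks.
finalMax : ℕ → List ℕ → ℕ
finalMax mx []      = mx
finalMax mx (a ∷ y) = finalMax (mx ℕ.⊔ a) y

-- Induction on `π`. An old label of `π` forces the letter of `y`. A new one leaves the choices 0,
-- ..., `mx + 1`; the remaining sum depends on the choice `b` only through
-- `signedFactorial (mx ⊔ b)`, and these values cancel. So only a `π` without new labels survives,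
-- which for `vs = [ 0 ]` is 1̂. The bound by `n` keeps the label `mx + 1` inside the alphabet
-- `zeroTo n`.
∑-coarsenings : ∀ n {mxπ} π vs mx → length vs ≡ suc mxπ → validRGS mxπ π ≡ true →
  All (ℕ._≤ mx) vs → length π ℕ.+ mx ℕ.≤ n →
  ∑ (words (length π) (zeroTo n)) (λ y → ⟦ validRGS mx y ⟧ * (⟦ factors vs π y ⟧ * signedFactorial (finalMax mx y)))
    ≡ ⟦ all (ℕ._<ᵇ length vs) π ⟧ * signedFactorial mx
∑-coarsenings n [] vs mx len v vs≤ bound =
  trans (ℤ.+-identityʳ _) (ℤ.*-identityˡ _)
∑-coarsenings n {mxπ} (a ∷ π) vs mx len v vs≤ bound = trans (∑-words (length π) (zeroTo n) _) step
  where
  open ≡-Reasoning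
  a≤ = proj₁ (validRGS-∷⁻ mxπ a π v)
  v′ = proj₂ (validRGS-∷⁻ mxπ a π v)
  summand : ℕ → List ℕ → ℤ
  summand b y = ⟦ validRGS mx (b ∷ y) ⟧ * (⟦ factors vs (a ∷ π) (b ∷ y) ⟧ * signedFactorial (finalMax (mx ℕ.⊔ b) y))
  bound′ : length π ℕ.+ mx ℕ.≤ n
  bound′ = ℕ.≤-trans (ℕ.n≤1+n _) bound
  step : ∑ (zeroTo n) (λ b → ∑ (words (length π) (zeroTo n)) (summand b))
         ≡ ⟦ all (ℕ._<ᵇ length vs) (a ∷ π) ⟧ * signedFactorial mx
  step with a ℕ.<ᵇ length vs in a<
  ... | true = begin
    ∑ (zeroTo n) g
      ≡⟨ ∑-single g (Unique.upTo⁺ (suc n)) (∈-upTo⁺ (ℕ.s≤s (ℕ.≤-trans w≤mx (ℕ.m+n≤o⇒n≤o (length π) bound′))))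
           (λ _ b≢w → ∑-zero (words (length π) (zeroTo n)) (λ {y} _ → off b≢w y)) ⟩
    g w
      ≡⟨ ∑-ext (words (length π) (zeroTo n)) on ⟩
    ∑ (words (length π) (zeroTo n)) (λ y → ⟦ validRGS mx y ⟧ * (⟦ factors vs π y ⟧ * signedFactorial (finalMax mx y)))
      ≡⟨ ∑-coarsenings n π vs mx len (subst (λ k → validRGS k π ≡ true) (validRGS-old {vs = vs} len a<) v′) vs≤ bound′ ⟩
    ⟦ all (ℕ._<ᵇ length vs) π ⟧ * signedFactorial mx ∎
    where
    w = at vs a
    w≤mx : w ℕ.≤ mx
    w≤mx = All.lookup vs≤ (at-∈ vs (<ᵇ-true⁻ a a<))
    term : ℕ → List ℕ → ℤ
    term b y = ⟦ (b ℕ.≤ᵇ suc mx) ∧ validRGS (mx ℕ.⊔ b) y ⟧ *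
               (⟦ (b ℕ.≡ᵇ w) ∧ factors vs π y ⟧ * signedFactorial (finalMax (mx ℕ.⊔ b) y))
    g : ℕ → ℤ
    g b = ∑ (words (length π) (zeroTo n)) (term b)
    off : ∀ {b} → b ≢ w → ∀ y → term b y ≡ + 0
    off {b} b≢w y rewrite ≡ᵇ-false b≢w = ℤ.*-zeroʳ ⟦ (b ℕ.≤ᵇ suc mx) ∧ validRGS (mx ℕ.⊔ b) y ⟧
    on : ∀ y → term w y ≡ ⟦ validRGS mx y ⟧ * (⟦ factors vs π y ⟧ * signedFactorial (finalMax mx y))
    on y rewrite ≤ᵇ-true (ℕ.m≤n⇒m≤1+n w≤mx) | ≡ᵇ-refl w | ℕ.m≥n⇒m⊔n≡m w≤mx = refl
  ... | false = begin
    ∑ (zeroTo n) (λ b → ∑ ws (term b))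
      ≡⟨ ∑-ext (zeroTo n) factor ⟩
    ∑ (zeroTo n) (λ b → ⟦ b ℕ.≤ᵇ suc mx ⟧ * ∑ ws (term′ b))
      ≡⟨ ∑-upTo-restrict (suc mx) (suc n) (λ b → ∑ ws (term′ b)) (ℕ.s≤s 1+mx≤n) ⟩
    ∑ (upTo (suc (suc mx))) (λ b → ∑ ws (term′ b))
      ≡⟨ ∑-cong (upTo (suc (suc mx))) (λ b∈ → branch (ℕ.≤-pred (∈-upTo⁻ b∈))) ⟩
    ∑ (upTo (suc (suc mx))) (λ b → ⟦ all (ℕ._<ᵇ suc (length vs)) π ⟧ * signedFactorial (mx ℕ.⊔ b))
      ≡⟨ ∑-*ˡ (upTo (suc (suc mx))) ⟦ all (ℕ._<ᵇ suc (length vs)) π ⟧ _ ⟩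
    ⟦ all (ℕ._<ᵇ suc (length vs)) π ⟧ * ∑ (upTo (suc (suc mx))) (λ b → signedFactorial (mx ℕ.⊔ b))
      ≡⟨ cong (⟦ all (ℕ._<ᵇ suc (length vs)) π ⟧ *_) (signedFactorial-cancel mx) ⟩
    ⟦ all (ℕ._<ᵇ suc (length vs)) π ⟧ * + 0
      ≡⟨ ℤ.*-zeroʳ ⟦ all (ℕ._<ᵇ suc (length vs)) π ⟧ ⟩
    + 0 ∎
    where
    ws = words (length π) (zeroTo n)
    1+mx≤n : suc mx ℕ.≤ n
    1+mx≤n = ℕ.≤-trans (ℕ.s≤s (ℕ.m≤n+m mx (length π))) bound
    term term′ : ℕ → List ℕ → ℤ
    term b y = ⟦ (b ℕ.≤ᵇ suc mx) ∧ validRGS (mx ℕ.⊔ b) y ⟧ *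
               (⟦ factors (vs ++ [ b ]) π y ⟧ * signedFactorial (finalMax (mx ℕ.⊔ b) y))
    term′ b y = ⟦ validRGS (mx ℕ.⊔ b) y ⟧ * (⟦ factors (vs ++ [ b ]) π y ⟧ * signedFactorial (finalMax (mx ℕ.⊔ b) y))
    factor : ∀ b → ∑ ws (term b) ≡ ⟦ b ℕ.≤ᵇ suc mx ⟧ * ∑ ws (term′ b)
    factor b = trans (∑-ext ws (λ y → ⟦∧⟧-* (b ℕ.≤ᵇ suc mx) (validRGS (mx ℕ.⊔ b) y) (⟦ factors (vs ++ [ b ]) π y ⟧ * signedFactorial (finalMax (mx ℕ.⊔ b) y))))
                     (∑-*ˡ ws ⟦ b ℕ.≤ᵇ suc mx ⟧ (term′ b))
    branch : ∀ {b} → b ℕ.≤ suc mx → ∑ ws (term′ b) ≡ ⟦ all (ℕ._<ᵇ suc (length vs)) π ⟧ * signedFactorial (mx ℕ.⊔ b)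
    branch {b} b≤ = trans
      (∑-coarsenings n π (vs ++ [ b ]) (mx ℕ.⊔ b) (trans (length-∷ʳ vs b) (cong suc len))
        (subst (λ k → validRGS k π ≡ true)
               (trans (cong (mxπ ℕ.⊔_) (validRGS-new {vs = vs} len a≤ a<)) (⊔-suc mxπ)) v′)
        (All.∷ʳ⁺ (All.map (λ x≤ → ℕ.≤-trans x≤ (ℕ.m≤m⊔n mx b)) vs≤) (ℕ.m≤n⊔m mx b))
        (ℕ.≤-trans (ℕ.+-monoʳ-≤ (length π) (ℕ.⊔-lub (ℕ.n≤1+n mx) b≤))
                   (ℕ.≤-trans (ℕ.≤-reflexive (ℕ.+-suc (length π) mx)) bound)))
      (cong (λ l → ⟦ all (ℕ._<ᵇ l) π ⟧ * signedFactorial (mx ℕ.⊔ b)) (length-∷ʳ vs b))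

-- Types of pointed set partitions

parts : (ℕ → ℕ) → List ℕ → List ℕ
parts g J = bfilter (λ c → not (c ==ℕ 0)) (map g J)

consPart : ℕ → List ℕ → List ℕ
consPart zero    r = r
consPart (suc c) r = suc c ∷ r

consPart-pos : ∀ {c} r → 1 ℕ.≤ c → consPart c r ≡ c ∷ r
consPart-pos {suc c} r _ = refl

consPart-↭ : ∀ c {r r′} → r ↭ r′ → consPart c r ↭ consPart c r′
consPart-↭ zero    p = p
consPart-↭ (suc c) p = prep (suc c) p

consPart-comm : ∀ c d r → consPart c (consPart d r) ↭ consPart d (consPart c r)
consPart-comm zero    d       r = ↭-refl
consPart-comm (suc c) zero    r = ↭-refl
consPart-comm (suc c) (suc d) r = swap (suc c) (suc d) ↭-refl

parts-∷ : ∀ g j J → parts g (j ∷ J) ≡ consPart (g j) (parts g J)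
parts-∷ g j J with g j
... | zero  = refl
... | suc c = refl

parts-cong : ∀ {g h} J → (∀ {j} → j ∈ J → g j ≡ h j) → parts g J ≡ parts h J
parts-cong []      g≡h = refl
parts-cong {g} {h} (j ∷ J) g≡h = trans (parts-∷ g j J)
  (trans (cong₂ consPart (g≡h (here refl)) (parts-cong J (g≡h ∘ there))) (sym (parts-∷ h j J)))

parts-zero : ∀ {g} J → (∀ {j} → j ∈ J → g j ≡ 0) → parts g J ≡ []
parts-zero {g} []      g≡0 = refl
parts-zero {g} (j ∷ J) g≡0 = trans (parts-∷ g j J)
  (trans (cong (λ c → consPart c (parts g J)) (g≡0 (here refl))) (parts-zero J (g≡0 ∘ there)))

parts-split : ∀ {g h : ℕ → ℕ} {j J} → Unique J → j ∈ J → (∀ {i} → i ≢ j → h i ≡ g i) →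
  ∃[ rest ] parts g J ↭ consPart (g j) rest × parts h J ↭ consPart (h j) rest
parts-split {g} {h} {j} {_ ∷ J} (j∉ ∷ u) (here refl) h≡g =
  parts g J , ↭-reflexive (parts-∷ g j J) ,
  ↭-reflexive (trans (parts-∷ h j J) (cong (consPart (h j)) (parts-cong J (λ i∈ → h≡g (All.lookup j∉ i∈ ∘ sym)))))
parts-split {g} {h} {j} {i ∷ J} (i∉ ∷ u) (there j∈) h≡g with parts-split u j∈ h≡g
... | rest , p , q = consPart (g i) rest
  , ↭-trans (↭-reflexive (parts-∷ g i J)) (↭-trans (consPart-↭ (g i) p) (consPart-comm (g i) (g j) rest))
  , ↭-trans (↭-reflexive (trans (parts-∷ h i J) (cong (λ c → consPart c (parts h J)) (h≡g (All.lookup i∉ j∈)))))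
            (↭-trans (consPart-↭ (g i) q) (consPart-comm (g i) (h j) rest))

-- If block `j` was empty, the part `s` simply becomes that block, which is a reordering; otherwise
-- `s` and `g j` merge, which is a cover.
parts-add : ∀ {g h : ℕ → ℕ} {j J s} m → 1 ℕ.≤ s → Unique J → j ∈ J → (∀ {i} → i ≢ j → h i ≡ g i) →
            h j ≡ s ℕ.+ g j → Step (s ∷ parts g J , m) (parts h J , m)
parts-add {g} {h} {j} {J} {s} m 1≤s u j∈ h≡g hj with parts-split u j∈ h≡g
... | rest , p , q rewrite hj with g j
...   | zero  rewrite ℕ.+-identityʳ s | consPart-pos rest 1≤s = inj₂ (↭-trans (prep s p) (↭-sym q) , refl)
...   | suc c rewrite consPart-pos rest (ℕ.≤-trans 1≤s (ℕ.m≤m+n s (suc c))) =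
        inj₁ (inj₁ (s , suc c , rest , prep s p , q , refl))

labelSum : ℕ → List (ℕ × ℕ) → ℕ
labelSum j []             = 0
labelSum j ((l , s) ∷ ps) = (if j ℕ.≡ᵇ l then s else 0) ℕ.+ labelSum j ps

-- A pair `(l , s)` sends a part of size `s` to block `l`, and the pairs are treated one at a time.
-- For `l = 0` the part is merged into the pointed part at once; otherwise it is carried along while
-- the others are merged, then added to its block.
Steps-merge : ∀ n ps m → All (λ p → proj₁ p ℕ.≤ n) ps → All (λ p → 1 ℕ.≤ proj₂ p) ps →
  Star Step (map proj₂ ps , m) (parts (λ j → labelSum j ps) (oneTo n) , labelSum 0 ps ℕ.+ m)
Steps-merge n [] m _ _ rewrite parts-zero {λ _ → 0} (oneTo n) (λ _ → refl) = ε
Steps-merge n ((zero , s) ∷ ps) m (_ ∷ l≤) (1≤s ∷ pos) =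
  inj₁ (inj₂ (s , ↭-refl , refl)) ◅
  subst₂ (λ xs k → Star Step (map proj₂ ps , s ℕ.+ m) (xs , k))
    (parts-cong (oneTo n) (λ {j} j∈ → same j∈))
    (trans (sym (ℕ.+-assoc (labelSum 0 ps) s m)) (cong (ℕ._+ m) (ℕ.+-comm (labelSum 0 ps) s)))
    (Steps-merge n ps (s ℕ.+ m) l≤ pos)
  where
  same : ∀ {j} → j ∈ oneTo n → labelSum j ps ≡ labelSum j ((zero , s) ∷ ps)
  same {zero}  j∈ with () ← proj₁ (∈-oneTo⁻ j∈)
  same {suc j} j∈ = refl
Steps-merge n ((suc l , s) ∷ ps) m (l≤ ∷ ls≤) (1≤s ∷ pos) =
  gmap (consC s) (Step-cons s) (Steps-merge n ps m ls≤ pos) ◅◅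
  (parts-add (labelSum 0 ps ℕ.+ m) 1≤s (oneTo-Unique n) (∈-oneTo⁺ (ℕ.s≤s ℕ.z≤n) l≤)
    (λ {i} i≢ → cong (λ p → (if p then s else 0) ℕ.+ labelSum i ps) (≡ᵇ-false i≢))
    (cong (λ p → (if p then s else 0) ℕ.+ labelSum (suc l) ps) (≡ᵇ-refl l)) ◅ ε)

zeroTo≡0∷oneTo : ∀ n → zeroTo n ≡ 0 ∷ oneTo n
zeroTo≡0∷oneTo n = cong (0 ∷_) (sym (map-applyUpTo id suc n))

+count : ∀ j ls → + count j ls ≡ ∑ ls (λ x → ⟦ j ℕ.≡ᵇ x ⟧)
+count j ls = length-bfilter (j ==ℕ_) ls

count-map : ∀ n f j ls → All (_∈ zeroTo n) ls →
            + count j (map f ls) ≡ ∑ (zeroTo n) (λ i → ⟦ j ℕ.≡ᵇ f i ⟧ * + count i ls)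
count-map n f j ls ls⊆ = begin
  + count j (map f ls)
    ≡⟨ trans (+count j (map f ls)) (∑-map f ls _) ⟩
  ∑ ls (λ x → ⟦ j ℕ.≡ᵇ f x ⟧)
    ≡⟨ ∑-cong ls (λ {x} x∈ → sym (trans
         (∑-single (λ i → ⟦ j ℕ.≡ᵇ f i ⟧ * ⟦ i ℕ.≡ᵇ x ⟧) (Unique.upTo⁺ (suc n)) (All.lookup ls⊆ x∈) (λ _ → off))
         (on x))) ⟩
  ∑ ls (λ x → ∑ (zeroTo n) (λ i → ⟦ j ℕ.≡ᵇ f i ⟧ * ⟦ i ℕ.≡ᵇ x ⟧))
    ≡⟨ ∑-swap ls (zeroTo n) _ ⟩
  ∑ (zeroTo n) (λ i → ∑ ls (λ x → ⟦ j ℕ.≡ᵇ f i ⟧ * ⟦ i ℕ.≡ᵇ x ⟧))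
    ≡⟨ ∑-ext (zeroTo n) (λ i → trans (∑-*ˡ ls ⟦ j ℕ.≡ᵇ f i ⟧ (λ x → ⟦ i ℕ.≡ᵇ x ⟧))
                                     (cong (⟦ j ℕ.≡ᵇ f i ⟧ *_) (sym (+count i ls)))) ⟩
  ∑ (zeroTo n) (λ i → ⟦ j ℕ.≡ᵇ f i ⟧ * + count i ls) ∎
  where
  open ≡-Reasoning
  off : ∀ {i x} → i ≢ x → ⟦ j ℕ.≡ᵇ f i ⟧ * ⟦ i ℕ.≡ᵇ x ⟧ ≡ + 0
  off {i} i≢x rewrite ≡ᵇ-false i≢x = ℤ.*-zeroʳ ⟦ j ℕ.≡ᵇ f i ⟧
  on : ∀ x → ⟦ j ℕ.≡ᵇ f x ⟧ * ⟦ x ℕ.≡ᵇ x ⟧ ≡ ⟦ j ℕ.≡ᵇ f x ⟧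
  on x rewrite ≡ᵇ-refl x = ℤ.*-identityʳ _

+sum-parts : ∀ g J → + sum (parts g J) ≡ ∑ J (λ j → + g j)
+sum-parts g []      = refl
+sum-parts g (j ∷ J) rewrite parts-∷ g j J with g j
... | zero  = trans (+sum-parts g J) (sym (ℤ.+-identityˡ _))
... | suc c = +-congˡ (+ suc c) (+sum-parts g J)

parts-positive : ∀ g J → All (1 ℕ.≤_) (parts g J)
parts-positive g []      = []
parts-positive g (j ∷ J) rewrite parts-∷ g j J with g j
... | zero  = parts-positive g J
... | suc c = ℕ.s≤s ℕ.z≤n ∷ parts-positive g J

count-zeros : ∀ (xs : List ℕ) → count 0 (map (λ _ → 0) xs) ≡ length xs
count-zeros []       = refl
count-zeros (x ∷ xs) = cong suc (count-zeros xs)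

-- Its `typeC` is `typeΠ n ls` by definition, so a chain of `Step`s between unsorted sizes gives a
-- relation between the types.
blockSizes : ℕ → List ℕ → PIP
blockSizes n ls = parts (λ j → count j ls) (oneTo n) , count 0 ls

blockSizes-IsComp : ∀ n ls → All (_∈ zeroTo n) ls → IsComp (length ls) (blockSizes n ls)
blockSizes-IsComp n ls ls⊆ = parts-positive _ (oneTo n) , ℤ.+-injective total
  where
  open ≡-Reasoning
  c : ℕ → ℕ
  c j = count j ls
  total : + (sum (parts c (oneTo n)) ℕ.+ c 0) ≡ + length ls
  total = begin
    + sum (parts c (oneTo n)) + + c 0
      ≡⟨ cong (_+ + c 0) (+sum-parts c (oneTo n)) ⟩
    ∑ (oneTo n) (λ j → + c j) + + c 0
      ≡⟨ ℤ.+-comm (∑ (oneTo n) (λ j → + c j)) (+ c 0) ⟩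
    ∑ (0 ∷ oneTo n) (λ j → + c j)
      ≡⟨ cong (λ xs → ∑ xs (λ j → + c j)) (sym (zeroTo≡0∷oneTo n)) ⟩
    ∑ (zeroTo n) (λ j → + c j)
      ≡⟨ ∑-ext (zeroTo n) (λ j → sym (ℤ.*-identityˡ (+ c j))) ⟩
    ∑ (zeroTo n) (λ j → + 1 * + c j)
      -- Under the constant relabelling every element lies in the zero block, so the fibre formula
      -- adds up all block sizes.
      ≡⟨ sym (count-map n (λ _ → 0) 0 ls ls⊆) ⟩
    + count 0 (map (λ _ → 0) ls)
      ≡⟨ cong +_ (count-zeros ls) ⟩
    + length ls ∎

bfilter-map : ∀ {A B : Set} (p : B → Bool) (h : A → B) xs → bfilter p (map h xs) ≡ map h (bfilter (p ∘ h) xs)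
bfilter-map p h []       = refl
bfilter-map p h (x ∷ xs) with p (h x)
... | true  = cong (h x ∷_) (bfilter-map p h xs)
... | false = bfilter-map p h xs

count≢0⇒∈ : ∀ j ls → count j ls ≢ 0 → j ∈ ls
count≢0⇒∈ j []       c≢0 = contradiction refl c≢0
count≢0⇒∈ j (x ∷ ls) c≢0 with j ℕ.≡ᵇ x in eq
... | true  = here (≡ᵇ-sound j x eq)
... | false = there (count≢0⇒∈ j ls c≢0)

+labelSum : ∀ (f c : ℕ → ℕ) j K →
            + labelSum j (map (λ i → f i , c i) (bfilter (λ i → not (c i ==ℕ 0)) K))
            ≡ ∑ K (λ i → ⟦ j ℕ.≡ᵇ f i ⟧ * + c i)
+labelSum f c j []      = refl
+labelSum f c j (i ∷ K) with c i in eq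
... | zero = trans (+labelSum f c j K) (sym (trans (cong (_+ _) (ℤ.*-zeroʳ ⟦ j ℕ.≡ᵇ f i ⟧)) (ℤ.+-identityˡ _)))
... | suc d rewrite eq with j ℕ.≡ᵇ f i
...   | true  = cong₂ _+_ (sym (ℤ.*-identityˡ (+ suc d))) (+labelSum f c j K)
...   | false = trans (+labelSum f c j K) (sym (ℤ.+-identityˡ _))

blockSizes-Steps : ∀ n π y → All (_∈ zeroTo n) π → All (_∈ zeroTo n) y → Coarsens π y →
                   Star Step (blockSizes n π) (blockSizes n y)
blockSizes-Steps n π _ π⊆ y⊆ (f , f0 , refl) =
  subst₂ (λ xs z → Star Step (xs , count 0 π) z) (trans (sym (map-∘ J)) (sym (bfilter-map _ c (oneTo n)))) target
    (Steps-merge n ps (count 0 π) (All.map⁺ (All.tabulate label≤n)) (All.map⁺ (All.tabulate size≥1)))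
  where
  open ≡-Reasoning
  c : ℕ → ℕ
  c i = count i π
  J : List ℕ
  -- Only labels that occur in `π`: elsewhere the relabelling is unconstrained and `f i` may exceed
  -- `n`.
  J = bfilter (λ i → not (c i ==ℕ 0)) (oneTo n)
  ps : List (ℕ × ℕ)
  ps = map (λ i → f i , c i) J
  nonzero : ∀ {i} → i ∈ J → c i ≢ 0
  nonzero {i} i∈ c≡0 with ∈-bfilter⁻ (λ i → not (c i ==ℕ 0)) (oneTo n) i∈
  ... | _ , eq rewrite c≡0 with () ← eq
  label≤n : ∀ {i} → i ∈ J → f i ℕ.≤ n
  label≤n {i} i∈ = ℕ.≤-pred (∈-upTo⁻ (All.lookup y⊆ (∈-map⁺ f (count≢0⇒∈ i π (nonzero i∈)))))
  size≥1 : ∀ {i} → i ∈ J → 1 ℕ.≤ c i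
  size≥1 i∈ = ℕ.n≢0⇒n>0 (nonzero i∈)
  count-y : ∀ j → + count j (map f π) ≡ ⟦ j ℕ.≡ᵇ 0 ⟧ * + c 0 + + labelSum j ps
  count-y j = begin
    + count j (map f π)
      ≡⟨ count-map n f j π π⊆ ⟩
    ∑ (zeroTo n) (λ i → ⟦ j ℕ.≡ᵇ f i ⟧ * + c i)
      ≡⟨ cong (λ xs → ∑ xs (λ i → ⟦ j ℕ.≡ᵇ f i ⟧ * + c i)) (zeroTo≡0∷oneTo n) ⟩
    ⟦ j ℕ.≡ᵇ f 0 ⟧ * + c 0 + ∑ (oneTo n) (λ i → ⟦ j ℕ.≡ᵇ f i ⟧ * + c i)
      ≡⟨ cong₂ (λ z s → ⟦ j ℕ.≡ᵇ z ⟧ * + c 0 + s) f0 (sym (+labelSum f c j (oneTo n))) ⟩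
    ⟦ j ℕ.≡ᵇ 0 ⟧ * + c 0 + + labelSum j ps ∎
  positive-label : ∀ {j} → j ∈ oneTo n → labelSum j ps ≡ count j (map f π)
  positive-label {zero}  j∈ with () ← proj₁ (∈-oneTo⁻ j∈)
  positive-label {suc j} j∈ = sym (ℤ.+-injective (trans (count-y (suc j)) (ℤ.+-identityˡ _)))
  zero-label : labelSum 0 ps ℕ.+ c 0 ≡ count 0 (map f π)
  zero-label = trans (ℕ.+-comm (labelSum 0 ps) (c 0))
    (sym (ℤ.+-injective (trans (count-y 0) (cong (_+ + labelSum 0 ps) (ℤ.*-identityˡ (+ c 0))))))
  target : (parts (λ j → labelSum j ps) (oneTo n) , labelSum 0 ps ℕ.+ c 0) ≡ blockSizes n (map f π)
  target = cong₂ _,_ (parts-cong (oneTo n) positive-label) zero-label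

zeros-valid : ∀ k → validRGS 0 (replicate k 0) ≡ true
zeros-valid zero    = refl
zeros-valid (suc k) = zeros-valid k

all-<1 : ∀ π → all (ℕ._<ᵇ 1) π ≡ true → π ≡ replicate (length π) 0
all-<1 []         eq = refl
all-<1 (zero ∷ π) eq = cong (0 ∷_) (all-<1 π eq)

all-<1-zeros : ∀ k → all (ℕ._<ᵇ 1) (replicate k 0) ≡ true
all-<1-zeros zero    = refl
all-<1-zeros (suc k) = all-<1-zeros k

module _ (n : ℕ) where

  ∈-PSP⁻ : ∀ {π} → π ∈ pointedSetPartitions n → validRGS 0 π ≡ true × length π ≡ n × All (_∈ zeroTo n) π
  ∈-PSP⁻ π∈ with ∈-bfilter⁻ (validRGS 0) (words n (zeroTo n)) π∈
  ... | π∈′ , v = v , ∈-words⁻ n π∈′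

  PSP-Unique : Unique (pointedSetPartitions n)
  PSP-Unique = bfilter-Unique _ (words-Unique n (Unique.upTo⁺ (suc n)))

  1̂∈PSP : replicate n 0 ∈ pointedSetPartitions n
  1̂∈PSP = ∈-bfilter⁺ _ (subst (λ k → replicate n 0 ∈ words k (zeroTo n)) (length-replicate n)
             (∈-words⁺ (All.replicate⁺ n (here refl)))) (zeros-valid n)

  refines⇒≤I : ∀ {π y} → π ∈ pointedSetPartitions n → y ∈ pointedSetPartitions n →
               refines π y ≡ true → typeΠ n π ≤I[ n ] typeΠ n y
  refines⇒≤I {π} {y} π∈ y∈ r with ∈-PSP⁻ π∈ | ∈-PSP⁻ y∈
  ... | _ , lenπ , π⊆ | _ , leny , y⊆ =
    Steps⇒≤I (subst (λ k → IsComp k (blockSizes n π)) lenπ (blockSizes-IsComp n π π⊆))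
      (blockSizes-Steps n π y π⊆ y⊆ (refines⇒Coarsens π y (trans lenπ (sym leny)) r))

  ≤I-top : ∀ lam m → InI n (lam , m) → (lam , m) ≤I[ n ] ([] , n)
  ≤I-top []        m (_ , _ , refl) = ε
  ≤I-top (s ∷ lam) m i@(sorted , 1≤s ∷ pos , eq) =
    (i , i′ , inj₂ (s , ↭-refl , refl)) ◅ ≤I-top lam (s ℕ.+ m) i′
    where
    i′ : InI n (lam , s ℕ.+ m)
    i′ = Linked.tail sorted , pos ,
         trans (sym (ℕ.+-assoc (sum lam) s m)) (trans (cong (ℕ._+ m) (ℕ.+-comm (sum lam) s)) eq)

  typeΠ-top : typeΠ n (replicate n 0) ≡ ([] , n)
  typeΠ-top = cong₂ _,_ (cong sort (parts-zero (oneTo n) (λ j∈ → none j∈ n))) (all-zero n)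
    where
    none : ∀ {j} → j ∈ oneTo n → ∀ k → count j (replicate k 0) ≡ 0
    none         j∈ zero    = refl
    none {zero}  j∈ (suc k) with () ← proj₁ (∈-oneTo⁻ j∈)
    none {suc j} j∈ (suc k) = none j∈ k
    all-zero : ∀ k → count 0 (replicate k 0) ≡ k
    all-zero zero    = refl
    all-zero (suc k) = cong suc (all-zero k)

-- The Möbius number of the filtered pointed set partitions

ΠF : ℕ → (PIP → Bool) → List (List ℕ)
ΠF n F = bfilter (λ π → F (typeΠ n π)) (pointedSetPartitions n)

module _ (n : ℕ) (F : PIP → Bool) where

  ∈-ΠF⁻ : ∀ {π} → π ∈ ΠF n F → π ∈ pointedSetPartitions n × F (typeΠ n π) ≡ true
  ∈-ΠF⁻ = ∈-bfilter⁻ (λ π → F (typeΠ n π)) (pointedSetPartitions n)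

  ΠF-Coarsens : ∀ {a b} → a ∈ ΠF n F → b ∈ ΠF n F → refines a b ≡ true → Coarsens a b
  ΠF-Coarsens {a} {b} a∈ b∈ = refines⇒Coarsens a b
    (trans (proj₁ (proj₂ (∈-PSP⁻ n (proj₁ (∈-ΠF⁻ a∈))))) (sym (proj₁ (proj₂ (∈-PSP⁻ n (proj₁ (∈-ΠF⁻ b∈)))))))

  ΠF-antisym : ∀ {a b} → a ∈ ΠF n F → b ∈ ΠF n F → refines a b ≡ true → refines b a ≡ true → a ≡ b
  ΠF-antisym {a} {b} a∈ b∈ p q with ΠF-Coarsens a∈ b∈ p | ΠF-Coarsens b∈ a∈ q
  ... | f , f0 , b≡ | g , g0 , a≡ =
    Coarsens-antisym 0 f g (λ { zero _ → f0 }) (λ { zero _ → g0 }) a b b≡ a≡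
      (proj₁ (∈-PSP⁻ n (proj₁ (∈-ΠF⁻ a∈)))) (proj₁ (∈-PSP⁻ n (proj₁ (∈-ΠF⁻ b∈))))

  ΠF-isFinPoset : IsFinPoset (ΠF∪0̂ n F)
  ΠF-isFinPoset = record
    { unique    = bot∷-Unique (bfilter-Unique _ (PSP-Unique n))
    ; ==-sound  = λ { nothing nothing _ → refl ; (just x) (just y) eq → cong just (==L-sound x y eq) }
    ; ==-refl   = λ { nothing → refl ; (just x) → ==L-refl x }
    ; ≼-refl    = λ { {nothing} _ → refl ; {just x} x∈ → Coarsens⇒refines x x (Coarsens-refl x) }
    ; ≼-trans   = λ { {nothing} _ _ _ _ _ → refl
                    ; {just x} {just y} {just z} x∈ y∈ z∈ p q →
                        Coarsens⇒refines x z (Coarsens-trans (ΠF-Coarsens (∈-just⁻ x∈) (∈-just⁻ y∈) p)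
                                                             (ΠF-Coarsens (∈-just⁻ y∈) (∈-just⁻ z∈) q)) }
    ; ≼-antisym = λ { {nothing} {nothing} _ _ _ _ → refl
                    ; {just x} {just y} x∈ y∈ p q → cong just (ΠF-antisym (∈-just⁻ x∈) (∈-just⁻ y∈) p q) }
    }

  ∑-coarsenings-ΠF : IsFilter n F → ∀ {π} → π ∈ ΠF n F →
    ∑ (ΠF n F) (λ y → ⟦ refines π y ⟧ * signedFactorial (finalMax 0 y)) ≡ ⟦ all (ℕ._<ᵇ 1) π ⟧
  ∑-coarsenings-ΠF isF {π} π∈ with ∈-ΠF⁻ π∈
  ... | π∈′ , Fπ with ∈-PSP⁻ n π∈′
  ...   | v , len , _ = begin
    ∑ (ΠF n F) (λ y → ⟦ refines π y ⟧ * w y)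
      ≡⟨ ∑-bfilter (λ y → F (typeΠ n y)) PSP (λ y → ⟦ refines π y ⟧ * w y) ⟩
    ∑ PSP (λ y → ⟦ F (typeΠ n y) ⟧ * (⟦ refines π y ⟧ * w y))
      ≡⟨ ∑-cong PSP drop-F ⟩
    ∑ PSP (λ y → ⟦ refines π y ⟧ * w y)
      ≡⟨ ∑-bfilter (validRGS 0) (words n (zeroTo n)) (λ y → ⟦ refines π y ⟧ * w y) ⟩
    ∑ (words n (zeroTo n)) (λ y → ⟦ validRGS 0 y ⟧ * (⟦ refines π y ⟧ * w y))
      ≡⟨ ∑-cong (words n (zeroTo n)) (λ {y} y∈ → cong (λ p → ⟦ validRGS 0 y ⟧ * (⟦ p ⟧ * w y))
           (refines≡factors π y v (trans len (sym (proj₁ (∈-words⁻ n y∈)))))) ⟩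
    ∑ (words n (zeroTo n)) (λ y → ⟦ validRGS 0 y ⟧ * (⟦ factors [ 0 ] π y ⟧ * w y))
      ≡⟨ cong (λ k → ∑ (words k (zeroTo n)) (λ y → ⟦ validRGS 0 y ⟧ * (⟦ factors [ 0 ] π y ⟧ * w y))) (sym len) ⟩
    ∑ (words (length π) (zeroTo n)) (λ y → ⟦ validRGS 0 y ⟧ * (⟦ factors [ 0 ] π y ⟧ * w y))
      ≡⟨ ∑-coarsenings n π [ 0 ] 0 refl v (ℕ.z≤n ∷ []) (ℕ.≤-reflexive (trans (ℕ.+-identityʳ _) len)) ⟩
    ⟦ all (ℕ._<ᵇ 1) π ⟧ * + 1
      ≡⟨ ℤ.*-identityʳ _ ⟩
    ⟦ all (ℕ._<ᵇ 1) π ⟧ ∎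
    where
    open ≡-Reasoning
    PSP = pointedSetPartitions n
    w : List ℕ → ℤ
    w y = signedFactorial (finalMax 0 y)
    -- Above `π` the filter condition holds automatically; elsewhere both sides vanish.
    drop-F : ∀ {y} → y ∈ PSP → ⟦ F (typeΠ n y) ⟧ * (⟦ refines π y ⟧ * w y) ≡ ⟦ refines π y ⟧ * w y
    drop-F {y} y∈ with refines π y in r
    ... | false = ℤ.*-zeroʳ ⟦ F (typeΠ n y) ⟧
    ... | true rewrite filter-up {F = F} isF (refines⇒≤I n π∈′ y∈ r) Fπ = ℤ.*-identityˡ (+ 1 * w y)

  -- With V the indicator of 1̂, the sum of V(π) μ(0̂,π) has one nonzero term at most. Nonemptiness
  -- ensures that this term is present: the type of 1̂ lies above every type, so it belongs to any
  -- nonempty filter.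
  möbius-ΠF : IsFilter n F → NonemptyIn n F →
    möbius (ΠF∪0̂ n F) nothing (top̂Π n) ≡ - ∑ (ΠF n F) (λ y → signedFactorial (finalMax 0 y))
  möbius-ΠF isF ((lam , m) , inI , Fx) = begin
    μ (replicate n 0)
      ≡⟨ sym (trans (cong (λ p → ⟦ p ⟧ * μ (replicate n 0)) (all-<1-zeros n)) (ℤ.*-identityˡ (μ (replicate n 0)))) ⟩
    ⟦ all (ℕ._<ᵇ 1) (replicate n 0) ⟧ * μ (replicate n 0)
      ≡⟨ sym (∑-single (λ π → ⟦ all (ℕ._<ᵇ 1) π ⟧ * μ π) (bfilter-Unique _ (PSP-Unique n))
               (∈-bfilter⁺ _ (1̂∈PSP n) F-top) off) ⟩
    ∑ (ΠF n F) (λ π → ⟦ all (ℕ._<ᵇ 1) π ⟧ * μ π)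
      ≡⟨ ∑-möbius-transform (ΠF n F) _ _ ΠF-isFinPoset (λ _ → refl) (λ y → signedFactorial (finalMax 0 y))
           (λ π → ⟦ all (ℕ._<ᵇ 1) π ⟧) (∑-coarsenings-ΠF isF) ⟩
    - ∑ (ΠF n F) (λ y → signedFactorial (finalMax 0 y)) ∎
    where
    open ≡-Reasoning
    μ : List ℕ → ℤ
    μ π = möbius (ΠF∪0̂ n F) nothing (just π)
    F-top : F (typeΠ n (replicate n 0)) ≡ true
    F-top = subst (λ x → F x ≡ true) (sym (typeΠ-top n))
      (filter-up {F = F} isF (≤I-top n lam m inI) (Fx⇒≡ Fx))
      where
      Fx⇒≡ : ∀ {p} → T p → p ≡ true
      Fx⇒≡ {true} _ = refl
    off : ∀ {π} → π ∈ ΠF n F → π ≢ replicate n 0 → ⟦ all (ℕ._<ᵇ 1) π ⟧ * μ π ≡ + 0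
    off {π} π∈ π≢ with all (ℕ._<ᵇ 1) π in eq
    ... | false = refl
    ... | true  = contradiction (trans (all-<1 π eq)
                    (cong (λ k → replicate k 0) (proj₁ (proj₂ (∈-PSP⁻ n (proj₁ (∈-ΠF⁻ π∈))))))) π≢

-- Descents

within : List ℕ → List ℕ → Bool
within D P = all (λ x → any (x ==ℕ_) P) D

any-false : ∀ {A : Set} (p : A → Bool) xs → (∀ {x} → x ∈ xs → p x ≡ false) → any p xs ≡ false
any-false p []       off = refl
any-false p (x ∷ xs) off rewrite off (here refl) = any-false p xs (off ∘ there)

partialSums-≥ : ∀ p ds {x} → x ∈ partialSums p ds → p ℕ.≤ x
partialSums-≥ p (d ∷ ds) (here refl) = ℕ.m≤m+n p d
partialSums-≥ p (d ∷ ds) (there x∈)  = ℕ.≤-trans (ℕ.m≤m+n p d) (partialSums-≥ (p ℕ.+ d) ds x∈)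

all-cong : ∀ {A : Set} {p q : A → Bool} xs → (∀ {x} → x ∈ xs → p x ≡ q x) → all p xs ≡ all q xs
all-cong []       p≡q = refl
all-cong (x ∷ xs) p≡q = cong₂ _∧_ (p≡q (here refl)) (all-cong xs (p≡q ∘ there))

within-drop : ∀ D p P → All (p ℕ.<_) D → within D (p ∷ P) ≡ within D P
within-drop D p P p<D = all-cong D (λ {x} x∈ → cong (λ t → t ∨ any (x ==ℕ_) P) (≡ᵇ-false (ℕ.>⇒≢ (All.lookup p<D x∈))))

within-head : ∀ {x D P} → (∀ {y} → y ∈ P → x ℕ.< y) → within (x ∷ D) P ≡ false
within-head {x} {D} {P} x<P rewrite any-false (x ==ℕ_) P (λ y∈ → ≡ᵇ-false (ℕ.<⇒≢ (x<P y∈))) = refl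

==L-false : ∀ {as bs} → as ≢ bs → (as ==L bs) ≡ false
==L-false {as} {bs} as≢bs = ≢true⇒≡false (as≢bs ∘ ==L-sound as bs)

==L-∷ : ∀ x as bs → ((x ∷ as) ==L (x ∷ bs)) ≡ (as ==L bs)
==L-∷ x as bs = Bool-ext
  (λ eq → ≡⇒== (∷-injectiveʳ (==L-sound (x ∷ as) (x ∷ bs) eq)))
  (λ eq → ≡⇒== (cong (x ∷_) (==L-sound as bs eq)))
  where
  ≡⇒== : ∀ {cs ds} → cs ≡ ds → (cs ==L ds) ≡ true
  ≡⇒== {cs} refl = ==L-refl cs

sgn : ℕ → ℤ
sgn k = (- (+ 1)) ^ k

-- The sublists P of the partial sums of cs correspond to the elements above cs, so this is
-- Σ_{D ⊆ P ⊆ S} (-1)^|P| = (-1)^|S| [D = S].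
∑-ups-within : ∀ o a q cs m D → o ℕ.+ a ≡ q → All (1 ℕ.≤_) cs → AllPairs ℕ._<_ D →
  ∑ (ups a cs m) (λ d → sgn (ρ d) * ⟦ within D (partialSums o (proj₁ d)) ⟧)
    ≡ sgn (length cs) * ⟦ D ==L partialSums q cs ⟧
∑-ups-within o a q [] m []      eq pos D↗ = refl
∑-ups-within o a q [] m (x ∷ D) eq pos D↗ = refl
∑-ups-within o a q (c ∷ cs) m D eq (1≤c ∷ pos) D↗ = begin
  ∑ (map (consC (a ℕ.+ c)) (ups 0 cs m) ++ ups (a ℕ.+ c) cs m) f
    ≡⟨ ∑-++ (map (consC (a ℕ.+ c)) (ups 0 cs m)) (ups (a ℕ.+ c) cs m) f ⟩
  ∑ (map (consC (a ℕ.+ c)) (ups 0 cs m)) f + ∑ (ups (a ℕ.+ c) cs m) f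
    ≡⟨ cong₂ _+_ (trans (∑-map (consC (a ℕ.+ c)) (ups 0 cs m) f)
                   (trans (∑-ext (ups 0 cs m) (λ d → ℤ.*-assoc (- (+ 1)) (sgn (ρ d)) ⟦ within D (p ∷ partialSums p (proj₁ d)) ⟧))
                          (∑-*ˡ (ups 0 cs m) (- (+ 1)) (g D))))
                 (∑-ups-within o (a ℕ.+ c) p cs m D refl pos D↗) ⟩
  - (+ 1) * ∑ (ups 0 cs m) (g D) + sgn (length cs) * ⟦ D ==L partialSums p cs ⟧
    ≡⟨ combine D D↗ ⟩
  sgn (length (c ∷ cs)) * ⟦ D ==L (p ∷ partialSums p cs) ⟧
    ≡⟨ cong (λ k → sgn (length (c ∷ cs)) * ⟦ D ==L (k ∷ partialSums k cs) ⟧)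
            (trans (sym (ℕ.+-assoc o a c)) (cong (ℕ._+ c) eq)) ⟩
  sgn (length (c ∷ cs)) * ⟦ D ==L partialSums q (c ∷ cs) ⟧ ∎
  where
  open ≡-Reasoning
  -- `o` is the last cut made and `a` the amount carried since, so `p` is the position of the next
  -- possible cut.
  p = o ℕ.+ (a ℕ.+ c)
  f : PC → ℤ
  f d = sgn (ρ d) * ⟦ within D (partialSums o (proj₁ d)) ⟧
  g : List ℕ → PC → ℤ
  g E d = sgn (ρ d) * ⟦ within E (p ∷ partialSums p (proj₁ d)) ⟧
  s = sgn (length cs)
  drop : ∀ E → All (p ℕ.<_) E → AllPairs ℕ._<_ E → ∑ (ups 0 cs m) (g E) ≡ s * ⟦ E ==L partialSums p cs ⟧
  drop E p<E E↗ = trans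
    (∑-ext (ups 0 cs m) (λ d → cong (λ t → sgn (ρ d) * ⟦ t ⟧) (within-drop E p (partialSums p (proj₁ d)) p<E)))
    (∑-ups-within p 0 p cs m E (ℕ.+-identityʳ p) pos E↗)
  cancel : ∀ x → - (+ 1) * x + x ≡ + 0
  cancel = solve-∀
  absent : ∀ E → All (p ℕ.<_) E → AllPairs ℕ._<_ E →
    - (+ 1) * ∑ (ups 0 cs m) (g E) + s * ⟦ E ==L partialSums p cs ⟧
      ≡ sgn (suc (length cs)) * ⟦ E ==L (p ∷ partialSums p cs) ⟧
  absent E p<E E↗ = trans (cong (λ z → - (+ 1) * z + s * ⟦ E ==L partialSums p cs ⟧) (drop E p<E E↗))
    (trans (cancel (s * ⟦ E ==L partialSums p cs ⟧))
      (sym (trans (cong (λ t → sgn (suc (length cs)) * ⟦ t ⟧) (==L-false {E} (E≢ p<E))) (ℤ.*-zeroʳ (sgn (suc (length cs)))))))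
    where
    E≢ : ∀ {E P} → All (p ℕ.<_) E → E ≢ p ∷ P
    E≢ (p<p ∷ _) refl = ℕ.<-irrefl refl p<p
  head-> : ∀ cs → All (1 ℕ.≤_) cs → ∀ {x E} → x ℕ.≤ p → x ∷ E ≢ partialSums p cs
  head-> (c ∷ cs) (1≤c ∷ _) x≤p refl = ℕ.<⇒≱ (ℕ.m<m+n p 1≤c) x≤p
  -- The first element of `E` is compared with `p`. If `p` is below all of `E`, keeping or dropping
  -- the cut at `p` gives opposite terms. If the first element is below `p`, no set of cuts contains
  -- it and everything vanishes. If it equals `p`, only the terms with the cut survive.
  combine : ∀ E → AllPairs ℕ._<_ E →
    - (+ 1) * ∑ (ups 0 cs m) (g E) + s * ⟦ E ==L partialSums p cs ⟧
      ≡ sgn (suc (length cs)) * ⟦ E ==L (p ∷ partialSums p cs) ⟧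
  combine []      []          = absent [] [] []
  combine (x ∷ E) (x<E ∷ E↗) with ℕ.<-cmp x p
  ... | tri> _ _ p<x = absent (x ∷ E) (p<x ∷ All.map (ℕ.<-trans p<x) x<E) (x<E ∷ E↗)
  ... | tri< x<p _ _ = begin
    - (+ 1) * ∑ (ups 0 cs m) (g (x ∷ E)) + s * ⟦ (x ∷ E) ==L partialSums p cs ⟧
      ≡⟨ cong₂ (λ u t → - (+ 1) * u + s * ⟦ t ⟧)
           (∑-zero (ups 0 cs m) (λ {d} _ → trans (cong (λ t → sgn (ρ d) * ⟦ t ⟧) (within-head {x} {E} (below d))) (ℤ.*-zeroʳ (sgn (ρ d)))))
           (==L-false (head-> cs pos (ℕ.<⇒≤ x<p))) ⟩
    - (+ 1) * + 0 + s * + 0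
      ≡⟨ zeros s ⟩
    sgn (suc (length cs)) * + 0
      ≡⟨ cong (λ t → sgn (suc (length cs)) * ⟦ t ⟧) (sym (==L-false {x ∷ E} {p ∷ partialSums p cs} (λ { refl → ℕ.<-irrefl refl x<p }))) ⟩
    sgn (suc (length cs)) * ⟦ (x ∷ E) ==L (p ∷ partialSums p cs) ⟧ ∎
    where
    zeros : ∀ s → - (+ 1) * + 0 + s * + 0 ≡ - (+ 1) * s * + 0
    zeros = solve-∀
    below : ∀ d {y} → y ∈ p ∷ partialSums p (proj₁ d) → x ℕ.< y
    below d (here refl) = x<p
    below d (there y∈)  = ℕ.<-≤-trans x<p (partialSums-≥ p (proj₁ d) y∈)
  ... | tri≈ _ refl _ = begin
    - (+ 1) * ∑ (ups 0 cs m) (g (p ∷ E)) + s * ⟦ (p ∷ E) ==L partialSums p cs ⟧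
      ≡⟨ cong₂ (λ u t → - (+ 1) * u + s * ⟦ t ⟧)
           (trans (∑-ext (ups 0 cs m) (λ d → cong (λ t → sgn (ρ d) * ⟦ (t ∨ any (p ==ℕ_) (partialSums p (proj₁ d))) ∧ within E (p ∷ partialSums p (proj₁ d)) ⟧) (≡ᵇ-refl p)))
                  (drop E x<E E↗))
           (==L-false (head-> cs pos ℕ.≤-refl)) ⟩
    - (+ 1) * (s * ⟦ E ==L partialSums p cs ⟧) + s * + 0
      ≡⟨ regroup s ⟦ E ==L partialSums p cs ⟧ ⟩
    sgn (suc (length cs)) * ⟦ E ==L partialSums p cs ⟧
      ≡⟨ cong (λ t → sgn (suc (length cs)) * ⟦ t ⟧) (sym (==L-∷ p E (partialSums p cs))) ⟩
    sgn (suc (length cs)) * ⟦ (p ∷ E) ==L (p ∷ partialSums p cs) ⟧ ∎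
    where
    regroup : ∀ s t → - (+ 1) * (s * t) + s * + 0 ≡ - (+ 1) * s * t
    regroup = solve-∀

descents-≥ : ∀ i a τ → All (i ℕ.≤_) (descents i (a ∷ τ))
descents-≥ i a []      = []
descents-≥ i a (b ∷ τ) with b ℕ.<ᵇ a
... | true  = ℕ.≤-refl ∷ All.map ℕ.<⇒≤ (descents-≥ (suc i) b τ)
... | false = All.map ℕ.<⇒≤ (descents-≥ (suc i) b τ)

descents-∷-↗ : ∀ i a τ → AllPairs ℕ._<_ (descents i (a ∷ τ))
descents-∷-↗ i a []      = []
descents-∷-↗ i a (b ∷ τ) with b ℕ.<ᵇ a
... | true  = descents-≥ (suc i) b τ ∷ descents-∷-↗ (suc i) b τ
... | false = descents-∷-↗ (suc i) b τ

descents-↗ : ∀ i τ → AllPairs ℕ._<_ (descents i τ)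
descents-↗ i []      = []
descents-↗ i (a ∷ τ) = descents-∷-↗ i a τ

-- Multinomial coefficients as numbers of permutations with restricted descents

total : List ℕ → ℕ → ℕ
total []       m = m
total (d ∷ ds) m = d ℕ.+ total ds m

total≡sum : ∀ ds m → total ds m ≡ sum ds ℕ.+ m
total≡sum []       m = refl
total≡sum (d ∷ ds) m = trans (cong (d ℕ.+_) (total≡sum ds m)) (sym (ℕ.+-assoc d (sum ds) m))

-- The multinomial coefficient as a product of binomials: the contents of the first run are chosen
-- from all letters, then the rest is filled. The pointed run takes what is left and contributes the
-- factor 1.
multinomial : List ℕ → ℕ → ℤ
multinomial []       m = + 1
multinomial (d ∷ ds) m = + (total (d ∷ ds) m ℕ.C d) * multinomial ds m

-- A subset of size r + 1 is chosen by its least element `b` and r further elements above it.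
hockey-stick : ∀ (q : ℕ → Bool) r L → AllPairs ℕ._<_ L →
  ∑ L (λ b → ⟦ q b ⟧ * + (length (bfilter (λ x → q x ∧ (b ℕ.<ᵇ x)) L) ℕ.C r)) ≡ + (length (bfilter q L) ℕ.C suc r)
hockey-stick q r []      []         = refl
hockey-stick q r (b ∷ L) (b<L ∷ L↗) = trans (cong₂ _+_ first rest) pascal
  where
  after : ℕ → List ℕ → ℕ
  after b L = length (bfilter (λ x → q x ∧ (b ℕ.<ᵇ x)) L)
  first : ⟦ q b ⟧ * + (after b (b ∷ L) ℕ.C r) ≡ ⟦ q b ⟧ * + (length (bfilter q L) ℕ.C r)
  first rewrite <ᵇ-false {b} {b} ℕ.≤-refl | ∧-zeroʳ (q b)
        | bfilter-cong {p = λ x → q x ∧ (b ℕ.<ᵇ x)} {q} L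
            (λ {x} x∈ → trans (cong (q x ∧_) (<ᵇ-true (All.lookup b<L x∈))) (∧-identityʳ (q x))) = refl
  rest : ∑ L (λ b′ → ⟦ q b′ ⟧ * + (after b′ (b ∷ L) ℕ.C r)) ≡ + (length (bfilter q L) ℕ.C suc r)
  rest = trans (∑-cong L (λ {b′} b′∈ → cong (λ k → ⟦ q b′ ⟧ * + (k ℕ.C r)) (skip-b b′∈))) (hockey-stick q r L L↗)
    where
    skip-b : ∀ {b′} → b′ ∈ L → after b′ (b ∷ L) ≡ after b′ L
    skip-b {b′} b′∈ rewrite <ᵇ-false {b′} {b} (ℕ.<⇒≤ (All.lookup b<L b′∈)) | ∧-zeroʳ (q b) = refl
  pascal : ⟦ q b ⟧ * + (length (bfilter q L) ℕ.C r) + + (length (bfilter q L) ℕ.C suc r) ≡ + (length (bfilter q (b ∷ L)) ℕ.C suc r)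
  pascal with q b
  ... | false = ℤ.+-identityˡ _
  ... | true  = trans (cong (_+ + (length (bfilter q L) ℕ.C suc r)) (ℤ.*-identityˡ (+ (length (bfilter q L) ℕ.C r))))
                      (cong +_ (ℕ.nCk+nC[k+1]≡[n+1]C[k+1] (length (bfilter q L)) r))

upTo-↗ : ∀ n → AllPairs ℕ._<_ (upTo n)
upTo-↗ n = AllPairs.applyUpTo⁺₁ id n (λ i<j _ → i<j)

remove : ℕ → (ℕ → Bool) → ℕ → Bool
remove b av x = av x ∧ not (b ==ℕ x)

length-remove : ∀ av {b} L → Unique L → b ∈ L → av b ≡ true →
                length (bfilter av L) ≡ suc (length (bfilter (remove b av) L))
length-remove av {b} (.b ∷ L) (b∉ ∷ u) (here refl) avb rewrite avb | ≡ᵇ-refl b =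
  cong (suc ∘ length) (bfilter-cong L (λ {x} x∈ →
    sym (trans (cong (λ t → av x ∧ not t) (≡ᵇ-false (All.lookup b∉ x∈))) (∧-identityʳ (av x)))))
length-remove av {b} (x ∷ L) (x∉ ∷ u) (there b∈) avb
  rewrite ≡ᵇ-false {b} {x} (λ b≡x → All.lookup x∉ b∈ (sym b≡x)) | ∧-identityʳ (av x) with av x
... | true  = cong suc (length-remove av L u b∈ avb)
... | false = length-remove av L u b∈ avb

all-remove : ∀ b av τ → all (remove b av) τ ≡ all av τ ∧ not (any (b ==ℕ_) τ)
all-remove b av []      = refl
all-remove b av (x ∷ τ) rewrite all-remove b av τ with av x | b ==ℕ x | all av τ
... | true  | true  | true  = refl
... | true  | true  | false = refl
... | true  | false | _     = refl
... | false | _     | _     = refl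

module Arrangements (n : ℕ) where

  U : List ℕ
  U = upTo n

  size : (ℕ → Bool) → ℕ
  size av = length (bfilter av U)

  -- The letters still available are given by a predicate and not by a list, so that the increasing
  -- alphabet `U` stays fixed while letters are used up.
  arrangements : (ℕ → Bool) → ℕ → (List ℕ → ℤ) → ℤ
  arrangements av r φ = ∑ (words r U) (λ τ → ⟦ distinct τ ⟧ * (⟦ all av τ ⟧ * φ τ))

  arrangements-cong : ∀ av r {φ ψ} → φ ≗ ψ → arrangements av r φ ≡ arrangements av r ψ
  arrangements-cong av r φ≗ψ = ∑-ext (words r U) (λ τ → cong (λ z → ⟦ distinct τ ⟧ * (⟦ all av τ ⟧ * z)) (φ≗ψ τ))

  arrangements-*ˡ : ∀ av r c φ → arrangements av r (λ τ → c * φ τ) ≡ c * arrangements av r φ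
  arrangements-*ˡ av r c φ = trans (∑-ext (words r U) (λ τ → lemma ⟦ distinct τ ⟧ ⟦ all av τ ⟧ c (φ τ))) (∑-*ˡ (words r U) c _)
    where
    lemma : ∀ x y c z → x * (y * (c * z)) ≡ c * (x * (y * z))
    lemma = solve-∀

  arrangements-suc : ∀ av r φ →
    arrangements av (suc r) φ ≡ ∑ U (λ b → ⟦ av b ⟧ * arrangements (remove b av) r (λ τ → φ (b ∷ τ)))
  arrangements-suc av r φ = trans (∑-words r U _) (∑-ext U (λ b →
    trans (∑-ext (words r U) (pointwise b)) (∑-*ˡ (words r U) ⟦ av b ⟧ _)))
    where
    open ≡-Reasoning
    reorder : ∀ a d v g x → a * (d * (v * (g * x))) ≡ v * (d * (g * (a * x)))
    reorder = solve-∀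
    pointwise : ∀ b τ → ⟦ distinct (b ∷ τ) ⟧ * (⟦ all av (b ∷ τ) ⟧ * φ (b ∷ τ))
                      ≡ ⟦ av b ⟧ * (⟦ distinct τ ⟧ * (⟦ all (remove b av) τ ⟧ * φ (b ∷ τ)))
    pointwise b τ = begin
      ⟦ new ∧ distinct τ ⟧ * (⟦ av b ∧ all av τ ⟧ * x)
        ≡⟨ trans (⟦∧⟧-* new (distinct τ) _) (cong (λ z → ⟦ new ⟧ * (⟦ distinct τ ⟧ * z)) (⟦∧⟧-* (av b) (all av τ) x)) ⟩
      ⟦ new ⟧ * (⟦ distinct τ ⟧ * (⟦ av b ⟧ * (⟦ all av τ ⟧ * x)))
        ≡⟨ reorder ⟦ new ⟧ ⟦ distinct τ ⟧ ⟦ av b ⟧ ⟦ all av τ ⟧ x ⟩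
      ⟦ av b ⟧ * (⟦ distinct τ ⟧ * (⟦ all av τ ⟧ * (⟦ new ⟧ * x)))
        ≡⟨ cong (λ z → ⟦ av b ⟧ * (⟦ distinct τ ⟧ * z))
             (trans (sym (⟦∧⟧-* (all av τ) new x)) (cong (λ t → ⟦ t ⟧ * x) (sym (all-remove b av τ)))) ⟩
      ⟦ av b ⟧ * (⟦ distinct τ ⟧ * (⟦ all (remove b av) τ ⟧ * x)) ∎
      where
      new = not (any (b ==ℕ_) τ)
      x   = φ (b ∷ τ)

  above : ℕ → (ℕ → Bool) → ℕ → Bool
  above b av x = av x ∧ (b ℕ.<ᵇ x)

  above-remove : ∀ b av → size (above b (remove b av)) ≡ size (above b av)
  above-remove b av = cong length (bfilter-cong U λ {x} _ → same x)
    where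
    same : ∀ x → above b (remove b av) x ≡ above b av x
    same x with b ℕ.<ᵇ x in b<x
    ... | false = trans (∧-zeroʳ (remove b av x)) (sym (∧-zeroʳ (av x)))
    ... | true rewrite ≡ᵇ-false {b} {x} (ℕ.<⇒≢ (<ᵇ-true⁻ b b<x)) = cong (_∧ true) (∧-identityʳ (av x))

  remove-self : ∀ b av → remove b av b ≡ false
  remove-self b av rewrite ≡ᵇ-refl b = ∧-zeroʳ (av b)

  size-remove : ∀ {b av k} → b ∈ U → av b ≡ true → size av ≡ suc k → size (remove b av) ≡ k
  size-remove {b} {av} b∈ avb eq =
    ℕ.suc-injective (trans (sym (length-remove av U (Unique.upTo⁺ n) b∈ avb)) eq)

  arrangements-choose : ∀ av (p : ℕ → Bool) r len φ M →
    (∀ {b x} → b ℕ.< x → p b ≡ true → p x ≡ true) →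
    (∀ {b} → b ∈ U → av b ≡ true → arrangements (remove b av) len (λ τ → φ (b ∷ τ))
                                   ≡ ⟦ p b ⟧ * (+ (size (above b (remove b av)) ℕ.C r) * M)) →
    arrangements av (suc len) φ ≡ + (size (λ x → av x ∧ p x) ℕ.C suc r) * M
  arrangements-choose av p r len φ M p-up step = begin
    arrangements av (suc len) φ
      ≡⟨ arrangements-suc av len φ ⟩
    ∑ U (λ b → ⟦ av b ⟧ * arrangements (remove b av) len (λ τ → φ (b ∷ τ)))
      ≡⟨ ∑-cong U term ⟩
    ∑ U (λ b → ⟦ q b ⟧ * + (length (bfilter (λ x → q x ∧ (b ℕ.<ᵇ x)) U) ℕ.C r) * M)
      ≡⟨ ∑-*ʳ U _ M ⟩
    ∑ U (λ b → ⟦ q b ⟧ * + (length (bfilter (λ x → q x ∧ (b ℕ.<ᵇ x)) U) ℕ.C r)) * M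
      ≡⟨ cong (_* M) (hockey-stick q r U (upTo-↗ n)) ⟩
    + (size q ℕ.C suc r) * M ∎
    where
    open ≡-Reasoning
    q : ℕ → Bool
    q x = av x ∧ p x
    term : ∀ {b} → b ∈ U → ⟦ av b ⟧ * arrangements (remove b av) len (λ τ → φ (b ∷ τ))
         ≡ ⟦ q b ⟧ * + (length (bfilter (λ x → q x ∧ (b ℕ.<ᵇ x)) U) ℕ.C r) * M
    term {b} b∈ with av b in avb
    ... | false = refl
    ... | true rewrite step b∈ avb | above-remove b av with p b in pb
    ...   | false = refl
    ...   | true = trans (ℤ.*-identityˡ _) (trans (ℤ.*-identityˡ _)
              (trans (cong (λ k → + (k ℕ.C r) * M) (cong length (bfilter-cong U (λ {x} _ → same x))))
                     (cong (_* M) (sym (ℤ.*-identityˡ (+ (length (bfilter (λ x → q x ∧ (b ℕ.<ᵇ x)) U) ℕ.C r)))))))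
      where
      same : ∀ x → above b av x ≡ q x ∧ (b ℕ.<ᵇ x)
      same x with b ℕ.<ᵇ x in b<x
      ... | false = trans (∧-zeroʳ (av x)) (sym (∧-zeroʳ (q x)))
      ... | true  = cong (_∧ true) (sym (trans (cong (av x ∧_) (p-up (<ᵇ-true⁻ b b<x) pb)) (∧-identityʳ (av x))))

  fits : ℕ → List ℕ → List ℕ → ℤ
  fits i P τ = ⟦ within (descents i τ) P ⟧

  fits-ascend : ∀ i a b τ P → i ∉ P → fits i P (a ∷ b ∷ τ) ≡ ⟦ not (b ℕ.<ᵇ a) ⟧ * fits (suc i) P (b ∷ τ)
  fits-ascend i a b τ P i∉P with b ℕ.<ᵇ a
  ... | false = sym (ℤ.*-identityˡ _)
  ... | true rewrite any-false (i ==ℕ_) P (λ {x} x∈ → ≡ᵇ-false {i} {x} (λ { refl → i∉P x∈ })) = refl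

  -- At a permitted position the comparison of `a` with the next letter is free, so `a` no longer
  -- matters. Dropping `i` from the permitted set is harmless because the later descents all exceed
  -- `i`.
  fits-cut : ∀ i a τ P → fits i (i ∷ P) (a ∷ τ) ≡ fits (suc i) P τ
  fits-cut i a []      P = refl
  fits-cut i a (b ∷ τ) P with b ℕ.<ᵇ a
  ... | false = cong ⟦_⟧ (within-drop (descents (suc i) (b ∷ τ)) i P (descents-≥ (suc i) b τ))
  ... | true rewrite ≡ᵇ-refl i = cong ⟦_⟧ (within-drop (descents (suc i) (b ∷ τ)) i P (descents-≥ (suc i) b τ))

  not-<-up : ∀ a {b x} → b ℕ.< x → not (b ℕ.<ᵇ a) ≡ true → not (x ℕ.<ᵇ a) ≡ true
  not-<-up a {b} {x} b<x eq with x ℕ.<ᵇ a in x<a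
  ... | false = refl
  ... | true = trans (sym (cong not (<ᵇ-true {b} {a} (ℕ.<-trans b<x (<ᵇ-true⁻ x x<a))))) eq

  size-not-< : ∀ a av → av a ≡ false → size (λ x → av x ∧ not (x ℕ.<ᵇ a)) ≡ size (above a av)
  size-not-< a av ava = cong length (bfilter-cong U λ {x} _ → same x)
    where
    same : ∀ x → av x ∧ not (x ℕ.<ᵇ a) ≡ above a av x
    same x with ℕ.<-cmp a x
    ... | tri< a<x _ _  rewrite <ᵇ-true a<x | <ᵇ-false (ℕ.<⇒≤ a<x) = refl
    ... | tri≈ _ refl _ rewrite ava = refl
    ... | tri> _ _ x<a  rewrite <ᵇ-true x<a | <ᵇ-false (ℕ.<⇒≤ x<a) = refl

  -- Just `len` letters are left, so the binomial is 1 if all of them exceed `a` and 0 otherwise. It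
  -- is written as a binomial to fit `arrangements-choose`.
  count-increasing : ∀ len i a av → av a ≡ false → size av ≡ len →
    arrangements av len (λ τ → fits i [] (a ∷ τ)) ≡ + (size (above a av) ℕ.C len) * + 1
  count-increasing zero      i a av ava eq = refl
  count-increasing (suc len) i a av ava eq = trans
    (arrangements-choose av (λ b → not (b ℕ.<ᵇ a)) len len _ (+ 1) (λ {b} {x} → not-<-up a {b} {x}) step)
    (cong (λ k → + (k ℕ.C suc len) * + 1) (size-not-< a av ava))
    where
    step : ∀ {b} → b ∈ U → av b ≡ true → arrangements (remove b av) len (λ τ → fits i [] (a ∷ b ∷ τ))
           ≡ ⟦ not (b ℕ.<ᵇ a) ⟧ * (+ (size (above b (remove b av)) ℕ.C len) * + 1)
    step {b} b∈ avb = trans (arrangements-cong (remove b av) len (λ τ → fits-ascend i a b τ [] λ ()))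
      (trans (arrangements-*ˡ (remove b av) len ⟦ not (b ℕ.<ᵇ a) ⟧ (λ τ → fits (suc i) [] (b ∷ τ)))
             (cong (⟦ not (b ℕ.<ᵇ a) ⟧ *_)
               (count-increasing len (suc i) b (remove b av) (remove-self b av) (size-remove b∈ avb eq))))

  -- i is the position of the last letter a already placed, and r letters are
  -- still missing from its run.
  count-run : ∀ r ds m i a av → All (1 ℕ.≤_) ds → av a ≡ false → size av ≡ r ℕ.+ total ds m →
    arrangements av (r ℕ.+ total ds m) (λ τ → fits i (partialSums i (r ∷ ds)) (a ∷ τ))
      ≡ + (size (above a av) ℕ.C r) * multinomial ds m

  -- The start of a new run, after `i` letters: the next letter is unrestricted, and `count-run`
  -- continues from it.
  count-fits : ∀ ds m i av → All (1 ℕ.≤_) ds → size av ≡ total ds m →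
    arrangements av (total ds m) (fits (suc i) (partialSums i ds)) ≡ multinomial ds m

  count-run zero ds m i a av pos ava eq = begin
    arrangements av (total ds m) (λ τ → fits i (i ℕ.+ 0 ∷ partialSums (i ℕ.+ 0) ds) (a ∷ τ))
      ≡⟨ cong (λ k → arrangements av (total ds m) (λ τ → fits i (k ∷ partialSums k ds) (a ∷ τ))) (ℕ.+-identityʳ i) ⟩
    arrangements av (total ds m) (λ τ → fits i (i ∷ partialSums i ds) (a ∷ τ))
      ≡⟨ arrangements-cong av (total ds m) (λ τ → fits-cut i a τ (partialSums i ds)) ⟩
    arrangements av (total ds m) (fits (suc i) (partialSums i ds))
      ≡⟨ count-fits ds m i av pos eq ⟩
    multinomial ds m
      ≡⟨ sym (ℤ.*-identityˡ _) ⟩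
    + 1 * multinomial ds m ∎
    where open ≡-Reasoning
  count-run (suc r) ds m i a av pos ava eq = trans
    (arrangements-choose av (λ b → not (b ℕ.<ᵇ a)) r (r ℕ.+ total ds m) _ (multinomial ds m) (λ {b} {x} → not-<-up a {b} {x}) step)
    (cong (λ k → + (k ℕ.C suc r) * multinomial ds m) (size-not-< a av ava))
    where
    i∉ : i ∉ partialSums i (suc r ∷ ds)
    i∉ (here i≡)  = ℕ.<⇒≢ (ℕ.m<m+n i (ℕ.s≤s ℕ.z≤n)) i≡
    i∉ (there i∈) = ℕ.<⇒≱ (ℕ.m<m+n i {suc r} (ℕ.s≤s ℕ.z≤n)) (partialSums-≥ (i ℕ.+ suc r) ds i∈)
    step : ∀ {b} → b ∈ U → av b ≡ true →
           arrangements (remove b av) (r ℕ.+ total ds m) (λ τ → fits i (partialSums i (suc r ∷ ds)) (a ∷ b ∷ τ))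
           ≡ ⟦ not (b ℕ.<ᵇ a) ⟧ * (+ (size (above b (remove b av)) ℕ.C r) * multinomial ds m)
    step {b} b∈ avb = trans
      (arrangements-cong (remove b av) (r ℕ.+ total ds m) (λ τ → trans
        (fits-ascend i a b τ (partialSums i (suc r ∷ ds)) i∉)
        (cong (λ k → ⟦ not (b ℕ.<ᵇ a) ⟧ * fits (suc i) (k ∷ partialSums k ds) (b ∷ τ)) (ℕ.+-suc i r))))
      (trans (arrangements-*ˡ (remove b av) (r ℕ.+ total ds m) ⟦ not (b ℕ.<ᵇ a) ⟧ (λ τ → fits (suc i) (partialSums (suc i) (r ∷ ds)) (b ∷ τ)))
             (cong (⟦ not (b ℕ.<ᵇ a) ⟧ *_)
               (count-run r ds m (suc i) b (remove b av) pos (remove-self b av) (size-remove b∈ avb eq))))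

  count-fits [] zero    i av pos eq = refl
  -- The last run takes all remaining letters, so its binomial coefficient is 1.
  count-fits [] (suc m) i av pos eq = trans
    (arrangements-choose av (λ _ → true) m m _ (+ 1) (λ _ _ → refl)
      (λ {b} b∈ avb → trans (count-increasing m (suc i) b (remove b av) (remove-self b av) (size-remove b∈ avb eq))
                            (sym (ℤ.*-identityˡ _))))
    (trans (ℤ.*-identityʳ _) (cong +_ (trans
      (cong (ℕ._C suc m) (trans (cong length (bfilter-cong U (λ {x} _ → ∧-identityʳ (av x)))) eq)) (ℕ.nCn≡1 (suc m)))))
  count-fits (suc r ∷ ds) m i av (1≤d ∷ pos) eq = trans
    (arrangements-choose av (λ _ → true) r (r ℕ.+ total ds m) _ (multinomial ds m) (λ _ _ → refl) step)
    (cong (λ k → + (k ℕ.C suc r) * multinomial ds m) (trans (cong length (bfilter-cong U (λ {x} _ → ∧-identityʳ (av x)))) eq))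
    where
    step : ∀ {b} → b ∈ U → av b ≡ true →
           arrangements (remove b av) (r ℕ.+ total ds m) (λ τ → fits (suc i) (partialSums i (suc r ∷ ds)) (b ∷ τ))
           ≡ + 1 * (+ (size (above b (remove b av)) ℕ.C r) * multinomial ds m)
    step {b} b∈ avb = trans
      (arrangements-cong (remove b av) (r ℕ.+ total ds m)
        (λ τ → cong (λ k → fits (suc i) (k ∷ partialSums k ds) (b ∷ τ)) (ℕ.+-suc i r)))
      (trans (count-run r ds m (suc i) b (remove b av) pos (remove-self b av) (size-remove b∈ avb eq))
             (sym (ℤ.*-identityˡ _)))

∑-permutations : ∀ n (φ : List ℕ → ℤ) → ∑ (permutations n) φ ≡ Arrangements.arrangements n (λ _ → true) n φ
∑-permutations n φ = trans (∑-bfilter distinct (words n (upTo n)) φ)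
  (∑-ext (words n (upTo n)) (λ τ → cong (⟦ distinct τ ⟧ *_)
    (sym (trans (cong (λ t → ⟦ t ⟧ * φ τ) (all⁺ (λ _ → true) τ (λ _ → refl))) (ℤ.*-identityˡ (φ τ))))))

count-⊆-descents : ∀ n cs m → IsComp n (cs , m) →
  ∑ (permutations n) (λ τ → ⟦ within (descents 1 τ) (partialSums 0 cs) ⟧) ≡ multinomial cs m
count-⊆-descents n cs m (pos , eq) = trans (∑-permutations n _)
  (subst (λ k → arrangements (λ _ → true) k (fits 1 (partialSums 0 cs)) ≡ multinomial cs m) tot≡n
    (count-fits cs m 0 (λ _ → true) pos (trans (all-available U) (trans (length-upTo n) (sym tot≡n)))))
  where
  open Arrangements n
  tot≡n : total cs m ≡ n
  tot≡n = trans (total≡sum cs m) eq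
  all-available : ∀ (L : List ℕ) → length (bfilter (λ _ → true) L) ≡ length L
  all-available []      = refl
  all-available (x ∷ L) = cong suc (all-available L)

descents-< : ∀ i a τ → All (ℕ._< i ℕ.+ length τ) (descents i (a ∷ τ))
descents-< i a []      = []
descents-< i a (b ∷ τ) with b ℕ.<ᵇ a
... | true  = ℕ.m<m+n i (ℕ.s≤s ℕ.z≤n) ∷ subst (λ k → All (ℕ._< k) (descents (suc i) (b ∷ τ))) (sym (ℕ.+-suc i (length τ))) (descents-< (suc i) b τ)
... | false = subst (λ k → All (ℕ._< k) (descents (suc i) (b ∷ τ))) (sym (ℕ.+-suc i (length τ))) (descents-< (suc i) b τ)

sum∈partialSums : ∀ o c cs → o ℕ.+ sum (c ∷ cs) ∈ partialSums o (c ∷ cs)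
sum∈partialSums o c []       = here (cong (o ℕ.+_) (ℕ.+-identityʳ c))
sum∈partialSums o c (d ∷ cs) = there (subst (_∈ partialSums (o ℕ.+ c) (d ∷ cs)) (ℕ.+-assoc o c (sum (d ∷ cs))) (sum∈partialSums (o ℕ.+ c) d cs))

-- A composition ending in 0 has n among its partial sums, which is never a descent: the
-- convention β = 0 agrees with the count of permutations.
β-count : ∀ n cs m → IsComp n (cs , m) →
  + β n (cs , m) ≡ ∑ (permutations n) (λ τ → ⟦ descents 1 τ ==L partialSums 0 cs ⟧)
β-count n cs       (suc m) c = length-bfilter (λ τ → descents 1 τ ==L partialSums 0 cs) (permutations n)
β-count n []       zero (pos , refl) = refl
β-count n (c ∷ cs) zero (1≤c ∷ pos , eq) = sym (∑-zero (permutations n) (λ {τ} τ∈ →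
  cong ⟦_⟧ (==L-false (λ D≡ → never τ (proj₁ (∈-words⁻ n (proj₁ (∈-bfilter⁻ distinct (words n (upTo n)) τ∈))))
    (subst (_∈ descents 1 τ) (trans (sym (ℕ.+-identityʳ _)) eq) (subst (sum (c ∷ cs) ∈_) (sym D≡) (sum∈partialSums 0 c cs)))))))
  where
  never : ∀ τ → length τ ≡ n → n ∉ descents 1 τ
  never (a ∷ τ) refl n∈ = ℕ.<-irrefl refl (All.lookup (descents-< 1 a τ) n∈)

weight : PC → ℤ
weight (cs , m) = sgn (length cs) * multinomial cs m

∑-ups-weight : ∀ n cs m → IsComp n (cs , m) → ∑ (ups 0 cs m) weight ≡ sgn (length cs) * + β n (cs , m)
∑-ups-weight n cs m c@(pos , _) = begin
  ∑ (ups 0 cs m) weight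
    ≡⟨ ∑-cong (ups 0 cs m) (λ {d} d∈ → trans
         (cong (sgn (ρ d) *_) (sym (count-⊆-descents n (proj₁ d) (proj₂ d) (≤C-IsComp (ups0⇒≤C cs m d∈) c))))
         (sym (∑-*ˡ (permutations n) (sgn (ρ d)) _))) ⟩
  ∑ (ups 0 cs m) (λ d → ∑ (permutations n) (λ τ → sgn (ρ d) * ⟦ within (descents 1 τ) (partialSums 0 (proj₁ d)) ⟧))
    ≡⟨ ∑-swap (ups 0 cs m) (permutations n) _ ⟩
  ∑ (permutations n) (λ τ → ∑ (ups 0 cs m) (λ d → sgn (ρ d) * ⟦ within (descents 1 τ) (partialSums 0 (proj₁ d)) ⟧))
    ≡⟨ ∑-ext (permutations n) (λ τ → ∑-ups-within 0 0 0 cs m (descents 1 τ) refl pos (descents-↗ 1 τ)) ⟩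
  ∑ (permutations n) (λ τ → sgn (length cs) * ⟦ descents 1 τ ==L partialSums 0 cs ⟧)
    ≡⟨ ∑-*ˡ (permutations n) (sgn (length cs)) _ ⟩
  sgn (length cs) * ∑ (permutations n) (λ τ → ⟦ descents 1 τ ==L partialSums 0 cs ⟧)
    ≡⟨ cong (sgn (length cs) *_) (sym (β-count n cs m c)) ⟩
  sgn (length cs) * + β n (cs , m) ∎
  where open ≡-Reasoning

-- Adding one element at a time

Symmetric : (PIP → ℤ) → Set
Symmetric h = ∀ {c c′ m} → c ↭ c′ → h (c , m) ≡ h (c′ , m)

Symmetric-consC : ∀ {h} d → Symmetric h → Symmetric (h ∘ consC d)
Symmetric-consC d h-sym p = h-sym (prep d p)

-- Sum of h over the ways of placing one more element in an ordered pointed partition with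
-- block sizes c: into a block, as a new block anywhere among the others, or into the zero block.
insertion : (PIP → ℤ) → PIP → ℤ
insertion h ([]    , m) = h ([ 1 ] , m) + h ([] , suc m)
insertion h (d ∷ c , m) = h (suc d ∷ c , m) + (h (1 ∷ d ∷ c , m) + insertion (h ∘ consC d) (c , m))

insertion-cong : ∀ {h k} → h ≗ k → insertion h ≗ insertion k
insertion-cong h≗k ([]    , m) = cong₂ _+_ (h≗k _) (h≗k _)
insertion-cong h≗k (d ∷ c , m) =
  cong₂ _+_ (h≗k _) (cong₂ _+_ (h≗k _) (insertion-cong (h≗k ∘ consC d) (c , m)))

insertion-symmetric : ∀ h → Symmetric h → Symmetric (insertion h)
insertion-symmetric h h-sym Perm.refl        = refl
insertion-symmetric h h-sym (Perm.trans p q) = trans (insertion-symmetric h h-sym p) (insertion-symmetric h h-sym q)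
insertion-symmetric h h-sym (prep x p)       =
  cong₂ _+_ (h-sym (prep (suc x) p))
    (cong₂ _+_ (h-sym (prep 1 (prep x p))) (insertion-symmetric (h ∘ consC x) (Symmetric-consC {h} x h-sym) p))
insertion-symmetric h h-sym {x ∷ y ∷ c} {_ ∷ _ ∷ c′} {m} (swap x y p) = trans
  (cong₂ _+_ (h-sym (swap (suc x) y p)) (cong₂ _+_ (h-sym (prep 1 (swap x y p)))
    (cong₂ _+_ (h-sym (swap x (suc y) p)) (cong₂ _+_ (h-sym rotate) tail))))
  -- Swapping `x` and `y` exchanges the places of their two enlargements in the sum; the other terms
  -- match one by one.
  (reorder (h (y ∷ suc x ∷ c′ , m)) (h (1 ∷ y ∷ x ∷ c′ , m)) (h (suc y ∷ x ∷ c′ , m)) (h (y ∷ 1 ∷ x ∷ c′ , m)) _)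
  where
  reorder : ∀ a b c d e → a + (b + (c + (d + e))) ≡ c + (b + (a + (d + e)))
  reorder = solve-∀
  rotate : x ∷ 1 ∷ y ∷ c ↭ y ∷ 1 ∷ x ∷ c′
  rotate = ↭-trans (prep x (swap 1 y p)) (↭-trans (swap x y ↭-refl) (prep y (swap x 1 ↭-refl)))
  tail : insertion (λ s → h (consC x (consC y s))) (c , m) ≡ insertion (λ s → h (consC y (consC x s))) (c′ , m)
  tail = trans (insertion-cong (λ s → h-sym (swap x y ↭-refl)) (c , m))
    (insertion-symmetric (λ s → h (consC y (consC x s))) (λ q → h-sym (prep y (prep x q))) p)

iterate : ((PIP → ℤ) → PIP → ℤ) → ℕ → (PIP → ℤ) → PIP → ℤ
iterate L zero    h = h
iterate L (suc r) h = L (iterate L r h)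

iterate-comm : ∀ L r h → iterate L r (L h) ≡ L (iterate L r h)
iterate-comm L zero    h = refl
iterate-comm L (suc r) h = cong L (iterate-comm L r h)

iterate-insertion-symmetric : ∀ r h → Symmetric h → Symmetric (iterate insertion r h)
iterate-insertion-symmetric zero    h h-sym = h-sym
iterate-insertion-symmetric (suc r) h h-sym = insertion-symmetric _ (iterate-insertion-symmetric r h h-sym)

-- Σ of multinomial · h over the compositions of n with at most k ordinary parts.
∑-comps : ℕ → ℕ → (PIP → ℤ) → ℤ
∑-comps zero    n h = h ([] , n)
∑-comps (suc k) n h = h ([] , n) + ∑ (oneTo n) (λ d → + (n ℕ.C d) * ∑-comps k (n ℕ.∸ d) (h ∘ consC d))

∑-comps-+ : ∀ k n h g → ∑-comps k n (λ s → h s + g s) ≡ ∑-comps k n h + ∑-comps k n g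
∑-comps-+ zero    n h g = refl
∑-comps-+ (suc k) n h g = trans
  (+-congˡ (h ([] , n) + g ([] , n)) (trans
    (∑-ext (oneTo n) (λ d → trans
      (cong (+ (n ℕ.C d) *_) (∑-comps-+ k (n ℕ.∸ d) (h ∘ consC d) (g ∘ consC d)))
      (ℤ.*-distribˡ-+ (+ (n ℕ.C d)) (∑-comps k (n ℕ.∸ d) (h ∘ consC d)) (∑-comps k (n ℕ.∸ d) (g ∘ consC d)))))
    (∑-+ (oneTo n) (λ d → + (n ℕ.C d) * ∑-comps k (n ℕ.∸ d) (h ∘ consC d)) (λ d → + (n ℕ.C d) * ∑-comps k (n ℕ.∸ d) (g ∘ consC d)))))
  (regroup (h ([] , n)) (g ([] , n)) _ _)
  where
  regroup : ∀ a b c d → a + b + (c + d) ≡ a + c + (b + d)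
  regroup = solve-∀

∸-bound : ∀ {n k d} → n ℕ.≤ suc k → d ∈ oneTo n → n ℕ.∸ d ℕ.≤ k
∸-bound {n} {k} {d} n≤ d∈ = ℕ.≤-pred (ℕ.≤-trans (ℕ.+-monoˡ-≤ (n ℕ.∸ d) (proj₁ (∈-oneTo⁻ d∈)))
  (ℕ.≤-trans (ℕ.≤-reflexive (ℕ.m+[n∸m]≡n (proj₂ (∈-oneTo⁻ d∈)))) n≤))

-- A composition of `n` has at most `n` ordinary parts, so raising the bound beyond `n` adds no
-- terms.
∑-comps-stable : ∀ k n h → n ℕ.≤ k → ∑-comps (suc k) n h ≡ ∑-comps k n h
∑-comps-stable zero    zero h _  = ℤ.+-identityʳ _
∑-comps-stable (suc k) n    h n≤ = +-congˡ (h ([] , n)) (∑-cong (oneTo n) (λ {d} d∈ →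
  cong (+ (n ℕ.C d) *_) (∑-comps-stable k (n ℕ.∸ d) (h ∘ consC d) (∸-bound n≤ d∈))))

-- Pascal's rule splits the binomial of the first block according to whether the new element lies in
-- it. If it does, either it is alone, a new singleton in front (`b` and `N`), or it enlarges an old
-- first block (`P`). If not, it is inserted further on, by induction (`Q`). The term `a` has no
-- ordinary blocks: the element joins the zero block.
∑-comps-insertion : ∀ k n h → n ℕ.≤ k → ∑-comps (suc k) (suc n) h ≡ ∑-comps k n (insertion h)
∑-comps-insertion zero zero h _ = lemma (h ([] , 1)) (h ([ 1 ] , 0))
  where
  lemma : ∀ a b → a + (+ 1 * b + + 0) ≡ b + a
  lemma = solve-∀
∑-comps-insertion (suc k) n h n≤ = begin
  a + ∑ (oneTo (suc n)) (λ d → + (suc n ℕ.C d) * X (suc k) (suc n ℕ.∸ d) d)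
    ≡⟨ +-congˡ a (∑-map suc (upTo (suc n)) (λ d → + (suc n ℕ.C d) * X (suc k) (suc n ℕ.∸ d) d)) ⟩
  a + ∑ (upTo (suc n)) (λ e → + (suc n ℕ.C suc e) * X (suc k) (n ℕ.∸ e) (suc e))
    ≡⟨ +-congˡ a (trans (∑-ext (upTo (suc n)) (λ e → pascal e (X (suc k) (n ℕ.∸ e) (suc e))))
         (∑-+ (upTo (suc n)) (λ e → + (n ℕ.C e) * X (suc k) (n ℕ.∸ e) (suc e)) (λ e → + (n ℕ.C suc e) * X (suc k) (n ℕ.∸ e) (suc e)))) ⟩
  a + (∑ (upTo (suc n)) (λ e → + (n ℕ.C e) * X (suc k) (n ℕ.∸ e) (suc e))
       + ∑ (upTo (suc n)) (λ e → + (n ℕ.C suc e) * X (suc k) (n ℕ.∸ e) (suc e)))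
    ≡⟨ +-congˡ a (cong₂ _+_ bumped kept) ⟩
  a + (+ 1 * (b + N) + P + Q)
    ≡⟨ regroup a b N P Q ⟩
  b + a + (P + (N + Q))
    ≡⟨ cong (λ z → b + a + (P + z)) (sym (∑-+ (oneTo n) _ _)) ⟩
  b + a + (P + ∑ (oneTo n) (λ d → + (n ℕ.C d) * t d + + (n ℕ.C d) * q d))
    ≡⟨ +-congˡ (b + a) (sym (∑-+ (oneTo n) _ _)) ⟩
  b + a + ∑ (oneTo n) (λ d → + (n ℕ.C d) * p d + (+ (n ℕ.C d) * t d + + (n ℕ.C d) * q d))
    ≡⟨ +-congˡ (b + a) (∑-cong (oneTo n) fold) ⟩
  b + a + ∑ (oneTo n) (λ d → + (n ℕ.C d) * ∑-comps k (n ℕ.∸ d) (insertion h ∘ consC d)) ∎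
  where
  open ≡-Reasoning
  X : ℕ → ℕ → ℕ → ℤ
  X k n d = ∑-comps k n (h ∘ consC d)
  a = h ([] , suc n)
  b = h ([ 1 ] , n)
  p t q : ℕ → ℤ
  p d = ∑-comps k (n ℕ.∸ d) (λ s → h (consC (suc d) s))
  t d = ∑-comps k (n ℕ.∸ d) (λ s → h (consC 1 (consC d s)))
  q d = ∑-comps k (n ℕ.∸ d) (insertion (h ∘ consC d))
  P = ∑ (oneTo n) (λ d → + (n ℕ.C d) * p d)
  N = ∑ (oneTo n) (λ d → + (n ℕ.C d) * t d)
  Q = ∑ (oneTo n) (λ d → + (n ℕ.C d) * q d)
  pascal : ∀ e x → + (suc n ℕ.C suc e) * x ≡ + (n ℕ.C e) * x + + (n ℕ.C suc e) * x
  pascal e x = trans (cong (λ c → + c * x) (sym (ℕ.nCk+nC[k+1]≡[n+1]C[k+1] n e))) (ℤ.*-distribʳ-+ x (+ (n ℕ.C e)) (+ (n ℕ.C suc e)))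
  regroup : ∀ a b t p q → a + (+ 1 * (b + t) + p + q) ≡ b + a + (p + (t + q))
  regroup = solve-∀
  bumped : ∑ (upTo (suc n)) (λ e → + (n ℕ.C e) * X (suc k) (n ℕ.∸ e) (suc e)) ≡ + 1 * (b + N) + P
  bumped = trans (cong (λ xs → ∑ xs (λ e → + (n ℕ.C e) * X (suc k) (n ℕ.∸ e) (suc e))) (zeroTo≡0∷oneTo n))
    (+-congˡ (+ 1 * (b + N)) (∑-cong (oneTo n) (λ {d} d∈ → cong (+ (n ℕ.C d) *_)
      (∑-comps-stable k (n ℕ.∸ d) (h ∘ consC (suc d)) (∸-bound n≤ d∈)))))
  kept : ∑ (upTo (suc n)) (λ e → + (n ℕ.C suc e) * X (suc k) (n ℕ.∸ e) (suc e)) ≡ Q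
  kept = begin
    ∑ (upTo (suc n)) (λ e → + (n ℕ.C suc e) * X (suc k) (n ℕ.∸ e) (suc e))
      ≡⟨ ∑-upTo-suc n (λ e → + (n ℕ.C suc e) * X (suc k) (n ℕ.∸ e) (suc e)) ⟩
    ∑ (upTo n) (λ e → + (n ℕ.C suc e) * X (suc k) (n ℕ.∸ e) (suc e)) + + (n ℕ.C suc n) * X (suc k) (n ℕ.∸ n) (suc n)
      ≡⟨ cong₂ _+_ (∑-cong (upTo n) (λ {e} e∈ → cong (+ (n ℕ.C suc e) *_) (shift (∈-upTo⁻ e∈))))
                   (cong (λ c → + c * X (suc k) (n ℕ.∸ n) (suc n)) (ℕ.k>n⇒nCk≡0 (ℕ.n<1+n n))) ⟩
    ∑ (upTo n) (λ e → + (n ℕ.C suc e) * q (suc e)) + + 0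
      ≡⟨ ℤ.+-identityʳ (∑ (upTo n) (λ e → + (n ℕ.C suc e) * q (suc e))) ⟩
    ∑ (upTo n) (λ e → + (n ℕ.C suc e) * q (suc e))
      ≡⟨ sym (∑-map suc (upTo n) (λ d → + (n ℕ.C d) * q d)) ⟩
    Q ∎
    where
    shift : ∀ {e} → e ℕ.< n → X (suc k) (n ℕ.∸ e) (suc e) ≡ q (suc e)
    shift {e} e<n = trans (cong (λ j → X (suc k) j (suc e)) (ℕ.+-∸-assoc 1 e<n))
      (∑-comps-insertion k (n ℕ.∸ suc e) (h ∘ consC (suc e)) (∸-bound n≤ (∈-oneTo⁺ (ℕ.s≤s ℕ.z≤n) e<n)))
  fold : ∀ {d} → d ∈ oneTo n → + (n ℕ.C d) * p d + (+ (n ℕ.C d) * t d + + (n ℕ.C d) * q d)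
                             ≡ + (n ℕ.C d) * ∑-comps k (n ℕ.∸ d) (insertion h ∘ consC d)
  fold {d} _ = trans (factor (+ (n ℕ.C d)) (p d) (t d) (q d))
    (cong (+ (n ℕ.C d) *_) (sym (trans (∑-comps-+ k (n ℕ.∸ d) _ _) (+-congˡ (p d) (∑-comps-+ k (n ℕ.∸ d) _ _)))))
    where
    factor : ∀ c x y z → c * x + (c * y + c * z) ≡ c * (x + (y + z))
    factor = solve-∀

∑-comps-iterate : ∀ n h → ∑-comps n n h ≡ iterate insertion n h ([] , 0)
∑-comps-iterate zero    h = refl
∑-comps-iterate (suc n) h = trans (∑-comps-insertion n n h ℕ.≤-refl)
  (trans (∑-comps-iterate n (insertion h)) (cong (λ g → g ([] , 0)) (iterate-comm insertion n h)))

-- A second listing, by first part, that follows the recursion of `∑-comps`. `pointedCompositions`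
-- goes by length and pointed part, so the two lists are compared up to permutation.
comps : ℕ → ℕ → List PC
comps zero    n = ([] , n) ∷ []
comps (suc k) n = ([] , n) ∷ concatMap (λ d → map (consC d) (comps k (n ℕ.∸ d))) (oneTo n)

∈-comps⁻ : ∀ k n {x} → x ∈ comps k n → IsComp n x
∈-comps⁻ zero    n (here refl) = [] , refl
∈-comps⁻ (suc k) n (here refl) = [] , refl
∈-comps⁻ (suc k) n (there x∈) with concatMap⁻ (λ d → map (consC d) (comps k (n ℕ.∸ d))) (oneTo n) x∈
... | d , d∈ , x∈′ with ∈-map⁻ (consC d) x∈′
...   | (cs , m) , s∈ , refl with ∈-comps⁻ k (n ℕ.∸ d) s∈
...     | pos , eq = proj₁ (∈-oneTo⁻ d∈) ∷ pos ,
          trans (ℕ.+-assoc d (sum cs) m) (trans (cong (d ℕ.+_) eq) (ℕ.m+[n∸m]≡n (proj₂ (∈-oneTo⁻ d∈))))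

∈-comps⁺ : ∀ k n {cs m} → IsComp n (cs , m) → length cs ℕ.≤ k → (cs , m) ∈ comps k n
∈-comps⁺ zero    n {[]}     (_ , refl) _ = here refl
∈-comps⁺ (suc k) n {[]}     (_ , refl) _ = here refl
∈-comps⁺ (suc k) n {d ∷ cs} {m} (1≤d ∷ pos , eq) (ℕ.s≤s len) = there
  (concatMap⁺ (λ d → map (consC d) (comps k (n ℕ.∸ d))) (∈-oneTo⁺ 1≤d (subst (d ℕ.≤_) eq′ (ℕ.m≤m+n d _)))
    (∈-map⁺ (consC d) (∈-comps⁺ k (n ℕ.∸ d) (pos , sym (trans (cong (ℕ._∸ d) (sym eq′)) (ℕ.m+n∸m≡n d _))) len)))
  where
  eq′ : d ℕ.+ (sum cs ℕ.+ m) ≡ n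
  eq′ = trans (sym (ℕ.+-assoc d (sum cs) m)) eq

comps-Unique : ∀ k n → Unique (comps k n)
comps-Unique zero    n = [] ∷ []
comps-Unique (suc k) n = All.tabulate distinct-[] ∷
  concatMap-Unique longer (oneTo-Unique n) (λ d → Unique.map⁺ (consC-injective d) (comps-Unique k (n ℕ.∸ d))) same-head
  where
  longer : ℕ → List PC
  longer d = map (consC d) (comps k (n ℕ.∸ d))
  distinct-[] : ∀ {x} → x ∈ concatMap longer (oneTo n) → ([] , n) ≢ x
  distinct-[] x∈ refl with concatMap⁻ longer (oneTo n) x∈
  ... | d , _ , x∈′ with ∈-map⁻ (consC d) x∈′
  ...   | _ , _ , ()
  same-head : ∀ {c d z} → z ∈ longer c → z ∈ longer d → c ≡ d
  same-head {c} {d} z∈c z∈d with ∈-map⁻ (consC c) z∈c | ∈-map⁻ (consC d) z∈d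
  ... | _ , _ , refl | _ , _ , refl = refl

multi : PC → ℤ
multi (cs , m) = multinomial cs m

∑-comps≡ : ∀ k n h → ∑ (comps k n) (λ c → multi c * h c) ≡ ∑-comps k n h
∑-comps≡ zero    n h = trans (ℤ.+-identityʳ _) (ℤ.*-identityˡ _)
∑-comps≡ (suc k) n h = cong₂ _+_ (ℤ.*-identityˡ (h ([] , n)))
  (trans (∑-concatMap (λ d → map (consC d) (comps k (n ℕ.∸ d))) (oneTo n) (λ c → multi c * h c))
    (∑-cong (oneTo n) (λ {d} d∈ → trans (∑-map (consC d) (comps k (n ℕ.∸ d)) (λ c → multi c * h c))
      (trans (∑-cong (comps k (n ℕ.∸ d)) (λ {c} c∈ → trans
               (cong (λ j → + (j ℕ.C d) * multi c * h (consC d c)) (total≡ d∈ c∈))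
               (ℤ.*-assoc (+ (n ℕ.C d)) (multi c) (h (consC d c)))))
        (trans (∑-*ˡ (comps k (n ℕ.∸ d)) (+ (n ℕ.C d)) (λ c → multi c * h (consC d c)))
               (cong (+ (n ℕ.C d) *_) (∑-comps≡ k (n ℕ.∸ d) (h ∘ consC d))))))))
  where
  total≡ : ∀ {d} → d ∈ oneTo n → ∀ {c} → c ∈ comps k (n ℕ.∸ d) → d ℕ.+ total (proj₁ c) (proj₂ c) ≡ n
  total≡ {d} d∈ {cs , m} c∈ = trans (cong (d ℕ.+_) (trans (total≡sum cs m) (proj₂ (∈-comps⁻ k (n ℕ.∸ d) c∈))))
                                  (ℕ.m+[n∸m]≡n (proj₂ (∈-oneTo⁻ d∈)))

∑-pointedCompositions : ∀ n h → ∑ (pointedCompositions n) (λ c → multi c * h c) ≡ iterate insertion n h ([] , 0)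
∑-pointedCompositions n h = trans
  (∑-↭ (λ c → multi c * h c) (Unique-↭ (pointedCompositions-Unique n) (comps-Unique n n)
    (λ c∈ → let c = ∈-pointedCompositions⁻ n c∈ in ∈-comps⁺ n n c (IsComp-ρ c))
    (λ c∈ → ∈-pointedCompositions⁺ n (∈-comps⁻ n n c∈))))
  (trans (∑-comps≡ n n h) (∑-comps-iterate n h))

-- Set partitions built by reading restricted growth words

enlarge : ℕ → List ℕ → List ℕ
-- Opens a new block. On restricted growth words this case is reached only with `j = 0`.
enlarge j       []      = [ 1 ]
enlarge zero    (x ∷ v) = suc x ∷ v
enlarge (suc j) (x ∷ v) = x ∷ enlarge j v

place : ℕ → PIP → PIP
place zero    (v , m) = v , suc m
place (suc j) (v , m) = enlarge j v , m

-- The state holds the sizes of the ordinary blocks in label order, so its `ρ` is the largest label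
-- read so far.
run : PIP → List ℕ → PIP
run s []      = s
run s (a ∷ y) = run (place a s) y

∑-enlarge : (PIP → ℤ) → PIP → ℤ
∑-enlarge g ([]    , m) = + 0
∑-enlarge g (x ∷ v , m) = g (suc x ∷ v , m) + ∑-enlarge (g ∘ consC x) (v , m)

-- The unordered counterpart of `insertion`: blocks are labelled by first appearance, so a new one
-- has a single place, at the end.
placement : (PIP → ℤ) → PIP → ℤ
placement g (v , m) = g (v , suc m) + (∑-enlarge g (v , m) + g (v ++ [ 1 ] , m))

∑-place : ∀ g v m → ∑ (upTo (suc (suc (length v)))) (λ a → g (place a (v , m))) ≡ placement g (v , m)
∑-place g v m = trans (cong (λ xs → ∑ xs (λ a → g (place a (v , m)))) (zeroTo≡0∷oneTo (suc (length v))))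
  (+-congˡ (g (v , suc m)) (trans (∑-map suc (upTo (suc (length v))) (λ a → g (place a (v , m)))) (go g v)))
  where
  go : ∀ g v → ∑ (upTo (suc (length v))) (λ j → g (enlarge j v , m)) ≡ ∑-enlarge g (v , m) + g (v ++ [ 1 ] , m)
  go g []      = ℤ.+-comm (g ([ 1 ] , m)) (+ 0)
  go g (x ∷ v) = trans (cong (λ xs → ∑ xs (λ j → g (enlarge j (x ∷ v) , m))) (zeroTo≡0∷oneTo (suc (length v))))
    (trans (+-congˡ (g (suc x ∷ v , m)) (trans (∑-map suc (upTo (suc (length v))) (λ j → g (enlarge j (x ∷ v) , m))) (go (g ∘ consC x) v)))
           (sym (ℤ.+-assoc (g (suc x ∷ v , m)) _ _)))

length-enlarge : ∀ j v → j ℕ.≤ length v → length (enlarge j v) ≡ length v ℕ.⊔ suc j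
length-enlarge zero    []      j≤         = refl
length-enlarge zero    (x ∷ v) j≤         = cong suc (sym (ℕ.⊔-identityʳ (length v)))
length-enlarge (suc j) (x ∷ v) (ℕ.s≤s j≤) = cong suc (length-enlarge j v j≤)

length-place : ∀ a s → a ℕ.≤ suc (ρ s) → ρ (place a s) ≡ ρ s ℕ.⊔ a
length-place zero    (v , m) a≤          = sym (ℕ.⊔-identityʳ (length v))
length-place (suc j) (v , m) (ℕ.s≤s j≤) = length-enlarge j v j≤

-- Restricted growth lets the next letter be 0, ..., `ρ s + 1`, exactly the range of `∑-place`. The
-- bound keeps these labels inside `zeroTo n`.
∑-run : ∀ n r g s → r ℕ.+ ρ s ℕ.≤ n →
  ∑ (words r (zeroTo n)) (λ y → ⟦ validRGS (ρ s) y ⟧ * g (run s y)) ≡ iterate placement r g s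
∑-run n zero    g s bound = trans (ℤ.+-identityʳ _) (ℤ.*-identityˡ _)
∑-run n (suc r) g s@(v , m) bound = begin
  ∑ (words (suc r) (zeroTo n)) (λ y → ⟦ validRGS (ρ s) y ⟧ * g (run s y))
    ≡⟨ ∑-words r (zeroTo n) _ ⟩
  ∑ (zeroTo n) (λ a → ∑ ws (λ y → ⟦ (a ℕ.≤ᵇ suc (ρ s)) ∧ validRGS (ρ s ℕ.⊔ a) y ⟧ * g (run (place a s) y)))
    ≡⟨ ∑-ext (zeroTo n) (λ a → trans
         (∑-ext ws (λ y → ⟦∧⟧-* (a ℕ.≤ᵇ suc (ρ s)) (validRGS (ρ s ℕ.⊔ a) y) (g (run (place a s) y))))
         (∑-*ˡ ws ⟦ a ℕ.≤ᵇ suc (ρ s) ⟧ (λ y → ⟦ validRGS (ρ s ℕ.⊔ a) y ⟧ * g (run (place a s) y)))) ⟩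
  ∑ (zeroTo n) (λ a → ⟦ a ℕ.≤ᵇ suc (ρ s) ⟧ * after a)
    ≡⟨ ∑-upTo-restrict (suc (ρ s)) (suc n) after (ℕ.s≤s (ℕ.≤-trans (ℕ.s≤s (ℕ.m≤n+m (ρ s) r)) bound)) ⟩
  ∑ (upTo (suc (suc (ρ s)))) after
    ≡⟨ ∑-cong (upTo (suc (suc (ρ s)))) (λ a∈ → step (ℕ.≤-pred (∈-upTo⁻ a∈))) ⟩
  ∑ (upTo (suc (suc (ρ s)))) (λ a → iterate placement r g (place a s))
    ≡⟨ ∑-place (iterate placement r g) v m ⟩
  iterate placement (suc r) g s ∎
  where
  open ≡-Reasoning
  ws = words r (zeroTo n)
  after : ℕ → ℤ
  after a = ∑ ws (λ y → ⟦ validRGS (ρ s ℕ.⊔ a) y ⟧ * g (run (place a s) y))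
  step : ∀ {a} → a ℕ.≤ suc (ρ s) → after a ≡ iterate placement r g (place a s)
  step {a} a≤ = trans
    (cong (λ k → ∑ ws (λ y → ⟦ validRGS k y ⟧ * g (run (place a s) y))) (sym (length-place a s a≤)))
    (∑-run n r g (place a s) (ℕ.≤-trans (ℕ.+-monoʳ-≤ r
      (ℕ.≤-trans (ℕ.≤-reflexive (length-place a s a≤)) (ℕ.⊔-lub (ℕ.n≤1+n (ρ s)) a≤)))
      (ℕ.≤-trans (ℕ.≤-reflexive (ℕ.+-suc r (ρ s))) bound)))

∑-enlarge-cong : ∀ {g h : PIP → ℤ} → g ≗ h → ∑-enlarge g ≗ ∑-enlarge h
∑-enlarge-cong g≗h ([]    , m) = refl
∑-enlarge-cong g≗h (x ∷ v , m) = cong₂ _+_ (g≗h _) (∑-enlarge-cong (g≗h ∘ consC x) (v , m))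

placement-cong : ∀ {g h : PIP → ℤ} → g ≗ h → placement g ≗ placement h
placement-cong g≗h (v , m) = cong₂ _+_ (g≗h _) (cong₂ _+_ (∑-enlarge-cong g≗h (v , m)) (g≗h _))

∑-enlarge-scale : ∀ (c : ℕ → ℤ) h v m → ∑-enlarge (λ s → c (ρ s) * h s) (v , m) ≡ c (length v) * ∑-enlarge h (v , m)
∑-enlarge-scale c h []      m = sym (ℤ.*-zeroʳ (c 0))
∑-enlarge-scale c h (x ∷ v) m = trans
  (+-congˡ (c (suc (length v)) * h (suc x ∷ v , m)) (∑-enlarge-scale (c ∘ suc) (h ∘ consC x) v m))
  (sym (ℤ.*-distribˡ-+ (c (suc (length v))) (h (suc x ∷ v , m)) _))

-- For symmetric `h` all `suc (length v)` places for the new singleton give the same value, so it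
-- can be put in front.
insertion-expand : ∀ h → Symmetric h → ∀ v m →
  insertion h (v , m) ≡ h (v , suc m) + (∑-enlarge h (v , m) + + suc (length v) * h (1 ∷ v , m))
insertion-expand h h-sym []      m = lemma (h ([ 1 ] , m)) (h ([] , suc m))
  where
  lemma : ∀ a b → a + b ≡ b + (+ 0 + + 1 * a)
  lemma = solve-∀
insertion-expand h h-sym (x ∷ v) m = trans
  (cong (λ z → h (suc x ∷ v , m) + (h (1 ∷ x ∷ v , m) + z)) (trans
    (insertion-expand (h ∘ consC x) (Symmetric-consC {h} x h-sym) v m)
    (cong (λ z → h (x ∷ v , suc m) + (∑-enlarge (h ∘ consC x) (v , m) + + suc (length v) * z)) (h-sym (swap x 1 ↭-refl)))))
  (lemma (h (suc x ∷ v , m)) (h (1 ∷ x ∷ v , m)) (h (x ∷ v , suc m)) (∑-enlarge (h ∘ consC x) (v , m)) (+ suc (length v)))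
  where
  lemma : ∀ a b c d k → a + (b + (c + (d + k * b))) ≡ c + (a + d + (+ 1 + k) * b)
  lemma = solve-∀

-- There are k! orders on the k ordinary blocks, and a new block can be inserted at k + 1 places.
placement-factorial : ∀ h → Symmetric h →
  placement (λ s → + (ρ s ℕ.!) * h s) ≗ (λ s → + (ρ s ℕ.!) * insertion h s)
placement-factorial h h-sym (v , m) = begin
  k! * h (v , suc m) + (∑-enlarge (λ s → + (ρ s ℕ.!) * h s) (v , m) + + (length (v ++ [ 1 ]) ℕ.!) * h (v ++ [ 1 ] , m))
    ≡⟨ cong₂ (λ x y → k! * h (v , suc m) + (x + y)) (∑-enlarge-scale (λ k → + (k ℕ.!)) h v m)
         (cong₂ _*_ (trans (cong (λ l → + (l ℕ.!)) (length-∷ʳ v 1)) (ℤ.pos-* (suc (length v)) (length v ℕ.!)))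
                    (h-sym (↭-sym (Perm.∷↭∷ʳ 1 v)))) ⟩
  k! * h (v , suc m) + (k! * ∑-enlarge h (v , m) + + suc (length v) * k! * h (1 ∷ v , m))
    ≡⟨ lemma k! (h (v , suc m)) (∑-enlarge h (v , m)) (+ suc (length v)) (h (1 ∷ v , m)) ⟩
  k! * (h (v , suc m) + (∑-enlarge h (v , m) + + suc (length v) * h (1 ∷ v , m)))
    ≡⟨ cong (k! *_) (sym (insertion-expand h h-sym v m)) ⟩
  k! * insertion h (v , m) ∎
  where
  open ≡-Reasoning
  k! = + (length v ℕ.!)
  lemma : ∀ f a b k c → f * a + (f * b + k * f * c) ≡ f * (a + (b + k * c))
  lemma = solve-∀

iterate-placement : ∀ r h → Symmetric h →
  iterate placement r (λ s → + (ρ s ℕ.!) * h s) ≗ (λ s → + (ρ s ℕ.!) * iterate insertion r h s)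
iterate-placement zero    h h-sym s = refl
iterate-placement (suc r) h h-sym s = trans (placement-cong (iterate-placement r h h-sym) s)
  (placement-factorial (iterate insertion r h) (iterate-insertion-symmetric r h h-sym) s)

signedFactorial≡ : ∀ k → signedFactorial k ≡ + (k ℕ.!) * sgn k
signedFactorial≡ zero    = refl
signedFactorial≡ (suc k) = trans (cong (λ z → - (+ suc k * z)) (signedFactorial≡ k))
  (trans (lemma (+ suc k) (+ (k ℕ.!)) (sgn k)) (cong (_* sgn (suc k)) (sym (ℤ.pos-* (suc k) (k ℕ.!)))))
  where
  lemma : ∀ a b c → - (a * (b * c)) ≡ a * b * (- (+ 1) * c)
  lemma = solve-∀

ρ-run : ∀ s y → validRGS (ρ s) y ≡ true → ρ (run s y) ≡ finalMax (ρ s) y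
ρ-run s []      v = refl
ρ-run s (a ∷ y) v with validRGS-∷⁻ (ρ s) a y v
... | a≤ , v′ = trans (ρ-run (place a s) y (subst (λ k → validRGS k y ≡ true) (sym (length-place a s a≤)) v′))
                      (cong (λ k → finalMax k y) (length-place a s a≤))

at-enlarge : ∀ j v i → j ℕ.≤ length v → at (enlarge j v) i ≡ (if i ℕ.≡ᵇ j then 1 else 0) ℕ.+ at v i
at-enlarge zero    []      zero    j≤         = refl
at-enlarge zero    []      (suc i) j≤         = refl
at-enlarge zero    (x ∷ v) zero    j≤         = refl
at-enlarge zero    (x ∷ v) (suc i) j≤         = refl
at-enlarge (suc j) (x ∷ v) zero    j≤         = refl
at-enlarge (suc j) (x ∷ v) (suc i) (ℕ.s≤s j≤) = at-enlarge j v i j≤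

count-∷ : ∀ j a y → count j (a ∷ y) ≡ (if j ℕ.≡ᵇ a then 1 else 0) ℕ.+ count j y
count-∷ j a y with j ℕ.≡ᵇ a
... | true  = refl
... | false = refl

run-sizes : ∀ s y → validRGS (ρ s) y ≡ true → ∀ i → at (proj₁ (run s y)) i ≡ at (proj₁ s) i ℕ.+ count (suc i) y
run-sizes s []      v i = sym (ℕ.+-identityʳ _)
run-sizes s (a ∷ y) v i with validRGS-∷⁻ (ρ s) a y v
... | a≤ , v′ = trans (run-sizes (place a s) y (subst (λ k → validRGS k y ≡ true) (sym (length-place a s a≤)) v′) i)
                      (trans (placed a s a≤) (cong (at (proj₁ s) i ℕ.+_) (sym (count-∷ (suc i) a y))))
  where
  placed : ∀ a s → a ℕ.≤ suc (ρ s) → at (proj₁ (place a s)) i ℕ.+ count (suc i) y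
         ≡ at (proj₁ s) i ℕ.+ ((if suc i ℕ.≡ᵇ a then 1 else 0) ℕ.+ count (suc i) y)
  placed zero    s       a≤         = refl
  placed (suc j) (v , m) (ℕ.s≤s j≤) = trans
    (cong (ℕ._+ count (suc i) y) (trans (at-enlarge j v i j≤) (ℕ.+-comm (if i ℕ.≡ᵇ j then 1 else 0) (at v i))))
    (ℕ.+-assoc (at v i) _ _)

run-zero : ∀ s y → proj₂ (run s y) ≡ proj₂ s ℕ.+ count 0 y
run-zero s       []          = sym (ℕ.+-identityʳ _)
run-zero (v , m) (zero ∷ y)  = trans (run-zero (v , suc m) y) (sym (ℕ.+-suc m (count 0 y)))
run-zero (v , m) (suc j ∷ y) = run-zero (enlarge j v , m) y

enlarge-positive : ∀ j {v} → All (1 ℕ.≤_) v → All (1 ℕ.≤_) (enlarge j v)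
enlarge-positive j       []          = ℕ.s≤s ℕ.z≤n ∷ []
enlarge-positive zero    (1≤x ∷ pos) = ℕ.s≤s ℕ.z≤n ∷ pos
enlarge-positive (suc j) (1≤x ∷ pos) = 1≤x ∷ enlarge-positive j pos

run-positive : ∀ s y → All (1 ℕ.≤_) (proj₁ s) → All (1 ℕ.≤_) (proj₁ (run s y))
run-positive s       []          pos = pos
run-positive (v , m) (zero ∷ y)  pos = run-positive (v , suc m) y pos
run-positive (v , m) (suc j ∷ y) pos = run-positive (enlarge j v , m) y (enlarge-positive j pos)

parts-at : ∀ v n → All (1 ℕ.≤_) v → length v ℕ.≤ n → parts (at v) (upTo n) ≡ v
parts-at []      n       pos         len         = parts-zero (upTo n) (λ _ → refl)
parts-at (x ∷ v) (suc n) (1≤x ∷ pos) (ℕ.s≤s len) = trans (cong (parts (at (x ∷ v))) (zeroTo≡0∷oneTo n))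
  (trans (parts-∷ (at (x ∷ v)) 0 (map suc (upTo n)))
    (trans (consPart-pos (parts (at (x ∷ v)) (map suc (upTo n))) 1≤x)
      (cong (x ∷_) (trans (cong (bfilter (λ c → not (c ==ℕ 0))) (sym (map-∘ (upTo n)))) (parts-at v n pos len)))))

run-length-bound : ∀ s y → ρ (run s y) ℕ.≤ ρ s ℕ.+ length y
run-length-bound s       []          = ℕ.≤-reflexive (sym (ℕ.+-identityʳ _))
run-length-bound (v , m) (zero ∷ y)  = ℕ.≤-trans (run-length-bound (v , suc m) y) (ℕ.+-monoʳ-≤ (length v) (ℕ.n≤1+n _))
run-length-bound (v , m) (suc j ∷ y) = ℕ.≤-trans (run-length-bound (enlarge j v , m) y)
  (ℕ.≤-trans (ℕ.+-monoˡ-≤ (length y) (bound j v)) (ℕ.≤-reflexive (sym (ℕ.+-suc (length v) (length y)))))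
  where
  bound : ∀ j v → length (enlarge j v) ℕ.≤ suc (length v)
  bound j       []      = ℕ.s≤s ℕ.z≤n
  bound zero    (x ∷ v) = ℕ.n≤1+n _
  bound (suc j) (x ∷ v) = ℕ.s≤s (bound j v)

-- In a restricted growth word the nonempty ordinary blocks carry the labels 1, ..., k without gaps,
-- so discarding the zero counts keeps the sizes in label order.
run≡blockSizes : ∀ n y → length y ≡ n → validRGS 0 y ≡ true → run ([] , 0) y ≡ blockSizes n y
run≡blockSizes n y len v = cong₂ _,_
  (trans (sym (parts-at w n (run-positive ([] , 0) y []) (subst (length w ℕ.≤_) len (run-length-bound ([] , 0) y))))
    (trans (parts-cong (upTo n) (λ {i} _ → run-sizes ([] , 0) y v i))
           (cong (bfilter (λ c → not (c ==ℕ 0))) (map-∘ (upTo n)))))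
  (run-zero ([] , 0) y)
  where w = proj₁ (run ([] , 0) y)

∑-ΠF≡∑-CF : ∀ n F → ∑ (ΠF n F) (λ y → signedFactorial (finalMax 0 y)) ≡ ∑ (CF n F) weight
∑-ΠF≡∑-CF n F = begin
  ∑ (ΠF n F) (λ y → signedFactorial (finalMax 0 y))
    ≡⟨ ∑-bfilter (λ y → F (typeΠ n y)) (pointedSetPartitions n) _ ⟩
  ∑ (pointedSetPartitions n) (λ y → ⟦ F (typeΠ n y) ⟧ * signedFactorial (finalMax 0 y))
    ≡⟨ ∑-cong (pointedSetPartitions n) by-run ⟩
  ∑ (pointedSetPartitions n) (λ y → H (run ([] , 0) y))
    ≡⟨ ∑-bfilter (validRGS 0) (words n (zeroTo n)) (λ y → H (run ([] , 0) y)) ⟩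
  ∑ (words n (zeroTo n)) (λ y → ⟦ validRGS 0 y ⟧ * H (run ([] , 0) y))
    ≡⟨ ∑-run n n H ([] , 0) (ℕ.≤-reflexive (ℕ.+-identityʳ n)) ⟩
  iterate placement n H ([] , 0)
    ≡⟨ trans (iterate-placement n h h-sym ([] , 0)) (ℤ.*-identityˡ _) ⟩
  iterate insertion n h ([] , 0)
    ≡⟨ sym (∑-pointedCompositions n h) ⟩
  ∑ (pointedCompositions n) (λ c → multi c * h c)
    ≡⟨ ∑-ext (pointedCompositions n) (λ c → reorder (multi c) ⟦ F (typeC c) ⟧ (sgn (ρ c))) ⟩
  ∑ (pointedCompositions n) (λ c → ⟦ F (typeC c) ⟧ * weight c)
    ≡⟨ sym (∑-bfilter (λ c → F (typeC c)) (pointedCompositions n) weight) ⟩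
  ∑ (CF n F) weight ∎
  where
  open ≡-Reasoning
  h H : PIP → ℤ
  -- The part common to both weights: a set partition contributes it with the factor k!, a
  -- composition with its multinomial coefficient.
  h s = ⟦ F (typeC s) ⟧ * sgn (ρ s)
  H s = + (ρ s ℕ.!) * h s
  h-sym : Symmetric h
  -- `F` sees only the sorted parts, and the sign only their number.
  h-sym {m = m} p = cong₂ (λ cs l → ⟦ F (cs , m) ⟧ * sgn l) (sort-cong-↭ p) (Perm.↭-length p)
  reorder : ∀ a b c → a * (b * c) ≡ b * (c * a)
  reorder = solve-∀
  reorder′ : ∀ a b c → a * (b * c) ≡ b * (a * c)
  reorder′ = solve-∀
  by-run : ∀ {y} → y ∈ pointedSetPartitions n →
           ⟦ F (typeΠ n y) ⟧ * signedFactorial (finalMax 0 y) ≡ H (run ([] , 0) y)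
  by-run {y} y∈ with ∈-PSP⁻ n y∈
  ... | v , len , _ = trans
    (cong₂ (λ s z → ⟦ F (typeC s) ⟧ * z) (sym (run≡blockSizes n y len v))
      (trans (cong signedFactorial (sym (ρ-run ([] , 0) y v))) (signedFactorial≡ (ρ (run ([] , 0) y)))))
    (reorder′ ⟦ F (typeC (run ([] , 0) y)) ⟧ (+ (ρ (run ([] , 0) y) ℕ.!)) (sgn (ρ (run ([] , 0) y))))

theorem3p1 : (n : ℕ) (F : PIP → Bool) → IsFilter n F → NonemptyIn n F →
    möbius (ΠF∪0̂ n F) nothing (top̂Π n)
    ≡ ℤsum (map (λ c → ((- (+ 1)) ^ ρ c) * möbius (CF∪0̂ n F) nothing (just c) * (+ β n c))
    (CF n F))
theorem3p1 n F isF nonempty = begin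
  möbius (ΠF∪0̂ n F) nothing (top̂Π n)
    ≡⟨ möbius-ΠF n F isF nonempty ⟩
  - ∑ (ΠF n F) (λ y → signedFactorial (finalMax 0 y))
    ≡⟨ cong -_ (∑-ΠF≡∑-CF n F) ⟩
  - ∑ (CF n F) weight
    ≡⟨ sym (∑-möbius-transform (CF n F) _ _ (CF-isFinPoset n F) (λ _ → refl) weight (λ c → sgn (ρ c) * + β n c)
         (λ {c} c∈ → trans (∑-up-set n F isF c∈ weight) (∑-ups-weight n (proj₁ c) (proj₂ c) (proj₁ (∈-CF⁻ n F c∈))))) ⟩
  ∑ (CF n F) (λ c → sgn (ρ c) * + β n c * μ c)
    ≡⟨ ∑-ext (CF n F) (λ c → reorder (sgn (ρ c)) (+ β n c) (μ c)) ⟩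
  ∑ (CF n F) (λ c → sgn (ρ c) * μ c * + β n c) ∎
  where
  open ≡-Reasoning
  μ : PC → ℤ
  μ c = möbius (CF∪0̂ n F) nothing (just c)
  reorder : ∀ a b c → a * b * c ≡ a * c * b
  reorder = solve-∀
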